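{- For undirected $n$-vertex graphs the following hold. (1) (Exact hopsets) For weighted graphs, exact hopsets of linear size admit a worst-case hopbound of $\beta=\Omega(n^{1/3})$. For undirected unweighted graphs the lower bound becomes $\beta=\Omega(n^{1/5})$. (2) (Hopsets with sublinear error) Any hopset with $f(d)\le d+O(k d^{1-1/k})+\widetilde{O}(1)$ and $\beta=O(k d^{1-1/k})+\widetilde{O}(1)$ requires in the worst case $\Omega\left(n^{1+1/(2^k-1)-o(1)}\right)$ edges.
   Context: $\widetilde{O}(\cdot)$ hides $\mathrm{poly}(\log n)$ factors. $\mathrm{dist}^{(\beta)}_{G'}(u,v)$ is the minimum length of a $u$-$v$ path in $G'$ with at most $\beta$ edges (hops). For a graph $G=(V,E)$, a set $H\subseteq V\times V$ of edges, each weighted by the $G$-distance between its endpoints, is a $(\beta,\epsilon)$-hopset if $\mathrm{dist}_G(u,v)\le\mathrm{dist}^{(\beta)}_{G\cup H}(u,v)\le(1+\epsilon)\,\mathrm{dist}_G(u,v)$ for all $u,v\in V$; $\beta$ is its hopbound, and an exact hopset is a $(\beta,0)$-hopset. Linear size means $O(n)$ edges. In (2), $d$ stands for the distance in $G$ of a vertex pair, $f(d)$ for the bound on its approximate distance (in place of $(1+\epsilon)d$), and $\beta$ for the hopbound. -}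

module Defs where

open import Data.Bool using (Bool; T)
open import Data.Fin using (Fin)
open import Data.Integer using (+_; -[1+_])
open import Data.List using (List; length)
open import Data.List.Membership.Propositional using (_∈_)
open import Data.List.Relation.Unary.Unique.Propositional using (Unique)
open import Data.Nat using (ℕ; suc; _+_; _*_; _∸_; _^_; _≤_; _≥_; NonZero; >-nonZero; >-nonZero⁻¹; s≤s; z≤n)
open import Data.Nat.Logarithm using (⌈log₂_⌉)
open import Data.Nat.Properties using (m<n⇒0<n∸m; ^-monoʳ-<)
open import Data.Product using (∃-syntax; _×_; _,_)
open import Data.Rational as ℚ using (ℚ; 0ℚ; 1ℚ)
open import Data.Rational.Literals using (fromℤ)
open import Data.Rational.Unnormalised as ℚᵘ using (ℚᵘ; mkℚᵘ; 1ℚᵘ)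
open import Data.Sum using (_⊎_)
open import Relation.Binary.PropositionalEquality using (_≡_)
open import Relation.Nullary using (¬_)

fromℕ : ℕ → ℚ
fromℕ d = fromℤ (+ d)

-- Finite simple undirected graphs on the vertex set Fin n with positive edge
-- weights; `weight` is only meaningful on adjacent pairs.
record Graph (n : ℕ) : Set where
  field
    adj        : Fin n → Fin n → Bool
    adj-sym    : ∀ {u v} → T (adj u v) → T (adj v u)
    adj-irrefl : ∀ {u} → ¬ T (adj u u)
    weight     : Fin n → Fin n → ℚ
    weight-sym : ∀ {u v} → T (adj u v) → weight u v ≡ weight v u
    weight-pos : ∀ {u v} → T (adj u v) → ℚ.Positive (weight u v)

Unweighted : ∀ {n} → Graph n → Set
Unweighted G = ∀ {u v} → T (adj u v) → weight u v ≡ 1ℚ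
  where open Graph G

-- `E u v w` says that there is an edge of weight w from u to v; parallel edges
-- of different weights are possible (they occur in G ∪ H below).
Edges : ℕ → Set₁
Edges n = Fin n → Fin n → ℚ → Set

infixr 5 _∷_

data Walk {n} (E : Edges n) : Fin n → Fin n → Set where
  []  : ∀ {u} → Walk E u u
  _∷_ : ∀ {u v t w} → E u v w → Walk E v t → Walk E u t

hops : ∀ {n} {E : Edges n} {u v} → Walk E u v → ℕ
hops []      = 0
hops (_ ∷ p) = suc (hops p)

len : ∀ {n} {E : Edges n} {u v} → Walk E u v → ℚ
len []                = 0ℚ
len (_∷_ {w = w} _ p) = w ℚ.+ len p

-- Distances are functional relations, so that an infinite distance is the
-- absence of a related value.  Since no weight is negative, minimising over
-- walks and over simple paths gives the same value.
Dist : ∀ {n} → Edges n → Fin n → Fin n → ℚ → Set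
Dist E u v d = (∃[ p ] len {E = E} {u} {v} p ≡ d)
             × ((p : Walk E u v) → d ℚ.≤ len p)

HopDist : ∀ {n} → ℕ → Edges n → Fin n → Fin n → ℚ → Set
HopDist β E u v d = (∃[ p ] hops {E = E} {u} {v} p ≤ β × len p ≡ d)
                  × ((p : Walk E u v) → hops p ≤ β → d ℚ.≤ len p)

edges : ∀ {n} → Graph n → Edges n
edges G u v w = T (adj u v) × weight u v ≡ w
  where open Graph G

record PairSet (n : ℕ) : Set where
  field
    pairs  : List (Fin n × Fin n)
    unique : Unique pairs

∣_∣ : ∀ {n} → PairSet n → ℕ
∣ H ∣ = length (PairSet.pairs H)

-- Pairs of H are used as undirected edges; a pair at infinite G-distance
-- contributes no edge.
_∪_ : ∀ {n} → Graph n → PairSet n → Edges n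
(G ∪ H) u v w = edges G u v w
              ⊎ (((u , v) ∈ pairs) ⊎ ((v , u) ∈ pairs)) × Dist (edges G) u v w
  where open PairSet H

-- d ≤ dist^(β)_{G∪H}(u,v) ≤ b
Approx : ∀ {n} → Graph n → PairSet n → (β : ℕ) → Fin n → Fin n → (d b : ℚ) → Set
Approx G H β u v d b = ∃[ d′ ] HopDist β (G ∪ H) u v d′ × d ℚ.≤ d′ × d′ ℚ.≤ b

-- Pairs at infinite G-distance need no condition: they are also at infinite
-- distance in G ∪ H.
IsHopset : ∀ {n} → Graph n → PairSet n → (β : ℕ) → (ε : ℚ) → Set
IsHopset G H β ε = ∀ {u v d} → Dist (edges G) u v d →
  Approx G H β u v d ((1ℚ ℚ.+ ε) ℚ.* d)

-- The variant in which a pair at distance d has hopbound β d and approximate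
-- distance at most f d; for unweighted G, whose distances are integers.
IsHopsetᶠ : ∀ {n} → Graph n → PairSet n → (β f : ℕ → ℕ) → Set
IsHopsetᶠ G H β f = ∀ {u v} (d : ℕ) → Dist (edges G) u v (fromℕ d) →
  Approx G H (β d) u v (fromℕ d) (fromℕ (f d))

-- Comparisons of naturals with real powers, cleared of roots and negative
-- exponents.  Both depend only on the value of the exponent, not on the
-- fraction representing it (for a negative exponent the base must be nonzero).

-- n ^ e ≤ y
⟨_^_⟩≤_ : ℕ → ℚᵘ → ℕ → Set
⟨ n ^ mkℚᵘ (+ p)    q-1 ⟩≤ y = n ^ p ≤ y ^ suc q-1
⟨ n ^ mkℚᵘ -[1+ m ] q-1 ⟩≤ y = 1 ≤ y ^ suc q-1 * n ^ suc m

-- x ≤ c · d ^ e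
_≤_·⟨_^_⟩ : ℕ → ℕ → ℕ → ℚᵘ → Set
x ≤ c ·⟨ d ^ mkℚᵘ (+ p)    q-1 ⟩ = x ^ suc q-1 ≤ c ^ suc q-1 * d ^ p
x ≤ c ·⟨ d ^ mkℚᵘ -[1+ m ] q-1 ⟩ = x ^ suc q-1 * d ^ suc m ≤ c ^ suc q-1

infix 4 ⟨_^_⟩≤_ _≤_·⟨_^_⟩

-- g n d ≤ O(k · d ^ (1 - 1/k)) + Õ(1), the constants and the exponent of the
-- logarithm being uniform in n and d.  The Õ(1) term is subtracted on the left
-- because the other summand need not be a natural number.
Sublinear : (k : ℕ) .{{_ : NonZero k}} → (ℕ → ℕ → ℕ) → Set
Sublinear k g = ∃[ C ] ∃[ a ] ∃[ n₀ ] (∀ n → n ≥ n₀ → ∀ d →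
  g n d ∸ C * ⌈log₂ n ⌉ ^ a ≤ (C * k) ·⟨ d ^ 1ℚᵘ ℚᵘ.- + 1 ℚᵘ./ k ⟩)

-- δ = o(1)
Vanishing : (ℕ → ℚᵘ) → Set
Vanishing δ = ∀ ε → ℚᵘ.Positive ε → ∃[ N ] (∀ n → n ≥ N → ℚᵘ.∣ δ n ∣ ℚᵘ.< ε)

2^k∸1≢0 : ∀ k .{{_ : NonZero k}} → NonZero (2 ^ k ∸ 1)
2^k∸1≢0 k = >-nonZero (m<n⇒0<n∸m (^-monoʳ-< 2 (s≤s (s≤s z≤n)) (>-nonZero⁻¹ k)))

sizeExponent : (k : ℕ) .{{_ : NonZero k}} → ℚᵘ
sizeExponent k = 1ℚᵘ ℚᵘ.+ ℚᵘ._/_ (+ 1) (2 ^ k ∸ 1) {{2^k∸1≢0 k}}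

{-# OPTIONS --safe #-}
module Submission where

open import Defs
open import Data.Integer using (+_)
open import Data.Nat using (ℕ; _+_; _*_; _≤_; _≥_; NonZero)
open import Data.Product using (∃-syntax; _×_)
open import Data.Rational using (0ℚ)
open import Data.Rational.Unnormalised using (_/_; _-_)
open import Data.Bool using (Bool; true; false; T; if_then_else_; _∧_; T?)
open import Data.Empty using (⊥; ⊥-elim)
open import Data.Fin as Fin using (Fin; toℕ)
import Data.Fin.Properties as Fin
import Data.Integer as ℤ
import Data.Integer.Properties as ℤ
open import Data.List using (List; []; _∷_; _++_; length; lookup; replicate)
open import Data.List.Membership.Propositional using (_∈_)
open import Data.List.Properties using (length-++; length-map)
open import Data.List.Relation.Unary.Any using (index)
open import Data.List.Relation.Unary.Any.Properties using (lookup-index)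
open import Data.Maybe using (Maybe; just; nothing)
open import Data.Maybe.Properties using (just-injective)
import Data.Nat as ℕ
open import Data.Nat using (zero; suc; _∸_; _^_; _<_; z≤n; s≤s; s≤s⁻¹; nonZero; >-nonZero; >-nonZero⁻¹; _≟_; _≤?_; _<?_) renaming (∣_-_∣ to gap)
import Data.Nat.DivMod as ℕ
open import Data.Nat.DivMod using (_mod_; m%n<n; m/n*n≤m; m≡m%n+[m/n]*n)
open import Data.Nat.Logarithm using (⌈log₂_⌉; ⌈log₂⌉-mono-≤; ⌈log₂2^n⌉≡n)
open import Data.Nat.Properties
open import Data.Nat.Tactic.RingSolver using (solve-∀)
open import Data.Product using (Σ; _,_; proj₁; proj₂) renaming (swap to ×-swap)
import Data.Product.Properties as ×
import Data.Rational as ℚ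
open import Data.Rational using (ℚ; 1ℚ)
import Data.Rational.Properties as ℚ
import Data.Rational.Unnormalised as ℚᵘ
import Data.Rational.Unnormalised.Properties as ℚᵘ
open import Data.Sum using (_⊎_; inj₁; inj₂; [_,_]′; swap)
open import Data.Unit using (⊤; tt)
open import Data.Vec as Vec using (Vec; []; _∷_)
import Data.Vec.Properties as Vec
open import Function using (_∘_; id)
open import Relation.Binary.Definitions using (tri<; tri≈; tri>)
open import Relation.Binary.PropositionalEquality using (_≡_; _≢_; refl; sym; trans; cong; cong₂; subst; subst₂; module ≡-Reasoning)
open import Relation.Nullary using (¬_; Dec; yes; no)
open import Relation.Nullary.Decidable using (toWitness; fromWitness; ⌊_⌋; _×-dec_; _⊎-dec_; decidable-stable)
open import Algebra.Properties.CommutativeSemigroup +-commutativeSemigroup using (interchange)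

-- Part (1).  Two points determine a line, so a shortcut between two vertices of a grid serves at
-- most one of the lines running through it.  If each line is the only shortest path between its
-- ends and there are more lines than pairs in H, some line has to be walked edge by edge.
--
-- Part (2).  The graph is layered by time; its vertices are the states of a small machine and an
-- edge performs one instruction.  A line fixes the vector that the machine adds to its registers
-- in each of R rounds.  As the registers also accumulate squared norms, equality in Jensen's
-- inequality shows that a walk between the ends of a line adds the right vectors, provided it never
-- undoes an instruction; instructions are separated by so many idle layers that undoing one costs
-- more than the permitted error.  At the next level the machine of the previous level is run inside
-- each round, and the vectors added are the ends of its line: a walk with fewer than R^(j+1) hops
-- and backward steps has, in one of the R rounds, fewer than R^j of them, and at the bottom a whole
-- round without any, which lies inside a single hop and determines the entire line.  Hence H has
-- almost as many pairs as there are lines.  Each level roughly squares the number of lines, and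
-- k levels give N^(2^k) lines on N^(2^k - 1) vertices.

-- All orders of magnitude in part (2) are powers of R. With k = j + 1 the program has about R^(k+1)
-- layers, and fewer than R^k hops and backward steps together are tolerated. For a distance d of
-- order R^(k+1) the quantity d^(1-1/k) has order R^(k-1/k), so that hopbound and error fall below
-- R^k once R is large; this is where the exponent 1 - 1/k enters. A vector has D entries below R^D,
-- hence N = R^(D²) values. Everything else (the layers, the growth of the registers over R rounds,
-- the norm registers, the positions on a shortcut) costs only R^(O(D)). For large D this becomes an
-- arbitrarily small loss in the exponent, and letting D grow slowly with n turns the loss into
-- o(1). The obstacle is to add N possible vectors without storing one: a second copy besides the
-- accumulating registers would give N² vertices for N² lines. The bottom machine therefore passes a
-- vector through a single number, one coordinate at a time. A nested machine reads its vector off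
-- the state of the inner machine, half of it before and half of it after the inner passage.

fromℕ-+ : ∀ a b → fromℕ a ℚ.+ fromℕ b ≡ fromℕ (a + b)
fromℕ-+ a b = ℚ.toℚᵘ-injective (ℚᵘ.≃-trans (ℚ.toℚᵘ-homo-+ (fromℕ a) (fromℕ b))
  (ℚᵘ.*≡* (cong (ℤ._* (+ 1)) (cong₂ ℤ._+_ (ℤ.*-identityʳ (+ a)) (ℤ.*-identityʳ (+ b))))))

fromℕ-mono-≤ : ∀ {a b} → a ≤ b → fromℕ a ℚ.≤ fromℕ b
fromℕ-mono-≤ a≤b = ℚ.*≤* (ℤ.*-monoʳ-≤-nonNeg (+ 1) (ℤ.+≤+ a≤b))

fromℕ-cancel-≤ : ∀ {a b} → fromℕ a ℚ.≤ fromℕ b → a ≤ b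
fromℕ-cancel-≤ (ℚ.*≤* le) = ℤ.drop‿+≤+ (ℤ.*-cancelʳ-≤-pos _ _ (+ 1) le)

fromℕ-pos : ∀ {a} → 0 < a → ℚ.Positive (fromℕ a)
fromℕ-pos (s≤s _) = _

module Lengths {n} (G : Graph n) (ω : Fin n → Fin n → ℕ)
  (weight≡ : ∀ {u v} → T (Graph.adj G u v) → Graph.weight G u v ≡ fromℕ (ω u v)) where
  open Graph G

  lenℕ : ∀ {u v} → Walk (edges G) u v → ℕ
  lenℕ []                  = 0
  lenℕ (_∷_ {u} {v} _ p) = ω u v + lenℕ p

  len≡ : ∀ {u v} (p : Walk (edges G) u v) → len p ≡ fromℕ (lenℕ p)
  len≡ []                        = refl
  len≡ (_∷_ {u} {v} (e , refl) p) =
    trans (cong₂ ℚ._+_ (weight≡ e) (len≡ p)) (fromℕ-+ (ω u v) (lenℕ p))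

  -- An edge of `H` carries a shortest walk of `G` in its `Dist` witness; the length of that walk
  -- stands in for the rational weight.
  lenℕ-∪ : ∀ H {u v} → Walk (G ∪ H) u v → ℕ
  lenℕ-∪ H []                               = 0
  lenℕ-∪ H (_∷_ {u} {v} (inj₁ _) p)           = ω u v + lenℕ-∪ H p
  lenℕ-∪ H (inj₂ (_ , (g , _) , _) ∷ p)       = lenℕ g + lenℕ-∪ H p

  len-∪≡ : ∀ H {u v} (p : Walk (G ∪ H) u v) → len p ≡ fromℕ (lenℕ-∪ H p)
  len-∪≡ H []                                 = refl
  len-∪≡ H (_∷_ {u} {v} (inj₁ (e , refl)) p)    =
    trans (cong₂ ℚ._+_ (weight≡ e) (len-∪≡ H p)) (fromℕ-+ (ω u v) (lenℕ-∪ H p))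
  len-∪≡ H (inj₂ (_ , (g , refl) , _) ∷ p)      =
    trans (cong₂ ℚ._+_ (len≡ g) (len-∪≡ H p)) (fromℕ-+ (lenℕ g) (lenℕ-∪ H p))

  dist : ∀ {u v d} (p : Walk (edges G) u v) → lenℕ p ≡ d → (∀ q → d ≤ lenℕ {u} {v} q) →
         Dist (edges G) u v (fromℕ d)
  dist p eq min = (p , trans (len≡ p) (cong fromℕ eq)) ,
                  λ q → subst (_ ℚ.≤_) (sym (len≡ q)) (fromℕ-mono-≤ (min q))

  approx⇒walk : ∀ H {β u v d b} → Approx G H β u v d (fromℕ b) →
                Σ (Walk (G ∪ H) u v) λ p → hops p ≤ β × lenℕ-∪ H p ≤ b
  approx⇒walk H (_ , ((p , h , refl) , _) , _ , le) =
    p , h , fromℕ-cancel-≤ (subst (ℚ._≤ _) (len-∪≡ H p) le)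

factor : ∀ x s y z → x + s * y + s * z ≡ x + s * (y + z)
factor = solve-∀

-- A potential φ with φ v ≤ φ u + s · ω u v along all edges makes a walk a shortest one as
-- soon as it has equality throughout; here equality moreover forces a walk to stay on a line.
module Lines {n} (G : Graph n) (ω : Fin n → Fin n → ℕ)
  (weight≡ : ∀ {u v} → T (Graph.adj G u v) → Graph.weight G u v ≡ fromℕ (ω u v))
  (L ℓ : ℕ) (On : Fin L → ℕ → Fin n → Set) (φ : Fin L → Fin n → ℕ) (s : Fin L → ℕ)
  (height : Fin n → ℕ) where
  open Graph G
  open Lengths G ω weight≡

  module _
    (s-pos : ∀ a → NonZero (s a))
    (φ-step : ∀ a {u v} → T (adj u v) → φ a v ≤ φ a u + s a * ω u v)
    (tight-step : ∀ a {r u v} → On a r u → T (adj u v) → φ a v ≡ φ a u + s a * ω u v →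
                  On a (suc r) v)
    (point : ∀ a r → r ≤ ℓ → Σ (Fin n) (On a r))
    (line-step : ∀ a {r u v} → On a r u → On a (suc r) v →
                 T (adj u v) × φ a v ≡ φ a u + s a * ω u v)
    (ascending : ∀ a {r q u v} → On a r u → On a q v → r < q → height u < height v)
    (two-points : ∀ {a b r q r′ q′ u v} → On a r u → On a q v → On b r′ u → On b q′ v → r < q → r′ < q′ → a ≡ b)
    where

    line-from : ∀ a m {r u} → On a r u → r + m ≡ ℓ →
                Σ (Fin n) λ v → On a ℓ v × Σ (Walk (edges G) u v) λ p → φ a v ≡ φ a u + s a * lenℕ p
    line-from a zero {r} {u} x eq =
      u , subst (λ q → On a q u) (trans (sym (+-identityʳ r)) eq) x , [] , sym (trans (cong (_+_ (φ a u)) (*-zeroʳ (s a))) (+-identityʳ _))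
    line-from a (suc m) {r} {u} x eq =
      let eq′            = trans (sym (+-suc r m)) eq
          t , y          = point a (suc r) (≤-trans (m≤m+n (suc r) m) (≤-reflexive eq′))
          e , tight      = line-step a x y
          v , z , p , eq = line-from a m y eq′
      in v , z , (e , refl) ∷ p ,
         trans eq (trans (cong (_+ s a * lenℕ p) tight) (factor (φ a u) (s a) (ω u t) (lenℕ p)))

    On-unique : ∀ a {r q u} → On a r u → On a q u → r ≡ q
    On-unique a {r} {q} x y with <-cmp r q
    ... | tri< r<q _ _ = ⊥-elim (<-irrefl refl (ascending a x y r<q))
    ... | tri≈ _ r≡q _ = r≡q
    ... | tri> _ _ q<r = ⊥-elim (<-irrefl refl (ascending a y x q<r))

    φ-walk : ∀ a {u v} (p : Walk (edges G) u v) → φ a v ≤ φ a u + s a * lenℕ p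
    φ-walk a {u} [] = m≤m+n (φ a u) _
    φ-walk a {u} (_∷_ {v = t} (e , _) p) = begin
      φ a _ ≤⟨ φ-walk a p ⟩
      φ a t + s a * lenℕ p ≤⟨ +-monoˡ-≤ _ (φ-step a e) ⟩
      φ a u + s a * ω u t + s a * lenℕ p ≡⟨ factor (φ a u) (s a) (ω u t) (lenℕ p) ⟩
      φ a u + s a * (ω u t + lenℕ p) ∎
      where open ≤-Reasoning

    -- If a chain of two upper bounds has no slack as a whole, neither link has any.
    both-tight : ∀ {x y z} s b c → y ≤ x + s * b → z ≤ y + s * c → z ≡ x + s * (b + c) →
                 y ≡ x + s * b × z ≡ y + s * c
    both-tight {x} {y} {z} s b c y≤ z≤ z≡ = y≡ , trans z≡ (trans (sym (factor x s b c)) (cong (_+ s * c) (sym y≡)))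
      where
      y≡ : y ≡ x + s * b
      y≡ = ≤-antisym y≤ (+-cancelʳ-≤ (s * c) _ _ (≤-trans (≤-reflexive (trans (factor x s b c) (sym z≡))) z≤))

    -- Meant for the shortest walk behind an edge of `H`: when the edge is tight so is that walk,
    -- and its far end is again a point of the line.
    tight-walk : ∀ a {r u v} → On a r u → (p : Walk (edges G) u v) → φ a v ≡ φ a u + s a * lenℕ p →
                 ∃[ q ] r ≤ q × On a q v
    tight-walk a {r} x [] eq = r , ≤-refl , x
    tight-walk a {r} {u} x (_∷_ {v = t} (e , _) p) eq
      with both-tight (s a) (ω u t) (lenℕ p) (φ-step a e) (φ-walk a p) eq
    ... | eq₁ , eq₂ with tight-walk a (tight-step a x e eq₁) p eq₂
    ... | q , r<q , y = q , <⇒≤ r<q , y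

    OnPair : Fin L → (Fin n × Fin n) → Set
    OnPair a (i , j) = ∃[ r ] ∃[ q ] r < q × On a r i × On a q j

    Used : PairSet n → Fin L → Set
    Used H a = ∃[ e ] (OnPair a (lookup (PairSet.pairs H) e) ⊎ OnPair a (×-swap (lookup (PairSet.pairs H) e)))

    φ-walk-∪ : ∀ a H {u v} (p : Walk (G ∪ H) u v) → φ a v ≤ φ a u + s a * lenℕ-∪ H p
    φ-walk-∪ a H {u} [] = m≤m+n (φ a u) _
    φ-walk-∪ a H {u} (_∷_ {v = t} (inj₁ (e , _)) p) = begin
      φ a _ ≤⟨ φ-walk-∪ a H p ⟩
      φ a t + s a * lenℕ-∪ H p ≤⟨ +-monoˡ-≤ _ (φ-step a e) ⟩
      φ a u + s a * ω u t + s a * lenℕ-∪ H p ≡⟨ factor (φ a u) (s a) (ω u t) (lenℕ-∪ H p) ⟩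
      φ a u + s a * (ω u t + lenℕ-∪ H p) ∎
      where open ≤-Reasoning
    φ-walk-∪ a H {u} (_∷_ {v = t} (inj₂ (_ , (g , _) , _)) p) = begin
      φ a _ ≤⟨ φ-walk-∪ a H p ⟩
      φ a t + s a * lenℕ-∪ H p ≤⟨ +-monoˡ-≤ _ (φ-walk a g) ⟩
      φ a u + s a * lenℕ g + s a * lenℕ-∪ H p ≡⟨ factor (φ a u) (s a) (lenℕ g) (lenℕ-∪ H p) ⟩
      φ a u + s a * (lenℕ g + lenℕ-∪ H p) ∎
      where open ≤-Reasoning

    -- A shortcut joining two different positions of the line is recorded in `Used`. Every other
    -- hop, including a shortcut that stays at its position, advances by at most one, so the number
    -- of hops bounds the position reached.
    tight-walk-∪ : ∀ a H {r u v} → On a r u → (p : Walk (G ∪ H) u v) → φ a v ≡ φ a u + s a * lenℕ-∪ H p →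
                   Used H a ⊎ ∃[ q ] q ≤ r + hops p × On a q v
    tight-walk-∪ a H {r} x [] eq = inj₂ (r , m≤m+n r 0 , x)
    tight-walk-∪ a H {r} {u} x (_∷_ {v = t} (inj₁ (ad , _)) p) eq
      with both-tight (s a) (ω u t) (lenℕ-∪ H p) (φ-step a ad) (φ-walk-∪ a H p) eq
    ... | eq₁ , eq₂ with tight-walk-∪ a H (tight-step a x ad eq₁) p eq₂
    ... | inj₁ used = inj₁ used
    ... | inj₂ (q , le , y) = inj₂ (q , ≤-trans le (≤-reflexive (sym (+-suc r (hops p)))) , y)
    tight-walk-∪ a H {r} {u} x (_∷_ {v = t} (inj₂ (mem , (g , _) , _)) p) eq
      with both-tight (s a) (lenℕ g) (lenℕ-∪ H p) (φ-walk a g) (φ-walk-∪ a H p) eq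
    ... | eq₁ , eq₂ with tight-walk a x g eq₁
    ... | q , r≤q , y with m≤n⇒m<n∨m≡n r≤q
    ... | inj₁ r<q = inj₁ (used mem)
      where
      used : _ → Used H a
      used (inj₁ m) = index m , inj₁ (subst (OnPair a) (lookup-index m) (r , q , r<q , x , y))
      used (inj₂ m) = index m , inj₂ (subst (OnPair a ∘ ×-swap) (lookup-index m) (r , q , r<q , x , y))
    ... | inj₂ refl with tight-walk-∪ a H y p eq₂
    ... | inj₁ used = inj₁ used
    ... | inj₂ (q′ , le , z) = inj₂ (q′ , ≤-trans le (+-monoʳ-≤ r (n≤1+n (hops p))) , z)

    used-or-long : ∀ H {β} → IsHopset G H β 0ℚ → ∀ a → Used H a ⊎ ℓ ≤ β
    used-or-long H {β} hopset a =
      let u , x          = point a 0 z≤n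
          v , y , p , eq = line-from a ℓ x refl
          shortest : ∀ q → lenℕ p ≤ lenℕ q
          shortest q     = *-cancelˡ-≤ (s a) {{s-pos a}} (+-cancelˡ-≤ (φ a u) _ _
                             (≤-trans (≤-reflexive (sym eq)) (φ-walk a q)))
          g , h≤β , g≤   = approx⇒walk H (subst (Approx G H β u v _) (ℚ.*-identityˡ _)
                             (hopset (dist p refl shortest)))
          tight          = ≤-antisym (φ-walk-∪ a H g) (≤-trans (+-monoʳ-≤ (φ a u)
                             (*-monoʳ-≤ (s a) g≤)) (≤-reflexive (sym eq)))
      in [ inj₁ , (λ (q , q≤h , z) → inj₂ (subst (_≤ β) (On-unique a z y) (≤-trans q≤h h≤β))) ]′
           (tight-walk-∪ a H x g tight)

    -- Pairs of `H` can be traversed both ways. As every line ascends in `height`, two lines cannot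
    -- use one pair in opposite directions, and each pair is charged to a single line.
    OnPair-clash : ∀ {a b x} → OnPair a x → OnPair b (×-swap x) → ⊥
    OnPair-clash {a} {b} (_ , _ , r<q , x , y) (_ , _ , r′<q′ , x′ , y′) =
      <-asym (ascending a x y r<q) (ascending b x′ y′ r′<q′)

    OnPair-injective : ∀ {a b x} → OnPair a x → OnPair b x → a ≡ b
    OnPair-injective (_ , _ , r<q , x , y) (_ , _ , r′<q′ , x′ , y′) = two-points x y x′ y′ r<q r′<q′

    Used-injective : ∀ {H a b} (x : Used H a) (y : Used H b) → proj₁ x ≡ proj₁ y → a ≡ b
    Used-injective (e , inj₁ x) (_ , inj₁ y) refl = OnPair-injective x y
    Used-injective (e , inj₂ x) (_ , inj₂ y) refl = OnPair-injective x y
    Used-injective (e , inj₁ x) (_ , inj₂ y) refl = ⊥-elim (OnPair-clash x y)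
    Used-injective (e , inj₂ x) (_ , inj₁ y) refl = ⊥-elim (OnPair-clash y x)

    not-all-used : ∀ {H} → ∣ H ∣ < L → ¬ (∀ a → Used H a)
    not-all-used {H} few used =
      let a , b , a<b , eq = Fin.pigeonhole few (proj₁ ∘ used)
      in <⇒≢ a<b (cong toℕ (Used-injective {H} (used a) (used b) eq))

    few-shortcuts⇒many-hops : ∀ H β → ∣ H ∣ < L → IsHopset G H β 0ℚ → ℓ ≤ β
    few-shortcuts⇒many-hops H β few hopset = decidable-stable (ℓ ≤? β) λ ℓ≰β →
      not-all-used {H} few λ a → [ id , ⊥-elim ∘ ℓ≰β ]′ (used-or-long H {β} hopset a)

-- Squares, integer roots and the numbering of grid points.

gap-cases : ∀ m n → (n ≡ m + gap m n) ⊎ (m ≡ n + gap m n)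
gap-cases zero    n       = inj₁ refl
gap-cases (suc m) zero    = inj₂ refl
gap-cases (suc m) (suc n) = [ inj₁ ∘ cong suc , inj₂ ∘ cong suc ]′ (gap-cases m n)

square-gap : ∀ a b → a * a + b * b ≡ 2 * (a * b) + gap a b * gap a b
square-gap a b with gap-cases a b
... | inj₁ eq = subst (λ x → a * a + x * x ≡ 2 * (a * x) + gap a b * gap a b) (sym eq) (go a (gap a b))
  where
  go : ∀ a e → a * a + (a + e) * (a + e) ≡ 2 * (a * (a + e)) + e * e
  go = solve-∀
... | inj₂ eq = subst (λ x → x * x + b * b ≡ 2 * (x * b) + gap a b * gap a b) (sym eq) (go b (gap a b))
  where
  go : ∀ b e → (b + e) * (b + e) + b * b ≡ 2 * ((b + e) * b) + e * e
  go = solve-∀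

AM-GM : ∀ a b → 2 * (a * b) ≤ a * a + b * b
AM-GM a b = ≤-trans (m≤m+n _ _) (≤-reflexive (sym (square-gap a b)))

square≡0 : ∀ a → a * a ≡ 0 → a ≡ 0
square≡0 a = [ id , id ]′ ∘ m*n≡0⇒m≡0∨n≡0 a

AM-GM-tight : ∀ a b → 2 * (a * b) ≡ a * a + b * b → a ≡ b
AM-GM-tight a b eq = ∣m-n∣≡0⇒m≡n (square≡0 (gap a b) (sym (+-cancelˡ-≡ (2 * (a * b)) _ _
  (trans (+-identityʳ _) (trans eq (square-gap a b))))))

bracket : (g : ℕ → ℕ) → (∀ m → g m < g (suc m)) → ∀ n → g 0 ≤ n → ∃[ m ] g m ≤ n × n < g (suc m)
bracket g grows n g0≤n = subst (λ n → ∃[ m ] g m ≤ n × n < g (suc m)) (m+[n∸m]≡n g0≤n) (go (n ∸ g 0))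
  where
  go : ∀ i → ∃[ m ] g m ≤ g 0 + i × g 0 + i < g (suc m)
  go zero = 0 , ≤-reflexive (sym (+-identityʳ _)) , subst (_< g 1) (sym (+-identityʳ _)) (grows 0)
  go (suc i) with go i
  ... | m , lo , hi with m≤n⇒m<n∨m≡n hi
  ... | inj₁ hi′ = m , ≤-trans lo (+-monoʳ-≤ (g 0) (n≤1+n i)) , subst (_< g (suc m)) (sym (+-suc (g 0) i)) hi′
  ... | inj₂ eq  = suc m , ≤-reflexive (sym eq′) , subst (_< g (suc (suc m))) (sym eq′) (grows (suc m))
    where eq′ = trans (+-suc (g 0) i) eq

∃root : ∀ K .{{_ : NonZero K}} e n → K ≤ n → ∃[ ℓ ] 1 ≤ ℓ × K * ℓ ^ suc e ≤ n × n < K * suc ℓ ^ suc e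
∃root K e n K≤n =
  let m , lo , hi = bracket (λ m → K * suc m ^ suc e) (λ m → *-monoʳ-< K (^-monoˡ-< (suc e) (n<1+n (suc m)))) n
                      (≤-trans (≤-reflexive (trans (cong (K *_) (^-zeroˡ (suc e))) (*-identityʳ K))) K≤n)
  in suc m , s≤s z≤n , lo , hi

^-distribˡ-* : ∀ a b e → (a * b) ^ e ≡ a ^ e * b ^ e
^-distribˡ-* a b zero    = refl
^-distribˡ-* a b (suc e) = trans (cong (a * b *_) (^-distribˡ-* a b e)) (regroup a b (a ^ e) (b ^ e))
  where
  regroup : ∀ a b c d → a * b * (c * d) ≡ a * c * (b * d)
  regroup = solve-∀

suc-≤-double : ∀ {ℓ} → 1 ≤ ℓ → suc ℓ ≤ 2 * ℓ
suc-≤-double {ℓ} 1≤ℓ = ≤-trans (+-monoˡ-≤ ℓ 1≤ℓ) (≤-reflexive (cong (_+_ ℓ) (sym (+-identityʳ ℓ))))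

-- Turns the choice of ℓ as an integer root of n / K into a bound on β: the successor costs a factor
-- 2, and `K ≤ K ^ suc e` moves the constant under the power.
root-bound : ∀ K .{{_ : NonZero K}} e {n ℓ β} → 1 ≤ ℓ → n < K * suc ℓ ^ suc e → ℓ ≤ β →
             n ≤ (K * 2 * β) ^ suc e
root-bound K e {n} {ℓ} {β} 1≤ℓ n< ℓ≤β = begin
  n ≤⟨ <⇒≤ n< ⟩
  K * suc ℓ ^ suc e ≤⟨ *-mono-≤ (m≤m*n K (K ^ e) {{m^n≢0 K e}}) (^-monoˡ-≤ (suc e) (≤-trans (suc-≤-double 1≤ℓ) (*-monoʳ-≤ 2 ℓ≤β))) ⟩
  K ^ suc e * (2 * β) ^ suc e ≡⟨ ^-distribˡ-* K (2 * β) (suc e) ⟨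
  (K * (2 * β)) ^ suc e ≡⟨ cong (_^ suc e) (*-assoc K 2 β) ⟨
  (K * 2 * β) ^ suc e ∎
  where open ≤-Reasoning

cell : ∀ {n} X .{{_ : NonZero X}} q r → r < X → q * X + r < n →
       Σ (Fin n) λ i → toℕ i ℕ./ X ≡ q × toℕ i ℕ.% X ≡ r
cell {n} X q r r<X lt = Fin.fromℕ< lt ,
  trans (cong (ℕ._/ X) (Fin.toℕ-fromℕ< lt)) quot , trans (cong (ℕ._% X) (Fin.toℕ-fromℕ< lt)) rem
  where
  rem : (q * X + r) ℕ.% X ≡ r
  rem = trans (cong (ℕ._% X) (+-comm (q * X) r)) (trans (ℕ.[m+kn]%n≡m%n r q X) (ℕ.m<n⇒m%n≡m r<X))
  quot : (q * X + r) ℕ./ X ≡ q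
  quot = trans (ℕ.+-distrib-/ (q * X) r (subst (_< X) (sym (cong₂ _+_ (ℕ.m*n%n≡0 q X) (ℕ.m<n⇒m%n≡m r<X))) r<X))
               (trans (cong₂ _+_ (ℕ.m*n/n≡m q X) (ℕ.m<n⇒m/n≡0 r<X)) (+-identityʳ q))

remQuot-injective : ∀ {m k} {i j : Fin (m * k)} → proj₁ (Fin.remQuot {m} k i) ≡ proj₁ (Fin.remQuot {m} k j) →
                    proj₂ (Fin.remQuot {m} k i) ≡ proj₂ (Fin.remQuot {m} k j) → i ≡ j
remQuot-injective {m} {k} {i} {j} eq₁ eq₂ = trans (sym (Fin.combine-remQuot {m} k i))
  (trans (cong₂ Fin.combine eq₁ eq₂) (Fin.combine-remQuot {m} k j))

next-multiple : ∀ o l r → o + r * l + l ≡ o + suc r * l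
next-multiple = solve-∀

-- Part (1): weighted graphs

-- Columns 0 … ℓ of height 2Aℓ; consecutive columns are completely joined, and the convexity of
-- d ↦ W + d² makes every line of slope a < A the only shortest path between its ends.
module WeightedGrid (n A ℓ : ℕ) .{{_ : NonZero A}} .{{_ : NonZero ℓ}} (fits : suc ℓ * (2 * (A * ℓ)) ≤ n) where

  instance
    Aℓ≢0 : NonZero (A * ℓ)
    Aℓ≢0 = m*n≢0 A ℓ
    height≢0 : NonZero (2 * (A * ℓ))
    height≢0 = m*n≢0 2 (A * ℓ)

  col row : Fin n → ℕ
  col i = toℕ i ℕ./ (2 * (A * ℓ))
  row i = toℕ i ℕ.% (2 * (A * ℓ))

  -- Larger than every squared slope, which leaves `V a` positive; this positivity makes steps to
  -- the left strictly wasteful.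
  W : ℕ
  W = suc (A * A)

  ω : Fin n → Fin n → ℕ
  ω i j = W + gap (row i) (row j) * gap (row i) (row j)

  ω-sym : ∀ i j → ω i j ≡ ω j i
  ω-sym i j = cong (λ d → W + d * d) (∣-∣-comm (row i) (row j))

  G : Graph n
  G = record
    { adj        = λ i j → ⌊ gap (col i) (col j) ≟ 1 ⌋
    ; adj-sym    = λ {i} {j} e → fromWitness (trans (∣-∣-comm (col j) (col i)) (toWitness e))
    ; adj-irrefl = λ {i} e → 0≢1+n (trans (sym (∣n-n∣≡0 (col i))) (toWitness e))
    ; weight     = λ i j → fromℕ (ω i j)
    ; weight-sym = λ {i} {j} _ → cong fromℕ (ω-sym i j)
    ; weight-pos = λ {i} {j} _ → fromℕ-pos {ω i j} (s≤s z≤n)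
    }

  slope intercept : Fin (A * (A * ℓ)) → ℕ
  slope a     = toℕ (proj₁ (Fin.remQuot {A} (A * ℓ) a))
  intercept a = toℕ (proj₂ (Fin.remQuot {A} (A * ℓ) a))

  slope<A : ∀ a → slope a < A
  slope<A a = Fin.toℕ<n (proj₁ (Fin.remQuot {A} (A * ℓ) a))

  V : Fin (A * (A * ℓ)) → ℕ
  V a = W ∸ slope a * slope a

  square<W : ∀ a → slope a * slope a < W
  square<W a = s≤s (*-mono-≤ (<⇒≤ (slope<A a)) (<⇒≤ (slope<A a)))

  V+square : ∀ a → V a + slope a * slope a ≡ W
  V+square a = m∸n+n≡m (<⇒≤ (square<W a))

  V>0 : ∀ a → 0 < V a
  V>0 a = m<n⇒0<n∸m (square<W a)

  On : Fin (A * (A * ℓ)) → ℕ → Fin n → Set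
  On a r i = col i ≡ r × row i ≡ intercept a + r * slope a

  -- A step one column to the right and d rows up gains `V a` + 2ad, while its weight is `V a` + a²
  -- + d² because `W` is `V a` + a². The slack is (a - d)².
  φ : Fin (A * (A * ℓ)) → Fin n → ℕ
  φ a i = V a * col i + 2 * (slope a * row i)

  open Lines G ω (λ _ → refl) (A * (A * ℓ)) ℓ On φ (λ _ → 1) col

  private
    Step : (V a x x′ y y′ d : ℕ) → Set
    Step V a x x′ y y′ d = V * x′ + 2 * (a * y′) ≤ V * x + 2 * (a * y) + 1 * (V + a * a + d * d)

    Tight : (V a x x′ y y′ d : ℕ) → Set
    Tight V a x x′ y y′ d = V * x′ + 2 * (a * y′) ≡ V * x + 2 * (a * y) + 1 * (V + a * a + d * d)

  forward-up : ∀ V a x y d → V * (x + 1) + 2 * (a * (y + d)) ≡ (V * x + 2 * (a * y) + V) + 2 * (a * d)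
  forward-up = solve-∀
  rhs : ∀ V a x y d → V * x + 2 * (a * y) + 1 * (V + a * a + d * d) ≡ (V * x + 2 * (a * y) + V) + (a * a + d * d)
  rhs = solve-∀
  forward-down : ∀ V a x y d → V * x + 2 * (a * (y + d)) + 1 * (V + a * a + d * d) ≡
                 (V * (x + 1) + 2 * (a * y)) + (2 * (a * d) + a * a + d * d)
  forward-down = solve-∀
  backward-up : ∀ V a x y d → V * (x + 1) + 2 * (a * y) + 1 * (V + a * a + d * d) ≡
                 (V * x + 2 * (a * y)) + (a * a + d * d) + 2 * V
  backward-up = solve-∀
  backward-up′ : ∀ V a x y d → V * x + 2 * (a * (y + d)) ≡ (V * x + 2 * (a * y)) + 2 * (a * d)
  backward-up′ = solve-∀
  backward-down : ∀ V a x y d → V * (x + 1) + 2 * (a * (y + d)) + 1 * (V + a * a + d * d) ≡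
                 (V * x + 2 * (a * y)) + (2 * (a * d) + a * a + d * d + V) + V
  backward-down = solve-∀

  -- To the left the gain `V` turns into a loss, so equality is excluded. To the right and downwards
  -- it survives only for a horizontal step along a line of slope 0.
  step : ∀ V a x x′ y y′ → 0 < V → gap x x′ ≡ 1 →
         Step V a x x′ y y′ (gap y y′) × (Tight V a x x′ y y′ (gap y y′) → x′ ≡ suc x × y′ ≡ y + a)
  step V a x x′ y y′ V>0 x~x′ with gap x x′ | gap-cases x x′ | gap y y′ | gap-cases y y′
  step V a x _ y _ V>0 refl | _ | inj₁ refl | d | inj₁ refl =
    subst₂ _≤_ (sym (forward-up V a x y d)) (sym (rhs V a x y d)) (+-monoʳ-≤ (V * x + 2 * (a * y) + V) (AM-GM a d)) ,
    λ eq → +-comm x 1 , cong (_+_ y) (sym (AM-GM-tight a d (+-cancelˡ-≡ (V * x + 2 * (a * y) + V) _ _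
             (trans (sym (forward-up V a x y d)) (trans eq (rhs V a x y d))))))
  step V a x _ _ y′ V>0 refl | _ | inj₁ refl | d | inj₂ refl =
    ≤-trans (m≤m+n _ _) (≤-reflexive (sym (forward-down V a x y′ d))) ,
    λ eq → +-comm x 1 , y′≡ (m+n≡0⇒n≡0 (2 * (a * d) + a * a) (loss eq))
                            (m+n≡0⇒n≡0 (2 * (a * d)) (m+n≡0⇒m≡0 _ (loss eq)))
    where
    loss : Tight V a x (x + 1) (y′ + d) y′ d → 2 * (a * d) + a * a + d * d ≡ 0
    loss eq = +-cancelˡ-≡ (V * (x + 1) + 2 * (a * y′)) _ _
                (sym (trans (+-identityʳ _) (trans eq (forward-down V a x y′ d))))
    y′≡ : d * d ≡ 0 → a * a ≡ 0 → y′ ≡ y′ + d + a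
    y′≡ d≡0 a≡0 = sym (trans (cong₂ (λ d a → y′ + d + a) (square≡0 d d≡0) (square≡0 a a≡0))
                             (trans (+-identityʳ _) (+-identityʳ _)))
  step V a _ x′ y _ V>0 refl | _ | inj₂ refl | d | inj₁ refl =
    <⇒≤ less , λ eq → ⊥-elim (<⇒≢ less eq)
    where
    less : V * x′ + 2 * (a * (y + d)) < V * (x′ + 1) + 2 * (a * y) + 1 * (V + a * a + d * d)
    less = subst₂ _<_ (sym (backward-up′ V a x′ y d)) (sym (backward-up V a x′ y d))
             (≤-<-trans (+-monoʳ-≤ (V * x′ + 2 * (a * y)) (AM-GM a d))
               (subst (_< (V * x′ + 2 * (a * y)) + (a * a + d * d) + 2 * V) (+-identityʳ _)
                 (+-monoʳ-< ((V * x′ + 2 * (a * y)) + (a * a + d * d)) (≤-trans V>0 (m≤m+n V _)))))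
  step V a _ x′ _ y′ V>0 refl | _ | inj₂ refl | d | inj₂ refl =
    <⇒≤ less , λ eq → ⊥-elim (<⇒≢ less eq)
    where
    less : V * x′ + 2 * (a * y′) < V * (x′ + 1) + 2 * (a * (y′ + d)) + 1 * (V + a * a + d * d)
    less = subst (V * x′ + 2 * (a * y′) <_) (sym (backward-down V a x′ y′ d))
             (≤-<-trans (m≤m+n _ _)
               (subst (_< (V * x′ + 2 * (a * y′)) + (2 * (a * d) + a * a + d * d + V) + V) (+-identityʳ _)
                 (+-monoʳ-< ((V * x′ + 2 * (a * y′)) + (2 * (a * d) + a * a + d * d + V)) V>0)))

  ω≡ : ∀ a i j → V a + slope a * slope a + gap (row i) (row j) * gap (row i) (row j) ≡ ω i j
  ω≡ a i j = cong (_+ gap (row i) (row j) * gap (row i) (row j)) (V+square a)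

  step-on : ∀ a {i j} → T (Graph.adj G i j) →
            φ a j ≤ φ a i + 1 * ω i j × (φ a j ≡ φ a i + 1 * ω i j → col j ≡ suc (col i) × row j ≡ row i + slope a)
  step-on a {i} {j} e = subst (λ w → φ a j ≤ φ a i + 1 * w × (φ a j ≡ φ a i + 1 * w → col j ≡ suc (col i) × row j ≡ row i + slope a))
    (ω≡ a i j) (step (V a) (slope a) (col i) (col j) (row i) (row j) (V>0 a) (toWitness e))

  tight-step : ∀ a {r u v} → On a r u → T (Graph.adj G u v) → φ a v ≡ φ a u + 1 * ω u v → On a (suc r) v
  tight-step a {r} (c≡ , r≡) e eq =
    let c≡′ , r≡′ = proj₂ (step-on a e) eq
    in trans c≡′ (cong suc c≡) , trans r≡′ (trans (cong (_+ slope a) r≡) (next-multiple (intercept a) (slope a) r))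

  point : ∀ a r → r ≤ ℓ → Σ (Fin n) (On a r)
  point a r r≤ℓ = cell (2 * (A * ℓ)) r (intercept a + r * slope a) y< (begin-strict
    r * (2 * (A * ℓ)) + (intercept a + r * slope a) <⟨ +-monoʳ-< (r * (2 * (A * ℓ))) y< ⟩
    r * (2 * (A * ℓ)) + 2 * (A * ℓ) ≡⟨ +-comm (r * (2 * (A * ℓ))) _ ⟩
    suc r * (2 * (A * ℓ)) ≤⟨ *-monoˡ-≤ (2 * (A * ℓ)) (s≤s r≤ℓ) ⟩
    suc ℓ * (2 * (A * ℓ)) ≤⟨ fits ⟩
    n ∎)
    where
    open ≤-Reasoning
    y< : intercept a + r * slope a < 2 * (A * ℓ)
    y< = begin-strict
      intercept a + r * slope a <⟨ +-monoˡ-< (r * slope a) (Fin.toℕ<n (proj₂ (Fin.remQuot {A} (A * ℓ) a))) ⟩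
      A * ℓ + r * slope a ≤⟨ +-monoʳ-≤ (A * ℓ) (*-mono-≤ r≤ℓ (<⇒≤ (slope<A a))) ⟩
      A * ℓ + ℓ * A ≡⟨ double A ℓ ⟩
      2 * (A * ℓ) ∎
      where
      double : ∀ A ℓ → A * ℓ + ℓ * A ≡ 2 * (A * ℓ)
      double = solve-∀

  line-step : ∀ a {r u v} → On a r u → On a (suc r) v → T (Graph.adj G u v) × φ a v ≡ φ a u + 1 * ω u v
  line-step a {r} {u} {v} (cu , ru) (cv , rv) =
    fromWitness (trans (cong₂ gap cu cv) (one-apart r)) ,
    (begin
      V a * col v + 2 * (slope a * row v)
        ≡⟨ cong₂ (λ x y → V a * x + 2 * (slope a * y)) cv rv ⟩
      V a * suc r + 2 * (slope a * (intercept a + suc r * slope a))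
        ≡⟨ expand (V a) (slope a) (intercept a) r ⟩
      V a * r + 2 * (slope a * (intercept a + r * slope a)) + 1 * (V a + slope a * slope a + slope a * slope a)
        ≡⟨ cong₂ (λ x y → V a * x + 2 * (slope a * y) + 1 * (V a + slope a * slope a + slope a * slope a)) cu ru ⟨
      φ a u + 1 * (V a + slope a * slope a + slope a * slope a)
        ≡⟨ cong₂ (λ w d → φ a u + 1 * (w + d * d)) (V+square a) (sym gap≡) ⟩
      φ a u + 1 * ω u v ∎)
    where
    open ≡-Reasoning
    one-apart : ∀ r → gap r (suc r) ≡ 1
    one-apart zero    = refl
    one-apart (suc r) = one-apart r
    expand : ∀ V a b r → V * suc r + 2 * (a * (b + suc r * a)) ≡ V * r + 2 * (a * (b + r * a)) + 1 * (V + a * a + a * a)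
    expand = solve-∀
    gap≡ : gap (row u) (row v) ≡ slope a
    gap≡ = trans (cong₂ gap ru rv) (trans (cong (gap (intercept a + r * slope a)) (sym (next-multiple (intercept a) (slope a) r))) (∣m-m+n∣≡n (intercept a + r * slope a) (slope a)))

  two-points : ∀ {a b r q r′ q′ u v} → On a r u → On a q v → On b r′ u → On b q′ v → r < q → r′ < q′ → a ≡ b
  two-points {a} {b} {r} {q} {u = u} {v} (refl , ru) (refl , rv) (refl , ru′) (refl , rv′) r<q _ =
    remQuot-injective {A} (Fin.toℕ-injective slope≡) (Fin.toℕ-injective intercept≡)
    where
    rise : ∀ m {x y z q r} → x + q * m ≡ y → x + r * m ≡ z → q ≡ r + (q ∸ r) → y ≡ z + (q ∸ r) * m
    rise m {x} {q = q} {r} refl refl eq = trans (cong (λ q → x + q * m) eq) (regroup x r (q ∸ r) m)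
      where
      regroup : ∀ x r w m → x + (r + w) * m ≡ x + r * m + w * m
      regroup = solve-∀
    q≡ : q ≡ r + (q ∸ r)
    q≡ = sym (m+[n∸m]≡n (<⇒≤ r<q))
    slope≡ : slope a ≡ slope b
    slope≡ = *-cancelˡ-≡ _ _ (q ∸ r) {{>-nonZero (m<n⇒0<n∸m r<q)}}
      (+-cancelˡ-≡ (row u) _ _ (trans (sym (rise (slope a) {r = r} (sym rv) (sym ru) q≡)) (rise (slope b) {r = r} (sym rv′) (sym ru′) q≡)))
    intercept≡ : intercept a ≡ intercept b
    intercept≡ = +-cancelʳ-≡ (r * slope a) _ _ (trans (sym ru) (trans ru′ (cong (λ s → intercept b + r * s) (sym slope≡))))

  lower-bound : ∀ H β → ∣ H ∣ < A * (A * ℓ) → IsHopset G H β 0ℚ → ℓ ≤ β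
  lower-bound = few-shortcuts⇒many-hops (λ _ → nonZero) (λ a e → proj₁ (step-on a e)) tight-step point line-step
    (λ { a (refl , _) (refl , _) r<q → r<q }) two-points

-- For slopes below κℓ the grid takes at most 4κℓ³ vertices and has κ²ℓ³ lines. From n < 4κ(ℓ+1)³ ≤
-- 32κℓ³ it follows that κ > 32C yields more lines than the C n permitted pairs.
weighted-at : ∀ C κ ℓ n → 32 * C < κ → 1 ≤ ℓ → 4 * κ * ℓ ^ 3 ≤ n → n < 4 * κ * suc ℓ ^ 3 →
  ∃[ G ] (∀ (H : PairSet n) (β : ℕ) → ∣ H ∣ ≤ C * n → IsHopset G H β 0ℚ → n ≤ (4 * κ * 2 * β) ^ 3)
weighted-at C κ ℓ n C<κ 1≤ℓ lo hi = Grid.G , λ H β few hopset →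
    root-bound (4 * κ) {{m*n≢0 4 κ}} 2 1≤ℓ hi (Grid.lower-bound H β (≤-<-trans few enough) hopset)
  where
  open ≤-Reasoning
  instance
    κ≢0 : NonZero κ
    κ≢0 = >-nonZero (≤-<-trans z≤n C<κ)
    ℓ≢0 : NonZero ℓ
    ℓ≢0 = >-nonZero 1≤ℓ
  fits : suc ℓ * (2 * (κ * ℓ * ℓ)) ≤ n
  fits = begin
    suc ℓ * (2 * (κ * ℓ * ℓ)) ≤⟨ *-monoˡ-≤ (2 * (κ * ℓ * ℓ)) (suc-≤-double 1≤ℓ) ⟩
    2 * ℓ * (2 * (κ * ℓ * ℓ)) ≡⟨ regroup κ ℓ ⟩
    4 * κ * ℓ ^ 3 ≤⟨ lo ⟩
    n ∎
    where
    regroup : ∀ κ ℓ → 2 * ℓ * (2 * (κ * ℓ * ℓ)) ≡ 4 * κ * (ℓ * (ℓ * (ℓ * 1)))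
    regroup = solve-∀
  module Grid = WeightedGrid n (κ * ℓ) ℓ {{m*n≢0 κ ℓ}} fits
  enough : C * n < κ * ℓ * (κ * ℓ * ℓ)
  enough = begin-strict
    C * n ≤⟨ *-monoʳ-≤ C (<⇒≤ hi) ⟩
    C * (4 * κ * suc ℓ ^ 3) ≤⟨ *-monoʳ-≤ C (*-monoʳ-≤ (4 * κ) (^-monoˡ-≤ 3 (suc-≤-double 1≤ℓ))) ⟩
    C * (4 * κ * (2 * ℓ) ^ 3) ≡⟨ regroup C κ ℓ ⟩
    32 * C * (κ * (ℓ * ℓ * ℓ)) <⟨ *-monoˡ-< (κ * (ℓ * ℓ * ℓ)) {{m*n≢0 κ (ℓ * ℓ * ℓ) {{κ≢0}} {{m*n≢0 (ℓ * ℓ) ℓ {{m*n≢0 ℓ ℓ}}}}}} C<κ ⟩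
    κ * (κ * (ℓ * ℓ * ℓ)) ≡⟨ regroup′ κ ℓ ⟩
    κ * ℓ * (κ * ℓ * ℓ) ∎
    where
    regroup : ∀ C κ ℓ → C * (4 * κ * (2 * ℓ * (2 * ℓ * (2 * ℓ * 1)))) ≡ 32 * C * (κ * (ℓ * ℓ * ℓ))
    regroup = solve-∀
    regroup′ : ∀ κ ℓ → κ * (κ * (ℓ * ℓ * ℓ)) ≡ κ * ℓ * (κ * ℓ * ℓ)
    regroup′ = solve-∀

weighted : ∀ (C : ℕ) → ∃[ c ] ∃[ n₀ ] (∀ n → n ≥ n₀ →
  ∃[ G ] (∀ (H : PairSet n) (β : ℕ) → ∣ H ∣ ≤ C * n → IsHopset G H β 0ℚ → ⟨ n ^ + 1 / 3 ⟩≤ c * β))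
weighted C = with-constant (suc (32 * C)) ≤-refl
  where
  with-constant : ∀ κ → 32 * C < κ → ∃[ c ] ∃[ n₀ ] (∀ n → n ≥ n₀ →
    ∃[ G ] (∀ (H : PairSet n) (β : ℕ) → ∣ H ∣ ≤ C * n → IsHopset G H β 0ℚ → ⟨ n ^ + 1 / 3 ⟩≤ c * β))
  with-constant κ C<κ = 4 * κ * 2 , 4 * κ , λ n n≥ →
    let ℓ , 1≤ℓ , lo , hi = ∃root (4 * κ) {{m*n≢0 4 κ {{_}} {{>-nonZero (≤-<-trans z≤n C<κ)}}}} 2 n n≥
        G , bound         = weighted-at C κ ℓ n C<κ 1≤ℓ lo hi
    in G , λ H β few hopset → ≤-trans (≤-reflexive (^-identityʳ n)) (bound H β few hopset)

-- Part (1): unweighted graphs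

-- The steps (b, B − b²) with b < A and B = 2A² are in strictly convex position: on them and their
-- negatives the functional (x, y) ↦ 2ax + y is at most B + a², with equality only at b = a.
-- Not layering the grid is what gives the exponent 1/5.
module ConvexGrid (n A ℓ : ℕ) .{{_ : NonZero A}} .{{_ : NonZero ℓ}}
  (fits : (A * A + ℓ * (2 * (A * A))) * (2 * (A * ℓ)) ≤ n) where

  instance
    width≢0 : NonZero (2 * (A * ℓ))
    width≢0 = m*n≢0 2 (A * ℓ) {{_}} {{m*n≢0 A ℓ}}

  col row : Fin n → ℕ
  col i = toℕ i ℕ.% (2 * (A * ℓ))
  row i = toℕ i ℕ./ (2 * (A * ℓ))

  -- Twice A², so that every step rises by `B` - b² > A². The origins of the lines fill a strip of
  -- height A², hence a line has only its origin in this strip and is listed once.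
  B : ℕ
  B = 2 * (A * A)

  square<B : ∀ {b} → b < A → b * b < B
  square<B b<A = <-≤-trans (*-mono-< b<A b<A) (m≤m+n (A * A) _)

  Step : Fin n → Fin n → ℕ → Set
  Step i j b = b < A × col j ≡ col i + b × row j + b * b ≡ row i + B

  step? : ∀ i j → Dec (Step i j (col j ∸ col i))
  step? i j = ((col j ∸ col i) <? A) ×-dec (col j ≟ (col i + (col j ∸ col i)))
              ×-dec (row j + (col j ∸ col i) * (col j ∸ col i) ≟ row i + B)

  adj? : ∀ i j → Dec (Step i j (col j ∸ col i) ⊎ Step j i (col i ∸ col j))
  adj? i j = step? i j ⊎-dec step? j i

  no-loop : ∀ i → ¬ Step i i (col i ∸ col i)
  no-loop i (b<A , _ , eq) = <⇒≢ (+-monoʳ-< (row i) (square<B b<A)) eq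

  G : Graph n
  G = record
    { adj        = λ i j → ⌊ adj? i j ⌋
    ; adj-sym    = λ {i} {j} e → fromWitness {a? = adj? j i} (swap (toWitness {a? = adj? i j} e))
    ; adj-irrefl = λ {i} e → [ no-loop i , no-loop i ]′ (toWitness {a? = adj? i i} e)
    ; weight     = λ _ _ → 1ℚ
    ; weight-sym = λ _ → refl
    ; weight-pos = λ _ → _
    }

  Line : ℕ
  Line = A * ((A * ℓ) * (A * A))

  slopeᶠ : Fin Line → Fin A
  slopeᶠ a = proj₁ (Fin.remQuot {A} ((A * ℓ) * (A * A)) a)

  originᶠ : Fin Line → Fin ((A * ℓ) * (A * A))
  originᶠ a = proj₂ (Fin.remQuot {A} ((A * ℓ) * (A * A)) a)

  slope x₀ y₀ : Fin Line → ℕ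
  slope a = toℕ (slopeᶠ a)
  x₀ a    = toℕ (proj₁ (Fin.remQuot {A * ℓ} (A * A) (originᶠ a)))
  y₀ a    = toℕ (proj₂ (Fin.remQuot {A * ℓ} (A * A) (originᶠ a)))

  slope<A : ∀ a → slope a < A
  slope<A a = Fin.toℕ<n (slopeᶠ a)

  x₀< : ∀ a → x₀ a < A * ℓ
  x₀< a = Fin.toℕ<n (proj₁ (Fin.remQuot {A * ℓ} (A * A) (originᶠ a)))

  y₀< : ∀ a → y₀ a < A * A
  y₀< a = Fin.toℕ<n (proj₂ (Fin.remQuot {A * ℓ} (A * A) (originᶠ a)))

  Line-ext : ∀ a b → slope a ≡ slope b → x₀ a ≡ x₀ b → y₀ a ≡ y₀ b → a ≡ b
  Line-ext a b s≡ x≡ y≡ = remQuot-injective {A} (Fin.toℕ-injective s≡)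
    (remQuot-injective {A * ℓ} (Fin.toℕ-injective x≡) (Fin.toℕ-injective y≡))

  On : Fin Line → ℕ → Fin n → Set
  On a r i = col i ≡ x₀ a + r * slope a × row i + r * (slope a * slope a) ≡ y₀ a + r * B

  φ : Fin Line → Fin n → ℕ
  φ a i = 2 * (slope a * col i) + row i

  speed : Fin Line → ℕ
  speed a = B + slope a * slope a

  open Lines G (λ _ _ → 1) (λ _ → refl) Line ℓ On φ speed row

  up : ∀ B a b x y y′ → y′ + b * b ≡ y + B →
       (2 * (a * (x + b)) + y′) + b * b ≡ 2 * (a * x) + y + B + 2 * (a * b)
  up B a b x y y′ eq = trans (regroup a b x y′ (b * b)) (trans (cong (_+_ (2 * (a * (x + b)))) eq) (regroup′ a b x y B))
    where
    regroup : ∀ a b x y′ c → (2 * (a * (x + b)) + y′) + c ≡ 2 * (a * (x + b)) + (y′ + c)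
    regroup = solve-∀
    regroup′ : ∀ a b x y B → 2 * (a * (x + b)) + (y + B) ≡ 2 * (a * x) + y + B + 2 * (a * b)
    regroup′ = solve-∀

  up-bound : ∀ B a b x y → (2 * (a * x) + y + (B + a * a) * 1) + b * b ≡ 2 * (a * x) + y + B + (a * a + b * b)
  up-bound = solve-∀

  -- The step gains 2ab + `B` - b² and is charged `B` + a²; the slack is (a - b)².
  forward : ∀ B a b x y y′ → y′ + b * b ≡ y + B →
            2 * (a * (x + b)) + y′ ≤ 2 * (a * x) + y + (B + a * a) * 1 ×
            (2 * (a * (x + b)) + y′ ≡ 2 * (a * x) + y + (B + a * a) * 1 → a ≡ b)
  forward B a b x y y′ eq =
    +-cancelʳ-≤ (b * b) _ _ (≤-trans (≤-reflexive (up B a b x y y′ eq))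
      (≤-trans (+-monoʳ-≤ (2 * (a * x) + y + B) (AM-GM a b)) (≤-reflexive (sym (up-bound B a b x y))))) ,
    λ tight → AM-GM-tight a b (+-cancelˡ-≡ (2 * (a * x) + y + B) _ _
      (trans (sym (up B a b x y y′ eq)) (trans (cong (_+ b * b) tight) (up-bound B a b x y))))

  backward : ∀ B a b x y y′ → b * b < B → y + b * b ≡ y′ + B →
             2 * (a * x) + y′ < 2 * (a * (x + b)) + y + (B + a * a) * 1
  backward B a b x y y′ small eq = ≤-<-trans (+-mono-≤ (*-monoʳ-≤ 2 (*-monoʳ-≤ a (m≤m+n x b))) (<⇒≤ y′<y))
    (subst (_< 2 * (a * (x + b)) + y + (B + a * a) * 1) (+-identityʳ _)
      (+-monoʳ-< (2 * (a * (x + b)) + y) (subst (0 <_) (sym (*-identityʳ _)) (<-≤-trans (≤-<-trans z≤n small) (m≤m+n B _)))))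
    where
    y′<y : y′ < y
    y′<y = +-cancelʳ-< (b * b) y′ y (subst (y′ + b * b <_) (sym eq) (+-monoʳ-< y′ small))

  Tight : Fin Line → Fin n → Fin n → Set
  Tight a i j = φ a j ≡ φ a i + speed a * 1

  step-on : ∀ a {i j} → T (Graph.adj G i j) →
            φ a j ≤ φ a i + speed a * 1 × (Tight a i j → Step i j (slope a))
  step-on a {i} {j} e = cases (toWitness {a? = adj? i j} e)
    where
    cases : Step i j (col j ∸ col i) ⊎ Step j i (col i ∸ col j) →
            φ a j ≤ φ a i + speed a * 1 × (Tight a i j → Step i j (slope a))
    cases (inj₁ st@(b<A , c , r)) =
      let le , eq = subst (λ x → 2 * (slope a * x) + row j ≤ φ a i + speed a * 1 ×
                                 (2 * (slope a * x) + row j ≡ φ a i + speed a * 1 → slope a ≡ col j ∸ col i))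
                      (sym c) (forward B (slope a) (col j ∸ col i) (col i) (row i) (row j) r)
      in le , λ t → subst (Step i j) (sym (eq t)) st
    cases (inj₂ (b<A , c , r)) =
      let less = subst (λ x → φ a j < 2 * (slope a * x) + row i + speed a * 1) (sym c)
                   (backward B (slope a) (col i ∸ col j) (col j) (row i) (row j) (square<B b<A) r)
      in <⇒≤ less , λ t → ⊥-elim (<⇒≢ less t)

  tight-step : ∀ a {r u v} → On a r u → T (Graph.adj G u v) → Tight a u v → On a (suc r) v
  tight-step a {r} {u} {v} (cu , ru) e t =
    let _ , cv , rv = proj₂ (step-on a e) t
    in trans cv (trans (cong (_+ slope a) cu) (next-multiple (x₀ a) (slope a) r)) ,
       trans (regroup (row v) (slope a * slope a) r) (trans (cong (_+ r * (slope a * slope a)) rv)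
         (trans (regroup′ (row u) B (r * (slope a * slope a))) (trans (cong (_+ B) ru) (next-multiple (y₀ a) B r))))
    where
    regroup : ∀ y q r → y + suc r * q ≡ y + q + r * q
    regroup = solve-∀
    regroup′ : ∀ y B q → y + B + q ≡ y + q + B
    regroup′ = solve-∀

  line-step : ∀ a {r u v} → On a r u → On a (suc r) v → T (Graph.adj G u v) × Tight a u v
  line-step a {r} {u} {v} (cu , ru) (cv , rv) =
    fromWitness {a? = adj? u v} (inj₁ (subst (Step u v) (sym slope≡) st)) ,
    +-cancelʳ-≡ (slope a * slope a) _ _ (trans (cong (λ x → 2 * (slope a * x) + row v + slope a * slope a) col≡)
      (trans (up B (slope a) (slope a) (col u) (row u) (row v) row≡)
        (trans (regroup″ (slope a) (φ a u) B) (sym (up-bound′ B (slope a) (φ a u))))))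
    where
    regroup′ : ∀ y q r → y + q + r * q ≡ y + suc r * q
    regroup′ = solve-∀
    regroup₃ : ∀ y B q → y + B + q ≡ y + q + B
    regroup₃ = solve-∀
    regroup″ : ∀ a f B → f + B + 2 * (a * a) ≡ f + B + (a * a + a * a)
    regroup″ = solve-∀
    up-bound′ : ∀ B a f → (f + (B + a * a) * 1) + a * a ≡ f + B + (a * a + a * a)
    up-bound′ = solve-∀
    col≡ : col v ≡ col u + slope a
    col≡ = trans cv (trans (sym (next-multiple (x₀ a) (slope a) r)) (cong (_+ slope a) (sym cu)))
    row≡ : row v + slope a * slope a ≡ row u + B
    row≡ = +-cancelʳ-≡ (r * (slope a * slope a)) _ _ (trans (regroup′ (row v) (slope a * slope a) r)
      (trans rv (trans (sym (next-multiple (y₀ a) B r)) (trans (cong (_+ B) (sym ru)) (sym (regroup₃ (row u) B (r * (slope a * slope a))))))))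
    slope≡ : col v ∸ col u ≡ slope a
    slope≡ = trans (cong (_∸ col u) col≡) (m+n∸m≡n (col u) (slope a))
    st : Step u v (slope a)
    st = slope<A a , col≡ , row≡

  point : ∀ a r → r ≤ ℓ → Σ (Fin n) (On a r)
  point a r r≤ℓ =
    let i , q , m = cell {n} (2 * (A * ℓ)) (y₀ a + r * (B ∸ slope a * slope a)) (x₀ a + r * slope a) x< (begin-strict
          (y₀ a + r * (B ∸ slope a * slope a)) * (2 * (A * ℓ)) + (x₀ a + r * slope a)
            <⟨ +-monoʳ-< ((y₀ a + r * (B ∸ slope a * slope a)) * (2 * (A * ℓ))) x< ⟩
          (y₀ a + r * (B ∸ slope a * slope a)) * (2 * (A * ℓ)) + 2 * (A * ℓ)
            ≡⟨ +-comm ((y₀ a + r * (B ∸ slope a * slope a)) * (2 * (A * ℓ))) _ ⟩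
          suc (y₀ a + r * (B ∸ slope a * slope a)) * (2 * (A * ℓ))
            ≤⟨ *-monoˡ-≤ (2 * (A * ℓ)) (+-mono-≤ (y₀< a) (*-mono-≤ r≤ℓ (m∸n≤m B (slope a * slope a)))) ⟩
          (A * A + ℓ * B) * (2 * (A * ℓ))
            ≤⟨ fits ⟩
          n ∎)
    in i , m , trans (cong (_+ r * (slope a * slope a)) q) (trans (regroup (y₀ a) r _ _)
                 (cong (λ b → y₀ a + r * b) (m∸n+n≡m (<⇒≤ (square<B (slope<A a))))))
    where
    open ≤-Reasoning
    regroup : ∀ y r b s → y + r * b + r * s ≡ y + r * (b + s)
    regroup = solve-∀
    x< : x₀ a + r * slope a < 2 * (A * ℓ)
    x< = begin-strict
      x₀ a + r * slope a <⟨ +-monoˡ-< (r * slope a) (x₀< a) ⟩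
      A * ℓ + r * slope a ≤⟨ +-monoʳ-≤ (A * ℓ) (*-mono-≤ r≤ℓ (<⇒≤ (slope<A a))) ⟩
      A * ℓ + ℓ * A ≡⟨ double A ℓ ⟩
      2 * (A * ℓ) ∎
      where
      double : ∀ A ℓ → A * ℓ + ℓ * A ≡ 2 * (A * ℓ)
      double = solve-∀

  difference : ∀ y y′ s z B {r q} → r < q → y + r * s ≡ z + r * B → y′ + q * s ≡ z + q * B →
               y′ + (q ∸ r) * s ≡ y + (q ∸ r) * B
  difference y y′ s z B {r} {q} r<q eq eq′ = +-cancelʳ-≡ (r * s) _ _ (begin
    y′ + (q ∸ r) * s + r * s ≡⟨ regroup y′ (q ∸ r) r s ⟩
    y′ + (r + (q ∸ r)) * s ≡⟨ cong (λ m → y′ + m * s) (m+[n∸m]≡n (<⇒≤ r<q)) ⟩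
    y′ + q * s ≡⟨ eq′ ⟩
    z + q * B ≡⟨ cong (λ m → z + m * B) (m+[n∸m]≡n (<⇒≤ r<q)) ⟨
    z + (r + (q ∸ r)) * B ≡⟨ regroup z (q ∸ r) r B ⟨
    z + (q ∸ r) * B + r * B ≡⟨ regroup′ z ((q ∸ r) * B) (r * B) ⟩
    (z + r * B) + (q ∸ r) * B ≡⟨ cong (_+ (q ∸ r) * B) eq ⟨
    (y + r * s) + (q ∸ r) * B ≡⟨ regroup′ y ((q ∸ r) * B) (r * s) ⟨
    y + (q ∸ r) * B + r * s ∎)
    where
    open ≡-Reasoning
    regroup : ∀ y m r s → y + m * s + r * s ≡ y + (r + m) * s
    regroup = solve-∀
    regroup′ : ∀ z m r → z + m + r ≡ (z + r) + m
    regroup′ = solve-∀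

  ascending : ∀ a {r q u v} → On a r u → On a q v → r < q → row u < row v
  ascending a {r} {q} {u} {v} (_ , ru) (_ , rv) r<q =
    +-cancelʳ-< ((q ∸ r) * (slope a * slope a)) _ _
      (subst (row u + (q ∸ r) * (slope a * slope a) <_)
        (sym (difference (row u) (row v) (slope a * slope a) (y₀ a) B r<q ru rv))
        (+-monoʳ-< (row u) (*-monoʳ-< (q ∸ r) {{>-nonZero (m<n⇒0<n∸m r<q)}} (square<B (slope<A a)))))

  -- Parallel steps coincide. From ma = m′b follow ma² = m′ab and m′b² = mab; inserted into m(B -
  -- a²) = m′(B - b²), they give m(B + ab) = m′(B + ab).
  same-direction : ∀ B a b m m′ y y′ .{{_ : NonZero B}} .{{_ : NonZero m}} → m * a ≡ m′ * b →
                   y′ + m * (a * a) ≡ y + m * B → y′ + m′ * (b * b) ≡ y + m′ * B → a ≡ b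
  same-direction B a b m m′ y y′ x≡ eq eq′ =
    *-cancelˡ-≡ a b m (trans x≡ (cong (_* b) (sym m≡m′)))
    where
    open ≡-Reasoning
    square₁ : m * (a * a) ≡ m′ * (a * b)
    square₁ = trans (regroup m a a) (trans (cong (_* a) x≡) (regroup′ m′ a b))
      where
      regroup : ∀ m a b → m * (a * b) ≡ m * a * b
      regroup = solve-∀
      regroup′ : ∀ m a b → m * b * a ≡ m * (a * b)
      regroup′ = solve-∀
    square₂ : m′ * (b * b) ≡ m * (a * b)
    square₂ = trans (regroup m′ b b) (trans (cong (_* b) (sym x≡)) (sym (regroup m a b)))
      where
      regroup : ∀ m a b → m * (a * b) ≡ m * a * b
      regroup = solve-∀
    m≡m′ : m ≡ m′
    m≡m′ = *-cancelʳ-≡ m m′ (B + a * b) {{>-nonZero (<-≤-trans (>-nonZero⁻¹ B) (m≤m+n B _))}} (+-cancelˡ-≡ y _ _ (begin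
      y + m * (B + a * b) ≡⟨ regroup y m B (a * b) ⟩
      (y + m * B) + m * (a * b) ≡⟨ cong₂ _+_ eq square₂ ⟨
      (y′ + m * (a * a)) + m′ * (b * b) ≡⟨ regroup′ y′ (m * (a * a)) (m′ * (b * b)) ⟩
      (y′ + m′ * (b * b)) + m * (a * a) ≡⟨ cong₂ _+_ eq′ square₁ ⟩
      (y + m′ * B) + m′ * (a * b) ≡⟨ regroup y m′ B (a * b) ⟨
      y + m′ * (B + a * b) ∎))
      where
      regroup : ∀ y m B c → y + m * (B + c) ≡ (y + m * B) + m * c
      regroup = solve-∀
      regroup′ : ∀ y c d → (y + c) + d ≡ (y + d) + c
      regroup′ = solve-∀

  -- Here z and z′ are the heights of the origins of two lines with squared slope s through a common
  -- point. Different positions r < r′ would put the origins (r′ - r)(2M - s) > M apart, but both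
  -- lie in a strip of height M.
  same-time : ∀ {y s z z′ M r r′} → s < M → z < M → y + r * s ≡ z + r * (2 * M) → y + r′ * s ≡ z′ + r′ * (2 * M) → ¬ (r < r′)
  same-time {y} {s} {z} {z′} {M} {r} {r′} s<M z<M eq eq′ r<r′ = <-irrefl eq₃ (begin-strict
    z + m * s ≤⟨ +-monoˡ-≤ (m * s) (<⇒≤ z<M) ⟩
    M + m * s ≤⟨ +-monoˡ-≤ (m * s) (m≤n*m M m {{m≢0}}) ⟩
    m * M + m * s <⟨ +-monoʳ-< (m * M) (*-monoʳ-< m {{m≢0}} s<M) ⟩
    m * M + m * M ≡⟨ regroup m M ⟩
    m * (2 * M) ≤⟨ m≤n+m _ z′ ⟩
    z′ + m * (2 * M) ∎)
    where
    open ≤-Reasoning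
    m = r′ ∸ r
    m≢0 : NonZero m
    m≢0 = >-nonZero (m<n⇒0<n∸m r<r′)
    regroup : ∀ m M → m * M + m * M ≡ m * (2 * M)
    regroup = solve-∀
    regroup′ : ∀ y r m s → y + (r + m) * s ≡ y + r * s + m * s
    regroup′ = solve-∀
    regroup″ : ∀ z c d → z + c + d ≡ z + d + c
    regroup″ = solve-∀
    r′≡ : r′ ≡ r + m
    r′≡ = sym (m+[n∸m]≡n (<⇒≤ r<r′))
    eq₃ : z + m * s ≡ z′ + m * (2 * M)
    eq₃ = +-cancelʳ-≡ (r * (2 * M)) _ _ (begin-equality
      z + m * s + r * (2 * M) ≡⟨ regroup″ z (m * s) (r * (2 * M)) ⟩
      z + r * (2 * M) + m * s ≡⟨ cong (_+ m * s) eq ⟨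
      y + r * s + m * s ≡⟨ regroup′ y r m s ⟨
      y + (r + m) * s ≡⟨ cong (λ q → y + q * s) r′≡ ⟨
      y + r′ * s ≡⟨ eq′ ⟩
      z′ + r′ * (2 * M) ≡⟨ cong (λ q → z′ + q * (2 * M)) r′≡ ⟩
      z′ + (r + m) * (2 * M) ≡⟨ regroup′ z′ r m (2 * M) ⟩
      z′ + r * (2 * M) + m * (2 * M) ≡⟨ regroup″ z′ (r * (2 * M)) (m * (2 * M)) ⟩
      z′ + m * (2 * M) + r * (2 * M) ∎)

  two-points : ∀ {a b r q r′ q′ u v} → On a r u → On a q v → On b r′ u → On b q′ v → r < q → r′ < q′ → a ≡ b
  two-points {a} {b} {r} {q} {r′} {q′} {u} {v} (cu , ru) (cv , rv) (cu′ , ru′) (cv′ , rv′) r<q r′<q′ =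
    Line-ext a b slope≡ (+-cancelʳ-≡ (r * slope a) _ _ (trans (sym cu) (trans cu′ (cong₂ (λ r s → x₀ b + r * s) (sym r≡) (sym slope≡)))))
      (+-cancelʳ-≡ (r * B) _ _ (trans (sym ru) (trans (cong₂ (λ r s → row u + r * (s * s)) r≡ slope≡)
        (trans ru′ (cong (λ r → y₀ b + r * B) (sym r≡))))))
    where
    x-difference : ∀ c {r q} → r < q → col u ≡ x₀ c + r * slope c → col v ≡ x₀ c + q * slope c →
                   col v + (q ∸ r) * 0 ≡ col u + (q ∸ r) * slope c
    x-difference c {r} {q} r<q e e′ = difference (col u) (col v) 0 (x₀ c) (slope c) r<q
      (trans (cong (_+_ (col u)) (*-zeroʳ r)) (trans (+-identityʳ _) e))
      (trans (cong (_+_ (col v)) (*-zeroʳ q)) (trans (+-identityʳ _) e′))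
    x≡ : (q ∸ r) * slope a ≡ (q′ ∸ r′) * slope b
    x≡ = +-cancelˡ-≡ (col u) _ _ (trans (sym (x-difference a r<q cu cv))
      (trans (cong (_+_ (col v)) (trans (*-zeroʳ (q ∸ r)) (sym (*-zeroʳ (q′ ∸ r′))))) (x-difference b r′<q′ cu′ cv′)))
    slope≡ : slope a ≡ slope b
    slope≡ = same-direction B (slope a) (slope b) (q ∸ r) (q′ ∸ r′) (row u) (row v)
      {{>-nonZero (≤-<-trans z≤n (square<B (slope<A a)))}} {{>-nonZero (m<n⇒0<n∸m r<q)}} x≡
      (difference (row u) (row v) (slope a * slope a) (y₀ a) B r<q ru rv)
      (difference (row u) (row v) (slope b * slope b) (y₀ b) B r′<q′ ru′ rv′)
    ru″ : row u + r′ * (slope a * slope a) ≡ y₀ b + r′ * B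
    ru″ = trans (cong (λ s → row u + r′ * (s * s)) slope≡) ru′
    small : slope a * slope a < A * A
    small = *-mono-< (slope<A a) (slope<A a)
    r≡ : r ≡ r′
    r≡ with <-cmp r r′
    ... | tri< r<r′ _ _ = ⊥-elim (same-time {row u} {slope a * slope a} {y₀ a} {y₀ b} small (y₀< a) ru ru″ r<r′)
    ... | tri≈ _ eq _   = eq
    ... | tri> _ _ r′<r = ⊥-elim (same-time {row u} {slope a * slope a} {y₀ b} {y₀ a} small (y₀< b) ru″ ru r′<r)

  lower-bound : ∀ H β → ∣ H ∣ < Line → IsHopset G H β 0ℚ → ℓ ≤ β
  lower-bound = few-shortcuts⇒many-hops
    (λ a → >-nonZero (<-≤-trans (≤-<-trans z≤n (square<B (slope<A a))) (m≤m+n B _)))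
    (λ a e → proj₁ (step-on a e)) tight-step point line-step ascending two-points

-- With A = κℓ the grid takes at most 6A³ℓ² = 6κ³ℓ⁵ vertices and has A⁴ℓ = κ⁴ℓ⁵ lines. The constant
-- 192 is 6 · 2⁵, the last factor coming from ℓ + 1 ≤ 2ℓ.
unweighted-at : ∀ C κ ℓ n → 192 * C < κ → 1 ≤ ℓ → 6 * (κ * (κ * κ)) * ℓ ^ 5 ≤ n → n < 6 * (κ * (κ * κ)) * suc ℓ ^ 5 →
  ∃[ G ] Unweighted {n} G × (∀ (H : PairSet n) (β : ℕ) → ∣ H ∣ ≤ C * n → IsHopset G H β 0ℚ → n ≤ (6 * (κ * (κ * κ)) * 2 * β) ^ 5)
unweighted-at C κ ℓ n C<κ 1≤ℓ lo hi = Grid.G , (λ _ → refl) , λ H β few hopset →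
    root-bound K {{K≢0}} 4 1≤ℓ hi (Grid.lower-bound H β (≤-<-trans few enough) hopset)
  where
  open ≤-Reasoning
  A K M : ℕ
  A = κ * ℓ
  K = 6 * (κ * (κ * κ))
  M = κ * (κ * κ) * ℓ ^ 5
  instance
    κ≢0 : NonZero κ
    κ≢0 = >-nonZero (≤-<-trans z≤n C<κ)
    ℓ≢0 : NonZero ℓ
    ℓ≢0 = >-nonZero 1≤ℓ
    κ³≢0 : NonZero (κ * (κ * κ))
    κ³≢0 = m*n≢0 κ (κ * κ) {{κ≢0}} {{m*n≢0 κ κ}}
  K≢0 : NonZero K
  K≢0 = m*n≢0 6 (κ * (κ * κ))
  fits : (A * A + ℓ * (2 * (A * A))) * (2 * (A * ℓ)) ≤ n
  fits = begin
    (A * A + ℓ * (2 * (A * A))) * (2 * (A * ℓ)) ≤⟨ *-monoˡ-≤ (2 * (A * ℓ)) (+-monoˡ-≤ _ (m≤n*m (A * A) ℓ)) ⟩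
    (ℓ * (A * A) + ℓ * (2 * (A * A))) * (2 * (A * ℓ)) ≡⟨ regroup κ ℓ ⟩
    K * ℓ ^ 5 ≤⟨ lo ⟩
    n ∎
    where
    regroup : ∀ κ ℓ → (ℓ * (κ * ℓ * (κ * ℓ)) + ℓ * (2 * (κ * ℓ * (κ * ℓ)))) * (2 * (κ * ℓ * ℓ)) ≡
                      6 * (κ * (κ * κ)) * (ℓ * (ℓ * (ℓ * (ℓ * (ℓ * 1)))))
    regroup = solve-∀
  module Grid = ConvexGrid n A ℓ {{m*n≢0 κ ℓ}} fits
  enough : C * n < A * ((A * ℓ) * (A * A))
  enough = begin-strict
    C * n ≤⟨ *-monoʳ-≤ C (<⇒≤ hi) ⟩
    C * (K * suc ℓ ^ 5) ≤⟨ *-monoʳ-≤ C (*-monoʳ-≤ K (^-monoˡ-≤ 5 (suc-≤-double 1≤ℓ))) ⟩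
    C * (K * (2 * ℓ) ^ 5) ≡⟨ cong (λ x → C * (K * x)) (^-distribˡ-* 2 ℓ 5) ⟩
    C * (K * (2 ^ 5 * ℓ ^ 5)) ≡⟨ regroup C (κ * (κ * κ)) (ℓ ^ 5) ⟩
    192 * C * M <⟨ *-monoˡ-< M {{m*n≢0 (κ * (κ * κ)) (ℓ ^ 5) {{κ³≢0}} {{m^n≢0 ℓ 5}}}} C<κ ⟩
    κ * M ≡⟨ regroup′ κ ℓ ⟩
    A * ((A * ℓ) * (A * A)) ∎
    where
    regroup : ∀ C k l → C * (6 * k * (32 * l)) ≡ 192 * C * (k * l)
    regroup = solve-∀
    regroup′ : ∀ κ ℓ → κ * (κ * (κ * κ) * (ℓ * (ℓ * (ℓ * (ℓ * (ℓ * 1)))))) ≡ κ * ℓ * ((κ * ℓ * ℓ) * (κ * ℓ * (κ * ℓ)))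
    regroup′ = solve-∀

unweighted : ∀ (C : ℕ) → ∃[ c ] ∃[ n₀ ] (∀ n → n ≥ n₀ →
  ∃[ G ] Unweighted G × (∀ (H : PairSet n) (β : ℕ) → ∣ H ∣ ≤ C * n → IsHopset G H β 0ℚ → ⟨ n ^ + 1 / 5 ⟩≤ c * β))
unweighted C = with-constant (suc (192 * C)) ≤-refl
  where
  with-constant : ∀ κ → 192 * C < κ → ∃[ c ] ∃[ n₀ ] (∀ n → n ≥ n₀ →
    ∃[ G ] Unweighted G × (∀ (H : PairSet n) (β : ℕ) → ∣ H ∣ ≤ C * n → IsHopset G H β 0ℚ → ⟨ n ^ + 1 / 5 ⟩≤ c * β))
  with-constant κ C<κ = K * 2 , K , λ n n≥ →
    let ℓ , 1≤ℓ , lo , hi = ∃root K {{K≢0}} 4 n n≥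
        G , unit , bound  = unweighted-at C κ ℓ n C<κ 1≤ℓ lo hi
    in G , unit , λ H β few hopset → ≤-trans (≤-reflexive (^-identityʳ n)) (bound H β few hopset)
    where
    K : ℕ
    K = 6 * (κ * (κ * κ))
    κ≢0 : NonZero κ
    κ≢0 = >-nonZero (≤-<-trans z≤n C<κ)
    K≢0 : NonZero K
    K≢0 = m*n≢0 6 (κ * (κ * κ)) {{_}} {{m*n≢0 κ (κ * κ) {{κ≢0}} {{m*n≢0 κ κ {{κ≢0}} {{κ≢0}}}}}}

-- Part (2): vectors and walks in layered graphs

infixl 6 _⊕_
infixl 7 _·_

_⊕_ : ∀ {m} → Vec ℕ m → Vec ℕ m → Vec ℕ m
[]       ⊕ []       = []
(x ∷ xs) ⊕ (y ∷ ys) = (x + y) ∷ (xs ⊕ ys)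

0ᵛ : ∀ {m} → Vec ℕ m
0ᵛ = Vec.replicate _ 0

_·_ : ∀ {m} → ℕ → Vec ℕ m → Vec ℕ m
r · xs = Vec.map (r *_) xs

∥_∥² : ∀ {m} → Vec ℕ m → ℕ
∥ [] ∥²     = 0
∥ x ∷ xs ∥² = x * x + ∥ xs ∥²

⟪_,_⟫ : ∀ {m} → Vec ℕ m → Vec ℕ m → ℕ
⟪ [] , [] ⟫         = 0
⟪ x ∷ xs , y ∷ ys ⟫ = x * y + ⟪ xs , ys ⟫

gap² : ∀ {m} → Vec ℕ m → Vec ℕ m → ℕ
gap² [] []             = 0
gap² (x ∷ xs) (y ∷ ys) = gap x y * gap x y + gap² xs ys

⊕-assoc : ∀ {m} (a b c : Vec ℕ m) → a ⊕ b ⊕ c ≡ a ⊕ (b ⊕ c)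
⊕-assoc [] [] []                = refl
⊕-assoc (x ∷ a) (y ∷ b) (z ∷ c) = cong₂ _∷_ (+-assoc x y z) (⊕-assoc a b c)

⊕-identityʳ : ∀ {m} (a : Vec ℕ m) → a ⊕ 0ᵛ ≡ a
⊕-identityʳ []      = refl
⊕-identityʳ (x ∷ a) = cong₂ _∷_ (+-identityʳ x) (⊕-identityʳ a)

⊕-identityˡ : ∀ {m} (a : Vec ℕ m) → 0ᵛ ⊕ a ≡ a
⊕-identityˡ []      = refl
⊕-identityˡ (x ∷ a) = cong (x ∷_) (⊕-identityˡ a)

⊕-cancelˡ : ∀ {m} (a b c : Vec ℕ m) → a ⊕ b ≡ a ⊕ c → b ≡ c
⊕-cancelˡ [] [] [] _                  = refl
⊕-cancelˡ (x ∷ a) (y ∷ b) (z ∷ c) eq =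
  cong₂ _∷_ (+-cancelˡ-≡ x y z (Vec.∷-injectiveˡ eq)) (⊕-cancelˡ a b c (Vec.∷-injectiveʳ eq))

⊕-cancelʳ : ∀ {m} (a b c : Vec ℕ m) → b ⊕ a ≡ c ⊕ a → b ≡ c
⊕-cancelʳ [] [] [] _                  = refl
⊕-cancelʳ (x ∷ a) (y ∷ b) (z ∷ c) eq =
  cong₂ _∷_ (+-cancelʳ-≡ x y z (Vec.∷-injectiveˡ eq)) (⊕-cancelʳ a b c (Vec.∷-injectiveʳ eq))

suc-· : ∀ {m} r (a : Vec ℕ m) → suc r · a ≡ a ⊕ r · a
suc-· r []      = refl
suc-· r (x ∷ a) = cong (x + r * x ∷_) (suc-· r a)

zero-· : ∀ {m} (a : Vec ℕ m) → 0 · a ≡ 0ᵛ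
zero-· []      = refl
zero-· (x ∷ a) = cong (0 ∷_) (zero-· a)

⊕-suc-· : ∀ {m} (z : Vec ℕ m) r a → z ⊕ suc r · a ≡ z ⊕ r · a ⊕ a
⊕-suc-· [] r []           = refl
⊕-suc-· (z ∷ zs) r (a ∷ as) = cong₂ _∷_ (regroup z a (r * a)) (⊕-suc-· zs r as)
  where
  regroup : ∀ z a b → z + (a + b) ≡ z + b + a
  regroup = solve-∀

⊕-++ : ∀ {m k} (a b : Vec ℕ m) (c d : Vec ℕ k) → (a Vec.++ c) ⊕ (b Vec.++ d) ≡ (a ⊕ b) Vec.++ (c ⊕ d)
⊕-++ [] [] c d           = refl
⊕-++ (x ∷ a) (y ∷ b) c d = cong (x + y ∷_) (⊕-++ a b c d)

∥++∥² : ∀ {m k} (a : Vec ℕ m) (b : Vec ℕ k) → ∥ a Vec.++ b ∥² ≡ ∥ a ∥² + ∥ b ∥²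
∥++∥² [] b      = refl
∥++∥² (x ∷ a) b = trans (cong (_+_ (x * x)) (∥++∥² a b)) (sym (+-assoc (x * x) _ _))

double-interchange : ∀ a b c d → 2 * a + b + (2 * c + d) ≡ 2 * (a + c) + (b + d)
double-interchange = solve-∀

polarisation : ∀ {m} (a b : Vec ℕ m) → ∥ a ∥² + ∥ b ∥² ≡ 2 * ⟪ a , b ⟫ + gap² a b
polarisation [] []           = refl
polarisation (x ∷ a) (y ∷ b) = trans (interchange (x * x) _ (y * y) _)
  (trans (cong₂ _+_ (square-gap x y) (polarisation a b)) (double-interchange (x * y) (gap x y * gap x y) ⟪ a , b ⟫ (gap² a b)))

gap²≡0 : ∀ {m} (a b : Vec ℕ m) → gap² a b ≡ 0 → a ≡ b
gap²≡0 [] [] _             = refl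
gap²≡0 (x ∷ a) (y ∷ b) eq = cong₂ _∷_
  (∣m-n∣≡0⇒m≡n (square≡0 (gap x y) (m+n≡0⇒m≡0 (gap x y * gap x y) eq))) (gap²≡0 a b (m+n≡0⇒n≡0 (gap x y * gap x y) eq))

⟪⊕⟫ : ∀ {m} (a b c : Vec ℕ m) → ⟪ a ⊕ b , c ⟫ ≡ ⟪ a , c ⟫ + ⟪ b , c ⟫
⟪⊕⟫ [] [] []                = refl
⟪⊕⟫ (x ∷ a) (y ∷ b) (z ∷ c) = trans (cong (_+_ ((x + y) * z)) (⟪⊕⟫ a b c)) (regroup x y z _ _)
  where
  regroup : ∀ x y z u v → (x + y) * z + (u + v) ≡ x * z + u + (y * z + v)
  regroup = solve-∀

⟪·⟫ : ∀ {m} r (a : Vec ℕ m) → ⟪ r · a , a ⟫ ≡ r * ∥ a ∥²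
⟪·⟫ r []      = sym (*-zeroʳ r)
⟪·⟫ r (x ∷ a) = trans (cong (_+_ (r * x * x)) (⟪·⟫ r a)) (regroup r x _)
  where
  regroup : ∀ r x s → r * x * x + r * s ≡ r * (x * x + s)
  regroup = solve-∀

Σᵛ : ∀ {m r} → Vec (Vec ℕ m) r → Vec ℕ m
Σᵛ []       = 0ᵛ
Σᵛ (a ∷ as) = a ⊕ Σᵛ as

Σ∥_∥² : ∀ {m r} → Vec (Vec ℕ m) r → ℕ
Σ∥ [] ∥²     = 0
Σ∥ a ∷ as ∥² = ∥ a ∥² + Σ∥ as ∥²

Σgap² : ∀ {m r} → Vec (Vec ℕ m) r → Vec ℕ m → ℕ
Σgap² [] b       = 0
Σgap² (a ∷ as) b = gap² a b + Σgap² as b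

data AllEqual {m} (b : Vec ℕ m) : ∀ {r} → Vec (Vec ℕ m) r → Set where
  []  : AllEqual b []
  _∷_ : ∀ {a r} {as : Vec _ r} → a ≡ b → AllEqual b as → AllEqual b (a ∷ as)

-- The squared distances of the vectors from `b` add up to the sum of the squared norms, minus twice
-- the product of the sum with `b`, plus r times the squared norm of `b`. The hypotheses make this
-- zero.
equality-in-Jensen : ∀ {m r} (as : Vec (Vec ℕ m) r) b → Σᵛ as ≡ r · b → Σ∥ as ∥² ≡ r * ∥ b ∥² → AllEqual b as
equality-in-Jensen {r = r} as b Σ≡ Σ²≡ = all-equal as (m+n≡0⇒m≡0 (Σgap² as b) {0} (trans (+-identityʳ _) no-gap))
  where
  expand : ∀ {r} (as : Vec _ r) → Σ∥ as ∥² + r * ∥ b ∥² ≡ 2 * ⟪ Σᵛ as , b ⟫ + Σgap² as b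
  expand [] = sym (trans (+-identityʳ _) (cong (2 *_) (zero-dot b)))
    where
    zero-dot : ∀ {m} (b : Vec ℕ m) → ⟪ 0ᵛ , b ⟫ ≡ 0
    zero-dot []      = refl
    zero-dot (x ∷ b) = zero-dot b
  expand {suc r} (a ∷ as) = trans (interchange ∥ a ∥² (Σ∥ as ∥²) ∥ b ∥² (r * ∥ b ∥²))
    (trans (cong₂ _+_ (polarisation a b) (expand as)) (trans (double-interchange ⟪ a , b ⟫ (gap² a b) ⟪ Σᵛ as , b ⟫ (Σgap² as b))
      (cong (λ x → 2 * x + (gap² a b + Σgap² as b)) (sym (⟪⊕⟫ a (Σᵛ as) b)))))
  no-gap : Σgap² as b ≡ 0
  no-gap = +-cancelˡ-≡ (r * ∥ b ∥² + r * ∥ b ∥²) _ _ (sym (trans (+-identityʳ _)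
    (trans (cong (_+ r * ∥ b ∥²) (sym Σ²≡)) (trans (expand as)
      (cong (_+ Σgap² as b) (trans (cong (λ x → 2 * ⟪ x , b ⟫) Σ≡) (trans (cong (2 *_) (⟪·⟫ r b)) (double (r * ∥ b ∥²)))))))))
    where
    double : ∀ x → 2 * x ≡ x + x
    double = solve-∀
  all-equal : ∀ {r} (as : Vec _ r) → Σgap² as b ≡ 0 → AllEqual b as
  all-equal [] _        = []
  all-equal (a ∷ as) eq = gap²≡0 a b (m+n≡0⇒m≡0 (gap² a b) eq) ∷ all-equal as (m+n≡0⇒n≡0 (gap² a b) eq)

-- The point of the paraboloid above `a`. By strict convexity, r lifted vectors with sum
-- `r · lifted b` must all be `lifted b`.
lifted : ∀ {m} → Vec ℕ m → Vec ℕ (suc m)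
lifted a = ∥ a ∥² ∷ a

lifted-injective : ∀ {m} {a b : Vec ℕ m} → lifted a ≡ lifted b → a ≡ b
lifted-injective = Vec.∷-injectiveʳ

-- Squared norms add under concatenation, so a lifted vector can be added in two instalments.
lifted-++ : ∀ {m k} (z : Vec ℕ (suc (m + k))) (p : Vec ℕ m) (q : Vec ℕ k) →
            z ⊕ (∥ p ∥² ∷ (p Vec.++ 0ᵛ)) ⊕ (∥ q ∥² ∷ (0ᵛ Vec.++ q)) ≡ z ⊕ lifted (p Vec.++ q)
lifted-++ z p q = trans (⊕-assoc z _ _) (cong (z ⊕_) (cong₂ _∷_ (sym (∥++∥² p q))
  (trans (⊕-++ p 0ᵛ 0ᵛ q) (cong₂ Vec._++_ (⊕-identityʳ p) (⊕-identityˡ q)))))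

-- The flag of a step records whether a hop starts with it.
module Traces {V : Set} (τ : V → ℕ) (Fwd : V → V → Set) (tick : ∀ {u v} → Fwd u v → τ v ≡ suc (τ u)) where

  data Step : V → V → Set where
    fwd : ∀ {u v} → Bool → Fwd u v → Step u v
    bwd : ∀ {u v} → Bool → Fwd v u → Step u v

  infixr 5 _⨾_ _⧺_

  data Trace : V → V → Set where
    ε   : ∀ {u} → Trace u u
    _⨾_ : ∀ {u v w} → Step u v → Trace v w → Trace u w

  _⧺_ : ∀ {u v w} → Trace u v → Trace v w → Trace u w
  ε       ⧺ q = q
  (s ⨾ p) ⧺ q = s ⨾ (p ⧺ q)

  flag : Bool → ℕ
  flag true  = 1
  flag false = 0

  cost : ∀ {u v} → Step u v → ℕ
  cost (fwd b _) = flag b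
  cost (bwd b _) = suc (flag b)

  bad : ∀ {u v} → Trace u v → ℕ
  bad ε       = 0
  bad (s ⨾ p) = cost s + bad p

  bad-⧺ : ∀ {u v w} (p : Trace u v) (q : Trace v w) → bad (p ⧺ q) ≡ bad p + bad q
  bad-⧺ ε q       = refl
  bad-⧺ (s ⨾ p) q = trans (cong (_+_ (cost s)) (bad-⧺ p q)) (sym (+-assoc (cost s) _ _))

  All : (V → Set) → ∀ {u w} → Trace u w → Set
  All P {u} ε       = P u
  All P {u} (s ⨾ p) = P u × All P p

  All-head : ∀ {P u w} (p : Trace u w) → All P p → P u
  All-head ε       x       = x
  All-head (s ⨾ p) (x , _) = x

  All-last : ∀ {P u w} (p : Trace u w) → All P p → P w
  All-last ε       x       = x
  All-last (s ⨾ p) (_ , y) = All-last p y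

  All-map : ∀ {P Q : V → Set} → (∀ {x} → P x → Q x) → ∀ {u w} (p : Trace u w) → All P p → All Q p
  All-map f ε       x       = f x
  All-map f (s ⨾ p) (x , y) = f x , All-map f p y

  All-zip : ∀ {P Q : V → Set} {u w} (p : Trace u w) → All P p → All Q p → All (λ x → P x × Q x) p
  All-zip ε       x       y       = x , y
  All-zip (s ⨾ p) (x , a) (y , b) = (x , y) , All-zip p a b

  All-⧺ˡ : ∀ {P u v w} (p : Trace u v) (q : Trace v w) → All P (p ⧺ q) → All P p
  All-⧺ˡ ε       q a       = All-head q a
  All-⧺ˡ (s ⨾ p) q (x , a) = x , All-⧺ˡ p q a

  All-⧺ʳ : ∀ {P u v w} (p : Trace u v) (q : Trace v w) → All P (p ⧺ q) → All P q
  All-⧺ʳ ε       q a       = a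
  All-⧺ʳ (s ⨾ p) q (x , a) = All-⧺ʳ p q a

  All-⧺ : ∀ {P u v w} (p : Trace u v) (q : Trace v w) → All P p → All P q → All P (p ⧺ q)
  All-⧺ ε       q a       b = b
  All-⧺ (s ⨾ p) q (x , a) b = x , All-⧺ p q a b

  -- A prefix without flags and backward steps, hence inside a single hop.
  data Prefix : ∀ {u w} → Trace u w → V → Set where
    stop : ∀ {u w} {p : Trace u w} → Prefix p u
    go   : ∀ {u v w x} {e : Fwd u v} {p : Trace v w} → Prefix p x → Prefix (fwd false e ⨾ p) x

  data Run : ∀ {u w} → Trace u w → V → V → Set where
    here  : ∀ {u w x} {p : Trace u w} → Prefix p x → Run p u x
    there : ∀ {u v w x y} {s : Step u v} {p : Trace v w} → Run p x y → Run (s ⨾ p) x y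

  clean⇒Prefix : ∀ {u w} (p : Trace u w) → bad p ≡ 0 → Prefix p w
  clean⇒Prefix ε                   _  = stop
  clean⇒Prefix (fwd false e ⨾ p)   eq = go (clean⇒Prefix p eq)

  Prefix-⧺ˡ : ∀ {u v w x} {p : Trace u v} (q : Trace v w) → Prefix p x → Prefix (p ⧺ q) x
  Prefix-⧺ˡ q stop   = stop
  Prefix-⧺ˡ q (go r) = go (Prefix-⧺ˡ q r)

  Run-⧺ˡ : ∀ {u v w x y} {p : Trace u v} (q : Trace v w) → Run p x y → Run (p ⧺ q) x y
  Run-⧺ˡ q (here r)  = here (Prefix-⧺ˡ q r)
  Run-⧺ˡ q (there r) = there (Run-⧺ˡ q r)

  Run-⧺ʳ : ∀ {u v w x y} (p : Trace u v) {q : Trace v w} → Run q x y → Run (p ⧺ q) x y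
  Run-⧺ʳ ε       r = r
  Run-⧺ʳ (s ⨾ p) r = there (Run-⧺ʳ p r)

  Run-All : ∀ {P u w x y} {p : Trace u w} → Run p x y → All P p → P x
  Run-All {p = p} (here r)  a       = All-head p a
  Run-All         (there r) (_ , a) = Run-All r a

  private
    -- Backward steps are indexed by the layer they land on: a trace gets from above layer t down to
    -- t only by a step counted in `backsAt t`.
    backAt backFrom : ℕ → ∀ {u v} → Step u v → ℕ
    backAt t (fwd _ _)           = 0
    backAt t (bwd {v = v} _ _)   = if ⌊ τ v ≟ t ⌋ then 1 else 0
    backFrom t (fwd _ _)         = 0
    backFrom t (bwd {v = v} _ _) = if ⌊ t ≤? τ v ⌋ then 1 else 0

    backsAt backsFrom : ℕ → ∀ {u v} → Trace u v → ℕ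
    backsAt t ε         = 0
    backsAt t (s ⨾ p)   = backAt t s + backsAt t p
    backsFrom t ε       = 0
    backsFrom t (s ⨾ p) = backFrom t s + backsFrom t p

    back-split : ∀ t {u v} (s : Step u v) → backAt t s + backFrom (suc t) s ≤ backFrom t s
    back-split t (fwd _ _) = z≤n
    back-split t (bwd {v = v} _ _) with τ v ≟ t | suc t ≤? τ v | t ≤? τ v
    ... | yes refl | yes lt | _      = ⊥-elim (<-irrefl refl lt)
    ... | yes refl | no _   | yes _  = ≤-refl
    ... | yes refl | no _   | no t≰t = ⊥-elim (t≰t ≤-refl)
    ... | no _     | yes lt | yes _  = ≤-refl
    ... | no _     | yes lt | no t≰  = ⊥-elim (t≰ (<⇒≤ lt))
    ... | no _     | no _   | _      = z≤n

    backs-split : ∀ t {u v} (p : Trace u v) → backsAt t p + backsFrom (suc t) p ≤ backsFrom t p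
    backs-split t ε       = z≤n
    backs-split t (s ⨾ p) = ≤-trans (≤-reflexive (interchange (backAt t s) _ _ _)) (+-mono-≤ (back-split t s) (backs-split t p))

    backs≤bad : ∀ t {u v} (p : Trace u v) → backsFrom t p ≤ bad p
    backs≤bad t ε               = z≤n
    backs≤bad t (fwd b _ ⨾ p)   = ≤-trans (backs≤bad t p) (m≤n+m _ (flag b))
    backs≤bad t (bwd {v = v} b _ ⨾ p) = +-mono-≤ (≤-trans one (s≤s z≤n)) (backs≤bad t p)
      where
      one : (if ⌊ t ≤? τ v ⌋ then 1 else 0) ≤ 1
      one with t ≤? τ v
      ... | yes _ = ≤-refl
      ... | no _  = z≤n

    clean-layer : ∀ W a {u v} (p : Trace u v) → backsFrom a p < W → ∃[ t ] a ≤ t × t < a + W × backsAt t p ≡ 0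
    clean-layer (suc W) a p (s≤s le) with backsAt a p in eq
    ... | zero  = a , ≤-refl , m<m+n a (s≤s z≤n) , eq
    ... | suc m with clean-layer W (suc a) p (<-≤-trans (s≤s (m≤n+m _ m))
                       (≤-trans (≤-trans (≤-reflexive (cong (_+ backsFrom (suc a) p) (sym eq))) (backs-split a p)) le))
    ... | t , a<t , t< , clean = t , <⇒≤ a<t , subst (t <_) (sym (+-suc a W)) t< , clean

    stays-above : ∀ t {u w} (p : Trace u w) → backsAt t p ≡ 0 → t < τ u → All (λ x → t < τ x) p
    stays-above t ε _ t<u = t<u
    stays-above t (fwd b e ⨾ p) eq t<u = t<u , stays-above t p eq (<-trans t<u (≤-reflexive (sym (tick e))))
    stays-above t (bwd {v = v} b e ⨾ p) eq t<u with τ v ≟ t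
    ... | no τv≢t = t<u , stays-above t p eq (≤∧≢⇒< (s≤s⁻¹ (subst (t <_) (tick e) t<u)) (τv≢t ∘ sym))

  record Cut {u w} (p : Trace u w) (a b : ℕ) : Set where
    field
      {mid} : V
      p₁    : Trace u mid
      p₂    : Trace mid w
      eq    : p ≡ p₁ ⧺ p₂
      lower : a ≤ τ mid
      upper : τ mid ≤ b
      below : All (λ x → τ x ≤ τ mid) p₁
      above : All (λ x → τ mid ≤ τ x) p₂

  private
    -- The cut is made at the first arrival on layer t + 1, so nothing before it lies higher. As no
    -- backward step lands on t, nothing after it lies lower.
    splitAt : ∀ t {u w} (p : Trace u w) → backsAt t p ≡ 0 → τ u ≤ t → t < τ w → Cut p (suc t) (suc t)
    splitAt t ε eq u≤t t<u = ⊥-elim (<-irrefl refl (<-≤-trans t<u u≤t))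
    splitAt t (fwd {u} {v} b e ⨾ p) eq u≤t t<w with τ u ≟ t
    ... | yes refl = record { p₁ = fwd b e ⨾ ε ; p₂ = p ; eq = refl ; lower = ≤-reflexive (sym (tick e)) ; upper = ≤-reflexive (tick e)
                            ; below = ≤-trans (n≤1+n _) (≤-reflexive (sym (tick e))) , ≤-refl
                            ; above = All-map (≤-trans (≤-reflexive (tick e))) p (stays-above t p eq (≤-reflexive (sym (tick e)))) }
    ... | no u≢t with splitAt t p eq (≤-trans (≤-reflexive (tick e)) (≤∧≢⇒< u≤t u≢t)) t<w
    ... | record { p₁ = p₁ ; p₂ = p₂ ; eq = refl ; lower = l ; upper = r ; below = b′ ; above = a } =
          record { p₁ = fwd b e ⨾ p₁ ; p₂ = p₂ ; eq = refl ; lower = l ; upper = r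
                 ; below = ≤-trans u≤t (≤-trans (n≤1+n t) l) , b′ ; above = a }
    splitAt t (bwd {u} {v} b e ⨾ p) eq u≤t t<w
      with splitAt t p (m+n≡0⇒n≡0 (backAt t (bwd b e)) eq) (≤-trans (n≤1+n _) (≤-trans (≤-reflexive (sym (tick e))) u≤t)) t<w
    ... | record { p₁ = p₁ ; p₂ = p₂ ; eq = refl ; lower = l ; upper = r ; below = b′ ; above = a } =
          record { p₁ = bwd b e ⨾ p₁ ; p₂ = p₂ ; eq = refl ; lower = l ; upper = r
                 ; below = ≤-trans u≤t (≤-trans (n≤1+n t) l) , b′ ; above = a }

  -- Each backward step spoils one of W consecutive layers.
  cut : ∀ W a {u w} (p : Trace u w) → τ u ≤ a → a + W ≤ τ w → bad p < W → Cut p a (a + W)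
  cut W a p u≤a W≤w bad< with clean-layer W a p (≤-<-trans (backs≤bad a p) bad<)
  ... | t , a≤t , t< , clean with splitAt t p clean (≤-trans u≤a a≤t) (<-≤-trans t< W≤w)
  ... | c = record { Cut c ; lower = ≤-trans a≤t (≤-trans (n≤1+n t) (Cut.lower c)) ; upper = ≤-trans (Cut.upper c) t< }

  -- A backward step is an edge traversed against its direction, so a value preserved by the edges
  -- survives any wandering between the two layers.
  invariant : ∀ {X : Set} (f : V → X) lo hi → (∀ {x y} → Fwd x y → lo ≤ τ x → τ x < hi → f x ≡ f y) →
              ∀ {u w} (p : Trace u w) → All (λ x → lo ≤ τ x × τ x ≤ hi) p → All (λ x → f x ≡ f u) p
  invariant f lo hi keep ε _ = refl
  invariant f lo hi keep (fwd b e ⨾ p) ((l , _) , a) = refl ,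
    All-map (λ eq → trans eq (sym (keep e l (≤-trans (≤-reflexive (sym (tick e))) (proj₂ (All-head p a))))))
      p (invariant f lo hi keep p a)
  invariant f lo hi keep (bwd b e ⨾ p) ((_ , r) , a) = refl ,
    All-map (λ eq → trans eq (keep e (proj₁ (All-head p a)) (≤-trans (≤-reflexive (sym (tick e))) r)))
      p (invariant f lo hi keep p a)

-- Part (2): the machines and their robustness

Layer : Set → Set
Layer S = S → S → Bool

repeat : ∀ {A : Set} → ℕ → List A → List A
repeat zero    p = []
repeat (suc r) p = p ++ repeat r p

module Idling {S : Set} (_≟ˢ_ : (x y : S) → Dec (x ≡ y)) where
  idle : Layer S
  idle x y = ⌊ x ≟ˢ y ⌋

  rest : ℕ → List (Layer S)
  rest W = replicate W idle

  length-rest : ∀ W ms → length (rest W ++ ms) ≡ W + length ms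
  length-rest zero ms    = refl
  length-rest (suc W) ms = cong suc (length-rest W ms)

  past-rest : ∀ {o} W ms → o + length (rest W ++ ms) ≡ o + W + length ms
  past-rest {o} W ms = trans (cong (_+_ o) (length-rest W ms)) (sym (+-assoc o W _))

  past-layer : ∀ {o} (l : Layer S) W ms → o + length (l ∷ rest W ++ ms) ≡ suc o + W + length ms
  past-layer {o} l W ms = trans (+-suc o _) (past-rest W ms)

-- A program for a layered graph.  A line prescribes the values read at its two ends; `budget`
-- bounds the backward steps and hops of the walks that have to follow some line to the letter
-- for a while.
record Gadget : Set₁ where
  field
    State   : Set
    _≟ˢ_    : (x y : State) → Dec (x ≡ y)
    width   : ℕ
    read    : State → Vec ℕ width
    program : List (Layer State)
    budget  : ℕ
    Line    : Set
    source  : Line → Vec ℕ width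
    target  : Line → Vec ℕ width
  open Idling _≟ˢ_ public

-- R rounds, each adding the lift (‖a‖² , a) of an arbitrary vector a coordinate by coordinate
-- through a one-number register; a line (z , a) adds the same a in each round.
module Base (D R : ℕ) where

  State : Set
  State = ℕ × Vec ℕ (suc D)

  _≟ˢ_ : (x y : State) → Dec (x ≡ y)
  _≟ˢ_ = ×.≡-dec _≟_ (Vec.≡-dec _≟_)

  open Idling _≟ˢ_

  choose : Layer State
  choose (_ , z) (_ , z′) = ⌊ Vec.≡-dec _≟_ z z′ ⌋

  bump : (ℕ → Vec ℕ D) → State → State
  bump slot (c , z) = c , z ⊕ (c * c ∷ slot c)

  add : (ℕ → Vec ℕ D) → Layer State
  add slot x y = ⌊ bump slot x ≟ˢ y ⌋

  -- `ι` places the coordinates still to come behind zeros. Reusing the register for each coordinate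
  -- keeps the state small: with all of `a` in the state there would be, to leading order, as many
  -- vertices as lines.
  pass : ∀ m → (Vec ℕ m → Vec ℕ D) → List (Layer State)
  pass zero    ι = []
  pass (suc m) ι = choose ∷ rest R ++ add (λ c → ι (c ∷ 0ᵛ)) ∷ rest R ++ pass m (λ a → ι (0 ∷ a))

  base : Gadget
  base = record
    { State   = State
    ; _≟ˢ_    = _≟ˢ_
    ; width   = suc D
    ; read    = proj₂
    ; program = rest R ++ repeat R (pass D id)
    ; budget  = R
    ; Line    = Vec ℕ (suc D) × Vec ℕ D
    ; source  = proj₁
    ; target  = λ (z , a) → z ⊕ R · lifted a
    }

-- Each round lets the inner state be chosen afresh, adds what is read before and after a passage
-- through the inner program, and a line uses the same inner line in each round.
module Nest (R : ℕ) (I : Gadget) where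
  private module I = Gadget I

  Outer : Set
  Outer = Vec ℕ (suc (I.width + I.width))

  State : Set
  State = Outer × I.State

  _≟ˢ_ : (x y : State) → Dec (x ≡ y)
  _≟ˢ_ = ×.≡-dec (Vec.≡-dec _≟_) I._≟ˢ_

  open Idling _≟ˢ_

  -- It serves two purposes. Fewer than `W` backward steps cannot spoil every layer of a rest, and
  -- `R` rounds sharing fewer than `R * I.budget` bad steps include one within the inner budget.
  W : ℕ
  W = R * I.budget

  choose : Layer State
  choose (z , _) (z′ , _) = ⌊ Vec.≡-dec _≟_ z z′ ⌋

  inner : Layer I.State → Layer State
  inner l (z , x) (z′ , x′) = ⌊ Vec.≡-dec _≟_ z z′ ⌋ ∧ l x x′

  -- The two instalments of `lifted (p ++ p′)`: each is added at the moment when its half can be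
  -- read off the inner state, so neither half is stored separately.
  before after : Vec ℕ I.width → Outer
  before p = ∥ p ∥² ∷ (p Vec.++ 0ᵛ)
  after  p = ∥ p ∥² ∷ (0ᵛ Vec.++ p)

  bump : (Vec ℕ I.width → Outer) → State → State
  bump half (z , x) = z ⊕ half (I.read x) , x

  add : (Vec ℕ I.width → Outer) → Layer State
  add half x y = ⌊ bump half x ≟ˢ y ⌋

  round : List (Layer State)
  round = choose ∷ rest W ++ add before ∷ rest W ++ (Data.List.map inner I.program ++ (rest W ++ add after ∷ rest W ++ []))

  n : ℕ
  n = length I.program

  -- The layer where the inner program begins in a round starting at layer o: two instructions and
  -- two rests come before it.
  entrance : ℕ → ℕ
  entrance o = suc (suc o + W) + W

  length-round : ∀ o → o + length round ≡ suc (entrance o + n + W) + W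
  length-round o = begin
    o + length round ≡⟨ past-layer choose W ms₀ ⟩
    o₁ + length ms₀ ≡⟨ past-layer (add before) W ms₁ ⟩
    o₂ + length ms₁ ≡⟨ cong (_+_ o₂) (trans (length-++ (Data.List.map inner I.program)) (cong (_+ length ms₂) (length-map inner I.program))) ⟩
    o₂ + (n + length ms₂) ≡⟨ sym (+-assoc o₂ n _) ⟩
    o₂ + n + length ms₂ ≡⟨ past-rest W ms₃ ⟩
    o₂ + n + W + length ms₃ ≡⟨ past-layer (add after) W [] ⟩
    suc (o₂ + n + W) + W + 0 ≡⟨ +-identityʳ _ ⟩
    suc (o₂ + n + W) + W ∎
    where
    open ≡-Reasoning
    ms₃ = add after ∷ rest W ++ []
    ms₂ = rest W ++ ms₃
    ms₁ = Data.List.map inner I.program ++ ms₂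
    ms₀ = add before ∷ rest W ++ ms₁
    o₁ = suc o + W
    o₂ = suc o₁ + W

  ends : I.Line → Vec ℕ (I.width + I.width)
  ends ℓ = I.source ℓ Vec.++ I.target ℓ

  nest : Gadget
  nest = record
    { State   = State
    ; _≟ˢ_    = _≟ˢ_
    ; width   = suc (I.width + I.width)
    ; read    = proj₁
    ; program = rest W ++ repeat R round
    ; budget  = W
    ; Line    = Outer × I.Line
    ; source  = proj₁
    ; target  = λ (z , ℓ) → z ⊕ R · lifted (ends ℓ)
    }

-- Traces cut into rounds inside the rests.

module Robustness {V : Set} (τ : V → ℕ) (Fwd : V → V → Set) (tick : ∀ {u v} → Fwd u v → τ v ≡ suc (τ u)) where
  open Traces τ Fwd tick

  Still : {X : Set} → (V → X) → ℕ → ℕ → Set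
  Still f a b = ∀ {x y} → Fwd x y → a ≤ τ x → τ x < b → f x ≡ f y

  Still-⊆ : ∀ {X : Set} {f : V → X} {a b a′ b′} → a ≤ a′ → b′ ≤ b → Still f a b → Still f a′ b′
  Still-⊆ a≤ ≤b st e l r = st e (≤-trans a≤ l) (≤-trans r ≤b)

  Still-join : ∀ {X : Set} {f : V → X} {a b c} → Still f a b → Still f b c → Still f a c
  Still-join {b = b} st st′ {x} e l r with τ x <? b
  ... | yes x<b = st e l x<b
  ... | no  x≮b = st′ e (≮⇒≥ x≮b) r

  Still-map : ∀ {X Y : Set} {f : V → X} (g : X → Y) {a b} → Still f a b → Still (g ∘ f) a b
  Still-map g st e l r = cong g (st e l r)

  Obeys : {S : Set} → (V → S) → ℕ → List (Layer S) → Set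
  Obeys π o []       = ⊤
  Obeys π o (l ∷ ls) = (∀ {x y} → Fwd x y → τ x ≡ o → T (l (π x) (π y))) × Obeys π (suc o) ls

  Obeys-++ : ∀ {S : Set} {π : V → S} {o} ls {ms} → Obeys π o (ls ++ ms) → Obeys π o ls × Obeys π (o + length ls) ms
  Obeys-++ {π = π} {o} [] {ms} ob = tt , subst (λ o → Obeys π o ms) (sym (+-identityʳ o)) ob
  Obeys-++ {π = π} {o} (l ∷ ls) {ms} (at , ob) =
    let ob₁ , ob₂ = Obeys-++ ls ob in (at , ob₁) , subst (λ o → Obeys π o ms) (sym (+-suc o (length ls))) ob₂

  -- What a cut leaves behind: the remaining trace begins within the `W` layers before `o`, never
  -- returns below its first layer, and every edge from there up to `o` preserves the state.
  record Entry {S : Set} (π : V → S) (W o : ℕ) {u w} (p : Trace u w) : Set where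
    field
      still : Still π (τ u) o
      ahead : All (λ x → τ u ≤ τ x) p
      early : τ u ≤ o
      late  : o ≤ τ u + W

  record Crossing {S : Set} (π : V → S) (W o : ℕ) {u w} (p : Trace u w) : Set where
    field
      {mid} : V
      p₁    : Trace u mid
      p₂    : Trace mid w
      eq    : p ≡ p₁ ⧺ p₂
      below : All (λ x → τ x ≤ τ mid) p₁
      entry : Entry π W o p₂
    open Entry entry public using () renaming (early to mid≤; late to ≤mid)

    bad₂ : bad p₂ ≤ bad p
    bad₂ = ≤-trans (m≤n+m _ (bad p₁)) (≤-reflexive (sym (trans (cong bad eq) (bad-⧺ p₁ p₂))))

    bad≡ : bad p ≡ bad p₁ + bad p₂
    bad≡ = trans (cong bad eq) (bad-⧺ p₁ p₂)

    All₁ : ∀ {P} → All P p → All P p₁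
    All₁ {P} a = All-⧺ˡ p₁ p₂ (subst (All P) eq a)

    All₂ : ∀ {P} → All P p → All P p₂
    All₂ {P} a = All-⧺ʳ p₁ p₂ (subst (All P) eq a)

    Run₁ : ∀ {x y} → Run p₁ x y → Run p x y
    Run₁ {x} {y} r = subst (λ p → Run p x y) (sym eq) (Run-⧺ˡ p₂ r)

    Run₂ : ∀ {x y} → Run p₂ x y → Run p x y
    Run₂ {x} {y} r = subst (λ p → Run p x y) (sym eq) (Run-⧺ʳ p₁ r)

  private
    ⧺-assoc : ∀ {a b c d} (p : Trace a b) (q : Trace b c) (r : Trace c d) → (p ⧺ q) ⧺ r ≡ p ⧺ (q ⧺ r)
    ⧺-assoc ε q r       = refl
    ⧺-assoc (s ⨾ p) q r = cong (s ⨾_) (⧺-assoc p q r)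

  module _ {S : Set} {π : V → S} {W : ℕ} where

    stay : ∀ {o u w} {p : Trace u w} → Entry π W o p → Crossing π W o p
    stay {p = p} en = record { p₁ = ε ; p₂ = p ; eq = refl ; below = ≤-refl ; entry = en }

    infixr 5 _then_

    _then_ : ∀ {o o′ u w} {p : Trace u w} (c : Crossing π W o p) → Crossing π W o′ (Crossing.p₂ c) → Crossing π W o′ p
    c then d = record
      { p₁ = C.p₁ ⧺ D.p₁ ; p₂ = D.p₂
      ; eq = trans C.eq (trans (cong (C.p₁ ⧺_) D.eq) (sym (⧺-assoc C.p₁ D.p₁ D.p₂)))
      ; below = All-⧺ C.p₁ D.p₁ (All-map (λ le → ≤-trans le mid≤mid) C.p₁ C.below) D.below
      ; entry = D.entry }
      where
      module C = Crossing c
      module D = Crossing d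
      mid≤mid : τ C.mid ≤ τ D.mid
      mid≤mid = All-last D.p₁ (D.All₁ (Entry.ahead C.entry))

    abstract
      cross : ∀ {a u w} (p : Trace u w) → All (λ x → τ u ≤ τ x) p → τ u ≤ a → Still π a (a + W) → bad p < W → a + W ≤ τ w →
              Crossing π W (a + W) p
      cross {a} p ahead u≤a st bad< a≤w = record
        { p₁ = C.p₁ ; p₂ = C.p₂ ; eq = C.eq ; below = C.below
        ; entry = record { still = Still-⊆ C.lower ≤-refl st ; ahead = C.above ; early = C.upper ; late = +-monoˡ-≤ W C.lower } }
        where module C = Cut (cut W a p u≤a a≤w bad<)

      step-over : ∀ {o u w} {p : Trace u w} → Entry π W o p → Still π (suc o) (suc o + W) → bad p < W → suc o + W ≤ τ w →
                  Crossing π W (suc o + W) p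
      step-over {p = p} en st bad< le = cross p (Entry.ahead en) (≤-trans (Entry.early en) (n≤1+n _)) st bad< le

    crossing-keeps : ∀ {X : Set} {f : V → X} {o u w} {p : Trace u w} → All (λ x → τ u ≤ τ x) p → (c : Crossing π W o p) →
                     Still f (τ u) o → All (λ x → f x ≡ f u) (Crossing.p₁ c)
    crossing-keeps {f = f} {o} {u} ahead c st = invariant f (τ u) o st C.p₁
      (All-zip C.p₁ (C.All₁ ahead) (All-map (λ le → ≤-trans le C.mid≤) C.p₁ C.below))
      where module C = Crossing c

    -- `g` up to layer `o` and `h` above it are glued into one function that all edges of the zone
    -- preserve. Crossing the instruction at `o` several times is therefore harmless; harm could
    -- come only from a return to an earlier instruction, which the preceding cut excludes.
    crossing-turns : ∀ {X : Set} {g h : V → X} {o u w} {p : Trace u w} → Entry π W o p → (c : Crossing π W (suc o + W) p) →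
                     Still g (τ u) o → (∀ {x y} → Fwd x y → τ x ≡ o → g x ≡ h y) → Still h (suc o) (suc o + W) →
                     h (Crossing.mid c) ≡ g u
    crossing-turns {X} {g} {h} {o} {u} en c st at st′ =
      trans (sym f-after) (trans (All-last C.p₁ (crossing-keeps (Entry.ahead en) c f-still)) f-before)
      where
      module C = Crossing c
      f : V → X
      f x = if ⌊ τ x ≤? o ⌋ then g x else h x
      f≤ : ∀ {x} → τ x ≤ o → f x ≡ g x
      f≤ {x} le with τ x ≤? o
      ... | yes _  = refl
      ... | no  ≰o = ⊥-elim (≰o le)
      f> : ∀ {x} → o < τ x → f x ≡ h x
      f> {x} lt with τ x ≤? o
      ... | yes ≤o = ⊥-elim (<-irrefl refl (<-≤-trans lt ≤o))
      ... | no  _  = refl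
      f-before : f u ≡ g u
      f-before = f≤ (Entry.early en)
      f-after : f C.mid ≡ h C.mid
      f-after = f> (+-cancelʳ-≤ W (suc o) (τ C.mid) C.≤mid)
      f-still : Still f (τ u) (suc o + W)
      f-still {x} {y} e l r with <-cmp (τ x) o
      ... | tri< x<o _ _ = trans (f≤ (<⇒≤ x<o)) (trans (st e l x<o) (sym (f≤ (≤-trans (≤-reflexive (tick e)) x<o))))
      ... | tri≈ _ eq _  = trans (f≤ (≤-reflexive eq)) (trans (at e eq) (sym (f> (≤-reflexive (trans (cong suc (sym eq)) (sym (tick e)))))))
      ... | tri> _ _ o<x = trans (f> o<x) (trans (st′ e o<x r) (sym (f> (<-trans o<x (≤-reflexive (sym (tick e)))))))

  module _ {S : Set} (_≟ˢ_ : (x y : S) → Dec (x ≡ y)) {π : V → S} where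
    open Idling _≟ˢ_

    Obeys-rest : ∀ W {o ms} → Obeys π o (rest W ++ ms) → Still π o (o + W) × Obeys π (o + W) ms
    Obeys-rest zero {o} {ms} ob =
      (λ {x} e l r → ⊥-elim (<-irrefl refl (<-≤-trans (subst (τ x <_) (+-identityʳ o) r) l))) ,
      subst (λ o → Obeys π o ms) (sym (+-identityʳ o)) ob
    Obeys-rest (suc W) {o} {ms} (at , ob) =
      let st , ob′ = Obeys-rest W ob
      in (λ {x} {y} e l r → [ (λ o<x → st e o<x (subst (τ x <_) (+-suc o W) r))
                            , (λ o≡x → toWitness {a? = π x ≟ˢ π y} (at e (sym o≡x))) ]′ (m≤n⇒m<n∨m≡n l)) ,
         subst (λ o → Obeys π o ms) (sym (+-suc o W)) ob′

  -- Common to both kinds of machine. `Info` retains what a round yields beyond the vector it adds;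
  -- the nested machine keeps its passage through the inner program there.
  module Rounds {S : Set} (_≟ˢ_ : (x y : S) → Dec (x ≡ y)) (π : V → S) (W : ℕ) {m : ℕ} (z : S → Vec ℕ (suc m))
    (rd : List (Layer S)) (Info : ∀ {u v} → ℕ → Vec ℕ m → Trace u v → Set)
    (round : ∀ {o u w} (p : Trace u w) → Obeys π o rd → Entry π W o p → bad p < W → o + length rd ≤ τ w →
       Σ (Crossing π W (o + length rd) p) λ c → ∃[ P ] z (π (Crossing.mid c)) ≡ z (π u) ⊕ lifted P × Info o P (Crossing.p₁ c))
    where
    open Idling _≟ˢ_

    data Chain : (r o : ℕ) → ∀ {u w} → Trace u w → Set where
      done : ∀ {o u w} {p : Trace u w} → z (π w) ≡ z (π u) → Chain 0 o p
      more : ∀ {r o u w} {p : Trace u w} → Entry π W o p → (c : Crossing π W (o + length rd) p) (P : Vec ℕ m) →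
             z (π (Crossing.mid c)) ≡ z (π u) ⊕ lifted P → Info o P (Crossing.p₁ c) →
             Chain r (o + length rd) (Crossing.p₂ c) → Chain (suc r) o p

    chain : ∀ r {o hi u w} (p : Trace u w) → Obeys π o (repeat r rd) → Entry π W o p → bad p < W →
            o + length (repeat r rd) ≤ τ w → All (λ x → τ x ≤ hi) p → Still π (o + length (repeat r rd)) hi → Chain r o p
    chain zero {o} {hi} {u} p _ en _ _ ≤hi st =
      done (cong z (All-last p (invariant π (τ u) hi (Still-join (Entry.still en) (subst (λ o → Still π o hi) (+-identityʳ o) st))
        p (All-zip p (Entry.ahead en) ≤hi))))
    chain (suc r) {o} {hi} {u} {w} p ob en bad< le ≤hi st =
      let ob₁ , ob₂ = Obeys-++ rd ob
          past      = trans (cong (_+_ o) (length-++ rd {repeat r rd})) (sym (+-assoc o (length rd) (length (repeat r rd))))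
          le′       = subst (_≤ τ w) past le
          c , P , z≡ , info = round p ob₁ en bad< (≤-trans (m≤m+n _ _) le′)
          module C  = Crossing c
      in more en c P z≡ info (chain r C.p₂ ob₂ C.entry (≤-<-trans C.bad₂ bad<) le′ (C.All₂ ≤hi) (subst (λ o → Still π o hi) past st))

    values : ∀ {r o u w} {p : Trace u w} → Chain r o p → Vec (Vec ℕ m) r
    values (done _)           = []
    values (more _ _ P _ _ ch) = P ∷ values ch

    total : ∀ {r o u w} {p : Trace u w} (ch : Chain r o p) → z (π w) ≡ z (π u) ⊕ (Σ∥ values ch ∥² ∷ Σᵛ (values ch))
    total {u = u} (done eq)            = trans eq (sym (⊕-identityʳ (z (π u))))
    total {u = u} (more _ c P eq _ ch) = trans (total ch) (trans (cong (_⊕ (Σ∥ values ch ∥² ∷ Σᵛ (values ch))) eq) (⊕-assoc (z (π u)) (lifted P) _))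

    record Pick (o X : ℕ) (P : Vec ℕ m) {u w} (p : Trace u w) : Set where
      field
        r       : ℕ
        {u′ v′} : V
        q       : Trace u′ v′
        start   : z (π u′) ≡ z (π u) ⊕ r · lifted P
        end     : z (π v′) ≡ z (π u′) ⊕ lifted P
        info    : Info (o + r * length rd) P q
        bad<    : bad q < X
        embed   : ∀ {x y} → Run q x y → Run p x y
        u′≤     : τ u′ ≤ o + r * length rd
        ≤u′     : o + r * length rd ≤ τ u′ + W
        v′≤     : τ v′ ≤ o + suc r * length rd
        ≤v′     : o + suc r * length rd ≤ τ v′ + W

    -- Pigeonhole on the bad steps, which are shared among r rounds. All rounds add the same `P`, so
    -- whichever round is found will do.
    pick : ∀ {r o X P u w} {p : Trace u w} (ch : Chain r o p) → AllEqual P (values ch) → bad p < r * X → Pick o X P p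
    pick {suc r} {o} {X} {P} {u} {p = p} (more en c _ eq info ch) (refl ∷ all) bad< with bad (Crossing.p₁ c) <? X
    ... | yes small = record
      { r = 0 ; q = C.p₁ ; start = sym (trans (cong (z (π u) ⊕_) (zero-· (lifted P))) (⊕-identityʳ _)) ; end = eq
      ; info = subst (λ o → Info o P C.p₁) (sym (+-identityʳ o)) info ; bad< = small ; embed = C.Run₁
      ; u′≤ = ≤-trans (Entry.early en) (m≤m+n o 0) ; ≤u′ = ≤-trans (≤-reflexive (+-identityʳ o)) (Entry.late en)
      ; v′≤ = ≤-trans C.mid≤ (≤-reflexive next) ; ≤v′ = ≤-trans (≤-reflexive (sym next)) C.≤mid }
      where
      module C = Crossing c
      next : o + length rd ≡ o + 1 * length rd
      next = cong (_+_ o) (sym (+-identityʳ (length rd)))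
    ... | no large = record
      { r = suc Q.r ; q = Q.q
      ; start = trans Q.start (trans (cong (_⊕ Q.r · lifted P) eq) (trans (⊕-assoc (z (π u)) (lifted P) _) (cong (z (π u) ⊕_) (sym (suc-· Q.r (lifted P))))))
      ; end = Q.end ; info = subst (λ o → Info o P Q.q) (later Q.r) Q.info ; bad< = Q.bad< ; embed = C.Run₂ ∘ Q.embed
      ; u′≤ = subst (τ Q.u′ ≤_) (later Q.r) Q.u′≤ ; ≤u′ = subst (_≤ τ Q.u′ + W) (later Q.r) Q.≤u′
      ; v′≤ = subst (τ Q.v′ ≤_) (later (suc Q.r)) Q.v′≤ ; ≤v′ = subst (_≤ τ Q.v′ + W) (later (suc Q.r)) Q.≤v′ }
      where
      module C = Crossing c
      later : ∀ r → o + length rd + r * length rd ≡ o + suc r * length rd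
      later r = +-assoc o (length rd) (r * length rd)
      module Q = Pick (pick {r} {X = X} ch all (+-cancelˡ-< X _ _ (≤-<-trans (≤-trans (+-monoˡ-≤ (bad C.p₂) (≮⇒≥ large)) (≤-reflexive (sym C.bad≡))) bad<)))

    -- The readings at the two ends fix both the sum and the sum of squared norms of the vectors
    -- added, with the values they have for R copies of `P`. Equality in Jensen's inequality then
    -- makes all rounds alike before one of them is selected.
    robust-rounds : ∀ R X {o lo hi u w} (p : Trace u w) a P → Obeys π o (rest W ++ repeat R rd) → Still π lo o →
      Still π (o + length (rest W ++ repeat R rd)) hi → All (λ x → lo ≤ τ x × τ x ≤ hi) p →
      τ u ≤ o → o + length (rest W ++ repeat R rd) ≤ τ w → bad p < W → bad p < R * X →
      z (π u) ≡ a → z (π w) ≡ a ⊕ R · lifted P → Pick (o + W) X P p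
    robust-rounds R X {o} {lo} {hi} {u} {w} p a P ob st₁ st₂ within u≤o o≤w bad<W bad< refl z≡ = result
      where
      past : o + length (rest W ++ repeat R rd) ≡ o + W + length (repeat R rd)
      past = past-rest W (repeat R rd)
      rests : Still π o (o + W) × Obeys π (o + W) (repeat R rd)
      rests = Obeys-rest _≟ˢ_ W ob
      o≤w′ : o + W + length (repeat R rd) ≤ τ w
      o≤w′ = subst (_≤ τ w) past o≤w
      K : Cut p o (o + W)
      K = cut W o p u≤o (≤-trans (m≤m+n _ _) o≤w′) bad<W
      module K = Cut K
      c : Crossing π W (o + W) p
      c = record { p₁ = K.p₁ ; p₂ = K.p₂ ; eq = K.eq ; below = K.below ; entry = record
        { still = Still-⊆ K.lower ≤-refl (proj₁ rests) ; ahead = K.above ; early = K.upper ; late = +-monoˡ-≤ W K.lower } }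
      module C = Crossing c
      z-mid : z (π C.mid) ≡ z (π u)
      z-mid = cong z (All-last C.p₁ (invariant π lo (o + W) (Still-join st₁ (proj₁ rests)) C.p₁
        (All-zip C.p₁ (All-map proj₁ C.p₁ (C.All₁ within)) (All-map (λ le → ≤-trans le C.mid≤) C.p₁ C.below))))
      ch : Chain R (o + W) C.p₂
      ch = chain R C.p₂ (proj₂ rests) C.entry (≤-<-trans C.bad₂ bad<W) o≤w′ (All-map proj₂ C.p₂ (C.All₂ within))
             (subst (λ o → Still π o hi) past st₂)
      sums : Σ∥ values ch ∥² ∷ Σᵛ (values ch) ≡ R · lifted P
      sums = ⊕-cancelˡ (z (π u)) _ _ (trans (cong (_⊕ (Σ∥ values ch ∥² ∷ Σᵛ (values ch))) (sym z-mid)) (trans (sym (total ch)) z≡))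
      module Q = Pick (pick {X = X} ch (equality-in-Jensen (values ch) P (Vec.∷-injectiveʳ sums) (Vec.∷-injectiveˡ sums)) (≤-<-trans C.bad₂ bad<))
      result : Pick (o + W) X P p
      result = record { Q ; start = trans Q.start (cong (_⊕ Q.r · lifted P) z-mid) ; embed = C.Run₂ ∘ Q.embed }

  -- The trace may begin before the program and end behind it, between `lo` and `hi`, where the
  -- state stands still. This is the situation of an inner program enclosed by two rests of the
  -- outer one.
  Robust : (G : Gadget) → ((V → Gadget.State G) → ℕ → Gadget.Line G → V → V → Set) → Set
  Robust G Cert = ∀ (π : V → State) {o lo hi} → Obeys π o program → Still π lo o → Still π (o + length program) hi →
    ∀ {u w} (p : Trace u w) → All (λ x → lo ≤ τ x × τ x ≤ hi) p → τ u ≤ o → o + length program ≤ τ w →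
    bad p < budget → ∀ ℓ → read (π u) ≡ source ℓ → read (π w) ≡ target ℓ → ∃[ x ] ∃[ y ] Run p x y × Cert π o ℓ x y
    where open Gadget G

  -- `Cert` says what the two ends of a run reveal about the line. `Cert-injective` allows lines to
  -- be counted by pairs of vertices, and `Cert-ascending` excludes runs without a step, which would
  -- point to no shortcut.
  record Guarantee (G : Gadget) : Set₁ where
    open Gadget G
    field
      Cert           : (V → State) → ℕ → Line → V → V → Set
      Cert-injective : ∀ {π o ℓ ℓ′ x y} → Cert π o ℓ x y → Cert π o ℓ′ x y → ℓ ≡ ℓ′
      Cert-ascending : ∀ {π o ℓ x y} → Cert π o ℓ x y → τ x < τ y
      robust         : Robust G Cert

-- Robustness of the two kinds of machine.

T-× : ∀ {a b} → T (a ∧ b) → T a × T b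
T-× {true} t = tt , t

module Guarantees {V : Set} (τ : V → ℕ) (Fwd : V → V → Set) (tick : ∀ {u v} → Fwd u v → τ v ≡ suc (τ u)) where
  open Traces τ Fwd tick
  open Robustness τ Fwd tick

  -- A round is longer than the tolerance `W`, so a layer at most `W` before a round boundary
  -- identifies that boundary.
  zone-unique : ∀ {o len W t r r′} → W < len → o + r * len ≤ t + W → t ≤ o + r′ * len → r ≤ r′
  zone-unique {o} {len} {W} {t} {r} {r′} W<len lo hi = ≮⇒≥ λ r′<r → <-irrefl refl (begin-strict
    o + r * len ≤⟨ lo ⟩
    t + W <⟨ +-mono-≤-< hi W<len ⟩
    o + r′ * len + len ≡⟨ next-multiple o len r′ ⟩
    o + suc r′ * len ≤⟨ +-monoʳ-≤ o (*-monoˡ-≤ len r′<r) ⟩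
    o + r * len ∎)
    where
    open ≤-Reasoning

  module BaseGuarantee (D R : ℕ) .{{_ : NonZero D}} where
    open Base D R
    open Idling _≟ˢ_

    pass-round : ∀ {π : V → State} m ι → (∀ a b → ι (a ⊕ b) ≡ ι a ⊕ ι b) → ι 0ᵛ ≡ 0ᵛ →
      ∀ {o u w} (p : Trace u w) → Obeys π o (pass m ι) → Entry π R o p → bad p < R → o + length (pass m ι) ≤ τ w →
      Σ (Crossing π R (o + length (pass m ι)) p) λ c → ∃[ a ] proj₂ (π (Crossing.mid c)) ≡ proj₂ (π u) ⊕ (∥ a ∥² ∷ ι a)
    pass-round {π} zero ι ι-⊕ ι-0 {o} {u} p ob en bad< le =
      subst (λ o → Σ (Crossing π R o p) λ c → ∃[ a ] proj₂ (π (Crossing.mid c)) ≡ proj₂ (π u) ⊕ (∥ a ∥² ∷ ι a)) (sym (+-identityʳ o))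
        (stay en , [] , sym (trans (cong (λ a → proj₂ (π u) ⊕ (0 ∷ a)) ι-0) (⊕-identityʳ (proj₂ (π u)))))
    pass-round {π} (suc m) ι ι-⊕ ι-0 {o} {u} {w} p (at₀ , ob₀) en bad< le =
      subst (λ o → Σ (Crossing π R o p) λ c → ∃[ a ] proj₂ (π (Crossing.mid c)) ≡ proj₂ (π u) ⊕ (∥ a ∥² ∷ ι a)) (sym past)
        ((c₀ then (c₁ then c₂)) , (c ∷ a) , z≡)
      where
      ms₁ = pass m (λ a → ι (0 ∷ a))
      slot : ℕ → Vec ℕ D
      slot c = ι (c ∷ 0ᵛ)
      ms₀ = add slot ∷ rest R ++ ms₁
      rest₀ = Obeys-rest _≟ˢ_ R ob₀
      o₁ = suc o + R
      at₁ = proj₁ (proj₂ rest₀)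
      rest₁ = Obeys-rest _≟ˢ_ R (proj₂ (proj₂ rest₀))
      o₂ = suc o₁ + R
      past₀ : o + length (pass (suc m) ι) ≡ o₁ + length ms₀
      past₀ = past-layer choose R ms₀
      past₁ : o₁ + length ms₀ ≡ o₂ + length ms₁
      past₁ = past-layer (add slot) R ms₁
      past : o + length (pass (suc m) ι) ≡ o₂ + length ms₁
      past = trans past₀ past₁
      le₂ : o₂ + length ms₁ ≤ τ w
      le₂ = subst (_≤ τ w) past le
      le₁ : o₂ ≤ τ w
      le₁ = ≤-trans (m≤m+n o₂ _) le₂
      c₀ : Crossing π R o₁ p
      c₀ = step-over en (proj₁ rest₀) bad< (≤-trans (≤-trans (n≤1+n o₁) (m≤m+n (suc o₁) R)) le₁)
      module C₀ = Crossing c₀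
      z₀ : proj₂ (π C₀.mid) ≡ proj₂ (π u)
      z₀ = crossing-turns {g = proj₂ ∘ π} {h = proj₂ ∘ π} en c₀ (Still-map proj₂ (Entry.still en))
             (λ {x} {y} e t → toWitness {a? = Vec.≡-dec _≟_ (proj₂ (π x)) (proj₂ (π y))} (at₀ e t)) (Still-map proj₂ (proj₁ rest₀))
      c₁ : Crossing π R o₂ C₀.p₂
      c₁ = step-over C₀.entry (proj₁ rest₁) (≤-<-trans C₀.bad₂ bad<) le₁
      module C₁ = Crossing c₁
      z₁ : π C₁.mid ≡ bump slot (π C₀.mid)
      z₁ = crossing-turns {g = bump slot ∘ π} {h = π} C₀.entry c₁ (Still-map (bump slot) (Entry.still C₀.entry))
             (λ {x} {y} e t → toWitness {a? = bump slot (π x) ≟ˢ π y} (at₁ e t)) (proj₁ rest₁)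
      later = pass-round m (λ a → ι (0 ∷ a)) (λ a b → ι-⊕ (0 ∷ a) (0 ∷ b)) ι-0 C₁.p₂ (proj₂ rest₁) C₁.entry
                (≤-<-trans C₁.bad₂ (≤-<-trans C₀.bad₂ bad<)) le₂
      c₂ = proj₁ later
      a = proj₁ (proj₂ later)
      -- The walk may pass through `choose` repeatedly before the cut; the coordinate added is the
      -- register content at the cut, after which it can no longer be changed before the addition.
      c = proj₁ (π C₀.mid)
      z≡ : proj₂ (π (Crossing.mid c₂)) ≡ proj₂ (π u) ⊕ (∥ c ∷ a ∥² ∷ ι (c ∷ a))
      z≡ = trans (proj₂ (proj₂ later)) (trans (cong (_⊕ (∥ a ∥² ∷ ι (0 ∷ a)))
             (trans (cong proj₂ z₁) (cong (_⊕ (c * c ∷ slot c)) z₀)))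
             (trans (⊕-assoc (proj₂ (π u)) _ _) (cong (λ b → proj₂ (π u) ⊕ (c * c + ∥ a ∥² ∷ b))
               (trans (sym (ι-⊕ (c ∷ 0ᵛ) (0 ∷ a))) (cong₂ (λ x y → ι (x ∷ y)) (+-identityʳ c) (⊕-identityˡ a))))))

    rd : List (Layer State)
    rd = pass D id

    rest<round : R < length rd
    rest<round = long D
      where
      long : ∀ D′ .{{_ : NonZero D′}} {ι} → R < length (pass D′ ι)
      long (suc m) {ι} = s≤s (≤-trans (m≤m+n R _) (≤-reflexive (sym (length-rest R (add (λ c → ι (c ∷ 0ᵛ)) ∷ rest R ++ pass m (λ a → ι (0 ∷ a)))))))

    -- The layer of x gives r, the difference of the two readings gives the vector added, and
    -- subtracting r lifted copies of it from the reading at x gives the starting vector.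
    record BaseCert (π : V → State) (o : ℕ) (ℓ : Vec ℕ (suc D) × Vec ℕ D) (x y : V) : Set where
      field
        r     : ℕ
        x≤    : τ x ≤ o + R + r * length rd
        ≤x    : o + R + r * length rd ≤ τ x + R
        ≤y    : o + R + suc r * length rd ≤ τ y + R
        start : proj₂ (π x) ≡ proj₁ ℓ ⊕ r · lifted (proj₂ ℓ)
        end   : proj₂ (π y) ≡ proj₂ (π x) ⊕ lifted (proj₂ ℓ)

    BaseCert-injective : ∀ {π o ℓ ℓ′ x y} → BaseCert π o ℓ x y → BaseCert π o ℓ′ x y → ℓ ≡ ℓ′
    BaseCert-injective {π} {o} {ℓ} {ℓ′} {x} {y} c d = cong₂ _,_ z≡ a≡
      where
      module C = BaseCert c
      module D = BaseCert d
      a≡ : proj₂ ℓ ≡ proj₂ ℓ′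
      a≡ = lifted-injective (⊕-cancelˡ (proj₂ (π x)) _ _ (trans (sym C.end) D.end))
      r≡ : C.r ≡ D.r
      r≡ = ≤-antisym (zone-unique {o + R} rest<round C.≤x D.x≤) (zone-unique {o + R} rest<round D.≤x C.x≤)
      z≡ : proj₁ ℓ ≡ proj₁ ℓ′
      z≡ = ⊕-cancelʳ (C.r · lifted (proj₂ ℓ)) _ _
             (trans (sym C.start) (trans D.start (cong₂ (λ r a → proj₁ ℓ′ ⊕ r · lifted a) (sym r≡) (sym a≡))))

    base-guarantee : Guarantee base
    base-guarantee = record
      { Cert           = BaseCert
      ; Cert-injective = BaseCert-injective
      ; Cert-ascending = λ {_} {o} {_} {x} {y} c → let module C = BaseCert c in
          +-cancelʳ-< R (τ x) (τ y) (<-≤-trans (+-mono-≤-< C.x≤ rest<round)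
            (≤-trans (≤-reflexive (next-multiple (o + R) (length rd) C.r)) C.≤y))
      ; robust         = robust
      }
      where
      module _ (π : V → State) where
        base-round : ∀ {o u w} (p : Trace u w) → Obeys π o rd → Entry π R o p → bad p < R → o + length rd ≤ τ w →
                     Σ (Crossing π R (o + length rd) p) λ c → ∃[ a ] proj₂ (π (Crossing.mid c)) ≡ proj₂ (π u) ⊕ lifted a × ⊤
        base-round p ob en bad< le = let c , a , eq = pass-round D id (λ _ _ → refl) refl p ob en bad< le in c , a , eq , tt
        module RR = Rounds _≟ˢ_ π R proj₂ rd (λ _ _ _ → ⊤) base-round
      robust : Robust base BaseCert
      robust π {o} ob st₁ st₂ p within u≤ ≤w bad< (z , a) z₁ z₂ =
          Q.u′ , Q.v′ , Q.embed (here (clean⇒Prefix Q.q (n<1⇒n≡0 Q.bad<))) ,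
          record { r = Q.r ; x≤ = Q.u′≤ ; ≤x = Q.≤u′ ; ≤y = Q.≤v′ ; start = trans Q.start (cong (_⊕ Q.r · lifted a) z₁) ; end = Q.end }
          -- With X = 1 the round found contains no bad step whatsoever and is the desired run as a
          -- whole.
          where module Q = RR.Pick π (RR.robust-rounds π R 1 p z a ob st₁ st₂ within u≤ ≤w bad< (subst (bad p <_) (sym (*-identityʳ R)) bad<) z₁ z₂)

  module NestGuarantee (R : ℕ) (I : Gadget) (guarantee : Guarantee I) where
    open Nest R I
    open Idling _≟ˢ_
    private
      module I = Gadget I
      module IG = Guarantee guarantee

    Obeys-inner : ∀ {π : V → State} ls {o} → Obeys π o (Data.List.map inner ls) →
                  Obeys (proj₂ ∘ π) o ls × Still (proj₁ ∘ π) o (o + length ls)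
    Obeys-inner [] {o} _ = tt , λ {x} e l r → ⊥-elim (<-irrefl refl (<-≤-trans (subst (τ x <_) (+-identityʳ o) r) l))
    Obeys-inner {π} (l ∷ ls) {o} (at , ob) =
      let ob′ , st = Obeys-inner ls ob
      in ((λ e t → proj₂ (T-× (at e t))) , ob′) ,
         λ {x} {y} e lo hi → [ (λ o<x → st e o<x (subst (τ x <_) (+-suc o (length ls)) hi))
                             , (λ o≡x → toWitness {a? = Vec.≡-dec _≟_ (proj₁ (π x)) (proj₁ (π y))} (proj₁ (T-× (at e (sym o≡x))))) ]′
                             (m≤n⇒m<n∨m≡n lo)

    -- The stretch of a round between the cuts before and behind the inner program, together with
    -- all that inner robustness demands. Along it the outer registers are constant and already
    -- contain the `before` half.
    record Passage (π : V → State) {u v} (o : ℕ) (P : Vec ℕ (I.width + I.width)) (q : Trace u v) : Set where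
      field
        p p′    : Vec ℕ I.width
        P≡      : P ≡ p Vec.++ p′
        {v₁ v₂} : V
        t       : Trace v₁ v₂
        embed   : ∀ {x y} → Run t x y → Run q x y
        bad≤    : bad t ≤ bad q
        read₁   : I.read (proj₂ (π v₁)) ≡ p
        read₂   : I.read (proj₂ (π v₂)) ≡ p′
        outer   : All (λ x → proj₁ (π x) ≡ proj₁ (π u) ⊕ before p) t
        within  : All (λ x → τ v₁ ≤ τ x × τ x ≤ τ v₂) t
        ≤v₁     : o ≤ τ v₁
        v₁≤     : τ v₁ ≤ entrance o
        ≤v₂     : entrance o + n ≤ τ v₂
        v₂≤     : τ v₂ ≤ entrance o + n + W
        still₁  : Still (proj₂ ∘ π) (τ v₁) (entrance o)
        still₂  : Still (proj₂ ∘ π) (entrance o + n) (τ v₂)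
        obeys   : Obeys (proj₂ ∘ π) (entrance o) I.program

    nest-round : ∀ {π : V → State} {o u w} (p : Trace u w) → Obeys π o round → Entry π W o p → bad p < W → o + length round ≤ τ w →
      Σ (Crossing π W (o + length round) p) λ c → ∃[ P ] proj₁ (π (Crossing.mid c)) ≡ proj₁ (π u) ⊕ lifted P × Passage π o P (Crossing.p₁ c)
    nest-round {π} {o} {u} {w} p (at₀ , ob₀) en bad< le =
      subst (λ o′ → Σ (Crossing π W o′ p) λ c → ∃[ P ] proj₁ (π (Crossing.mid c)) ≡ proj₁ (π u) ⊕ lifted P × Passage π o P (Crossing.p₁ c))
        (sym (length-round o)) ((c₀ then (c₁ then (c₂ then c₃))) , (I.read (proj₂ (π C₁.mid)) Vec.++ I.read (proj₂ (π C₂.mid))) , z≡ , passage)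
      where
      ms₃ = add after ∷ rest W ++ []
      o₁ = suc o + W
      o₂ = suc o₁ + W
      o₃ = o₂ + n + W
      o₄ = suc o₃ + W
      rest₀ = Obeys-rest _≟ˢ_ {π} W ob₀
      at₁ = proj₁ (proj₂ rest₀)
      rest₁ = Obeys-rest _≟ˢ_ {π} W (proj₂ (proj₂ rest₀))
      split = Obeys-++ {π = π} (Data.List.map inner I.program) (proj₂ rest₁)
      in₂ = Obeys-inner I.program (proj₁ split)
      after₂ : Obeys π (o₂ + n) (rest W ++ ms₃)
      after₂ = subst (λ k → Obeys π (o₂ + k) (rest W ++ ms₃)) (length-map inner I.program) (proj₂ split)
      rest₂ = Obeys-rest _≟ˢ_ {π} W after₂
      at₃ = proj₁ (proj₂ rest₂)
      rest₃ = Obeys-rest _≟ˢ_ {π} W (proj₂ (proj₂ rest₂))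
      le₄ : o₄ ≤ τ w
      le₄ = subst (_≤ τ w) (length-round o) le
      le₃ : o₃ ≤ τ w
      le₃ = ≤-trans (≤-trans (n≤1+n o₃) (m≤m+n (suc o₃) W)) le₄
      le₂ : o₂ ≤ τ w
      le₂ = ≤-trans (≤-trans (m≤m+n o₂ n) (m≤m+n (o₂ + n) W)) le₃
      le₁ : o₁ ≤ τ w
      le₁ = ≤-trans (≤-trans (n≤1+n o₁) (m≤m+n (suc o₁) W)) le₂
      c₀ : Crossing π W o₁ p
      c₀ = step-over en (proj₁ rest₀) bad< le₁
      module C₀ = Crossing c₀
      c₁ : Crossing π W o₂ C₀.p₂
      c₁ = step-over C₀.entry (proj₁ rest₁) (≤-<-trans C₀.bad₂ bad<) le₂
      module C₁ = Crossing c₁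
      bad₁< : bad C₁.p₂ < W
      bad₁< = ≤-<-trans C₁.bad₂ (≤-<-trans C₀.bad₂ bad<)
      -- Here a whole program is crossed instead of one instruction. Whatever the walk does inside
      -- it, inner layers keep the outer registers, so a cut in the rest behind it suffices; the
      -- inner behaviour is left to the inner guarantee.
      c₂ : Crossing π W o₃ C₁.p₂
      c₂ = cross C₁.p₂ (Entry.ahead C₁.entry) (≤-trans C₁.mid≤ (m≤m+n o₂ n)) (proj₁ rest₂) bad₁< le₃
      module C₂ = Crossing c₂
      c₃ : Crossing π W o₄ C₂.p₂
      c₃ = step-over C₂.entry (proj₁ rest₃) (≤-<-trans C₂.bad₂ bad₁<) le₄
      module C₃ = Crossing c₃
      z₀ : proj₁ (π C₀.mid) ≡ proj₁ (π u)
      z₀ = crossing-turns {g = proj₁ ∘ π} {h = proj₁ ∘ π} en c₀ (Still-map proj₁ (Entry.still en))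
             (λ {x} {y} e t → toWitness {a? = Vec.≡-dec _≟_ (proj₁ (π x)) (proj₁ (π y))} (at₀ e t)) (Still-map proj₁ (proj₁ rest₀))
      z₁ : π C₁.mid ≡ bump before (π C₀.mid)
      z₁ = crossing-turns {g = bump before ∘ π} {h = π} C₀.entry c₁ (Still-map (bump before) (Entry.still C₀.entry))
             (λ {x} {y} e t → toWitness {a? = bump before (π x) ≟ˢ π y} (at₁ e t)) (proj₁ rest₁)
      z₁′ : proj₁ (π C₁.mid) ≡ proj₁ (π u) ⊕ before (I.read (proj₂ (π C₁.mid)))
      z₁′ = trans (cong proj₁ z₁) (cong₂ (λ z x → z ⊕ before (I.read x)) z₀ (sym (cong proj₂ z₁)))
      still-z : Still (proj₁ ∘ π) (τ C₁.mid) o₃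
      still-z = Still-join (Still-map proj₁ (Entry.still C₁.entry)) (Still-join (proj₂ in₂) (Still-map proj₁ (proj₁ rest₂)))
      z₂ : All (λ x → proj₁ (π x) ≡ proj₁ (π C₁.mid)) C₂.p₁
      z₂ = crossing-keeps (Entry.ahead C₁.entry) c₂ still-z
      z₃ : π C₃.mid ≡ bump after (π C₂.mid)
      z₃ = crossing-turns {g = bump after ∘ π} {h = π} C₂.entry c₃ (Still-map (bump after) (Entry.still C₂.entry))
             (λ {x} {y} e t → toWitness {a? = bump after (π x) ≟ˢ π y} (at₃ e t)) (proj₁ rest₃)
      z≡ : proj₁ (π C₃.mid) ≡ proj₁ (π u) ⊕ lifted (I.read (proj₂ (π C₁.mid)) Vec.++ I.read (proj₂ (π C₂.mid)))
      z≡ = trans (cong proj₁ z₃) (trans (cong (_⊕ after (I.read (proj₂ (π C₂.mid)))) (trans (All-last C₂.p₁ z₂) z₁′))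
             (lifted-++ (proj₁ (π u)) (I.read (proj₂ (π C₁.mid))) (I.read (proj₂ (π C₂.mid)))))
      passage : Passage π o (I.read (proj₂ (π C₁.mid)) Vec.++ I.read (proj₂ (π C₂.mid))) (C₀.p₁ ⧺ (C₁.p₁ ⧺ (C₂.p₁ ⧺ C₃.p₁)))
      passage = record
        { P≡ = refl ; t = C₂.p₁
        ; embed = λ r → Run-⧺ʳ C₀.p₁ (Run-⧺ʳ C₁.p₁ (Run-⧺ˡ C₃.p₁ r))
        ; bad≤ = ≤-trans (m≤m+n (bad C₂.p₁) (bad C₃.p₁)) (≤-trans (≤-reflexive (sym (bad-⧺ C₂.p₁ C₃.p₁)))
                   (≤-trans (m≤n+m _ (bad C₁.p₁)) (≤-trans (≤-reflexive (sym (bad-⧺ C₁.p₁ _)))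
                     (≤-trans (m≤n+m _ (bad C₀.p₁)) (≤-reflexive (sym (bad-⧺ C₀.p₁ _)))))))
        ; read₁ = refl ; read₂ = refl
        ; outer = All-map (λ eq → trans eq z₁′) C₂.p₁ z₂
        ; within = All-zip C₂.p₁ (C₂.All₁ (Entry.ahead C₁.entry)) C₂.below
        ; ≤v₁ = ≤-trans (≤-trans (n≤1+n o) (m≤m+n (suc o) W)) (≤-trans (n≤1+n o₁) (+-cancelʳ-≤ W (suc o₁) (τ C₁.mid) C₁.≤mid))
        ; v₁≤ = C₁.mid≤
        ; ≤v₂ = +-cancelʳ-≤ W (o₂ + n) (τ C₂.mid) C₂.≤mid
        ; v₂≤ = C₂.mid≤
        ; still₁ = Still-map proj₂ (Entry.still C₁.entry)
        ; still₂ = Still-map proj₂ (Still-⊆ ≤-refl C₂.mid≤ (proj₁ rest₂))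
        ; obeys = proj₁ in₂
        }

    -- The layer of x gives r, the inner certificate gives the inner line, and both together
    -- determine what has been added to the outer registers up to x, the `before` half of round r
    -- included; the rest is the starting vector.
    record NestCert (π : V → State) (o : ℕ) (ℓ : Outer × I.Line) (x y : V) : Set where
      field
        r     : ℕ
        ≤x    : o + W + r * length round ≤ τ x
        x<    : τ x < o + W + suc r * length round
        outer : proj₁ (π x) ≡ proj₁ ℓ ⊕ r · lifted (ends (proj₂ ℓ)) ⊕ before (I.source (proj₂ ℓ))
        within : IG.Cert (proj₂ ∘ π) (entrance (o + W + r * length round)) (proj₂ ℓ) x y

    NestCert-injective : ∀ {π o ℓ ℓ′ x y} → NestCert π o ℓ x y → NestCert π o ℓ′ x y → ℓ ≡ ℓ′
    NestCert-injective {π} {o} {ℓ} {ℓ′} {x} {y} c d = cong₂ _,_ z≡ ℓ≡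
      where
      module C = NestCert c
      module D = NestCert d
      before′ : ∀ {r r′} → o + W + r * length round ≤ τ x → τ x < o + W + suc r′ * length round → r ≤ r′
      before′ {r} {r′} lo hi = s≤s⁻¹ (*-cancelʳ-< (length round) r (suc r′) (+-cancelˡ-< (o + W) _ _ (≤-<-trans lo hi)))
      r≡ : C.r ≡ D.r
      r≡ = ≤-antisym (before′ C.≤x D.x<) (before′ D.≤x C.x<)
      ℓ≡ : proj₂ ℓ ≡ proj₂ ℓ′
      ℓ≡ = IG.Cert-injective (subst (λ r → IG.Cert (proj₂ ∘ π) (entrance (o + W + r * length round)) (proj₂ ℓ) x y) r≡ C.within) D.within
      z≡ : proj₁ ℓ ≡ proj₁ ℓ′
      z≡ = ⊕-cancelʳ (C.r · lifted (ends (proj₂ ℓ))) _ _ (⊕-cancelʳ (before (I.source (proj₂ ℓ))) _ _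
             (trans (sym C.outer) (trans D.outer (cong₂ (λ r ℓ → proj₁ ℓ′ ⊕ r · lifted (ends ℓ) ⊕ before (I.source ℓ)) (sym r≡) (sym ℓ≡)))))

    nest-guarantee : Guarantee nest
    nest-guarantee = record
      { Cert           = NestCert
      ; Cert-injective = NestCert-injective
      ; Cert-ascending = λ c → IG.Cert-ascending (NestCert.within c)
      ; robust         = robust
      }
      where
      module _ (π : V → State) where
        module RR = Rounds _≟ˢ_ π W proj₁ round (Passage π) nest-round
      robust : Robust nest NestCert
      robust π {o} ob st₁ st₂ p within u≤ ≤w bad< (z , ℓ) z₁ z₂ =
          let x , y , run , cert = found in x , y , Q.embed (P.embed run) , record
            { r = Q.r
            ; ≤x = ≤-trans P.≤v₁ (proj₁ (Run-All run P.within))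
            ; x< = ≤-<-trans (≤-trans (proj₂ (Run-All run P.within)) P.v₂≤) (before-end Q.r)
            ; outer = trans (Run-All run P.outer) (cong₂ (λ z p → z ⊕ before p) (trans Q.start (cong (_⊕ Q.r · lifted (ends ℓ)) z₁)) (sym (proj₁ same-ends)))
            ; within = cert }
          where
          -- `bad<` is passed twice: `W` is by definition `R * I.budget`, so it bounds both the
          -- tolerance of the cuts and the total to be shared among the rounds.
          module Q = RR.Pick π (RR.robust-rounds π R I.budget p z (ends ℓ) ob st₁ st₂ within u≤ ≤w bad< bad< z₁ z₂)
          module P = Passage Q.info
          same-ends : I.source ℓ ≡ P.p × I.target ℓ ≡ P.p′
          same-ends = Vec.++-injective (I.source ℓ) P.p P.P≡
          before-end : ∀ r → entrance (o + W + r * length round) + n + W < o + W + suc r * length round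
          before-end r = <-≤-trans (m≤m+n (suc (entrance (o + W + r * length round) + n + W)) W)
            (≤-reflexive (trans (sym (length-round (o + W + r * length round))) (next-multiple (o + W) (length round) r)))
          found = IG.robust (proj₂ ∘ π) P.obeys P.still₁ P.still₂ P.t P.within P.v₁≤ P.≤v₂ (≤-<-trans P.bad≤ Q.bad<) ℓ
                    (trans P.read₁ (sym (proj₁ same-ends))) (trans P.read₂ (sym (proj₂ same-ends)))

-- Part (2): the layered graph of a machine

infix 4 _≺_ _≼_

data _≺_ : ∀ {m} → Vec ℕ m → Vec ℕ m → Set where
  []  : [] ≺ []
  _∷_ : ∀ {m x y} {a b : Vec ℕ m} → x < y → a ≺ b → x ∷ a ≺ y ∷ b

data _≼_ : ∀ {m} → Vec ℕ m → Vec ℕ m → Set where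
  []  : [] ≼ []
  _∷_ : ∀ {m x y} {a b : Vec ℕ m} → x ≤ y → a ≼ b → x ∷ a ≼ y ∷ b

≼-≺-trans : ∀ {m} {a b c : Vec ℕ m} → a ≼ b → b ≺ c → a ≺ c
≼-≺-trans []      []      = []
≼-≺-trans (p ∷ a) (q ∷ b) = ≤-<-trans p q ∷ ≼-≺-trans a b

≺⇒≼ : ∀ {m} {a b : Vec ℕ m} → a ≺ b → a ≼ b
≺⇒≼ []      = []
≺⇒≼ (p ∷ a) = <⇒≤ p ∷ ≺⇒≼ a

≼-refl : ∀ {m} {a : Vec ℕ m} → a ≼ a
≼-refl {a = []}    = []
≼-refl {a = x ∷ a} = ≤-refl ∷ ≼-refl

≼-⊕ʳ : ∀ {m} (a b : Vec ℕ m) → a ≼ a ⊕ b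
≼-⊕ʳ [] []           = []
≼-⊕ʳ (x ∷ a) (y ∷ b) = m≤m+n x y ∷ ≼-⊕ʳ a b

⊕-mono-≼ : ∀ {m} {a b c d : Vec ℕ m} → a ≼ b → c ≼ d → a ⊕ c ≼ b ⊕ d
⊕-mono-≼ [] []           = []
⊕-mono-≼ (p ∷ a) (q ∷ b) = +-mono-≤ p q ∷ ⊕-mono-≼ a b

⊕-mono-≺ : ∀ {m} {a b c d : Vec ℕ m} → a ≺ b → c ≼ d → a ⊕ c ≺ b ⊕ d
⊕-mono-≺ [] []           = []
⊕-mono-≺ (p ∷ a) (q ∷ b) = +-mono-<-≤ p q ∷ ⊕-mono-≺ a b

·-mono-≼ : ∀ {m} r {a b : Vec ℕ m} → a ≼ b → r · a ≼ r · b
·-mono-≼ r []      = []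
·-mono-≼ r (p ∷ a) = *-monoʳ-≤ r p ∷ ·-mono-≼ r a

∥∥²-mono : ∀ {m} {a b : Vec ℕ m} → a ≼ b → ∥ a ∥² ≤ ∥ b ∥²
∥∥²-mono []      = z≤n
∥∥²-mono (p ∷ a) = +-mono-≤ (*-mono-≤ p p) (∥∥²-mono a)

lifted-mono : ∀ {m} {a b : Vec ℕ m} → a ≼ b → lifted a ≼ lifted b
lifted-mono p = ∥∥²-mono p ∷ p

++-mono-≼ : ∀ {m k} {a b : Vec ℕ m} {c d : Vec ℕ k} → a ≼ b → c ≼ d → a Vec.++ c ≼ b Vec.++ d
++-mono-≼ []      q = q
++-mono-≼ (p ∷ a) q = p ∷ ++-mono-≼ a q

++-mono-≺ : ∀ {m k} {a b : Vec ℕ m} {c d : Vec ℕ k} → a ≺ b → c ≺ d → a Vec.++ c ≺ b Vec.++ d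
++-mono-≺ []      q = q
++-mono-≺ (p ∷ a) q = p ∷ ++-mono-≺ a q

0ᵛ≼ : ∀ {m} (a : Vec ℕ m) → 0ᵛ ≼ a
0ᵛ≼ []      = []
0ᵛ≼ (x ∷ a) = z≤n ∷ 0ᵛ≼ a

-- Boxes of vectors, their mixed-radix numbering, and finite sets of states.

∏ : ∀ {m} → Vec ℕ m → ℕ
∏ []      = 1
∏ (b ∷ bs) = b * ∏ bs

encode : ∀ {m} {a b : Vec ℕ m} → a ≺ b → Fin (∏ b)
encode []       = Fin.zero
encode (p ∷ ps) = Fin.combine (Fin.fromℕ< p) (encode ps)

decode : ∀ {m} (b : Vec ℕ m) → Fin (∏ b) → Vec ℕ m
decode []       _ = []
decode (b ∷ bs) i = toℕ (proj₁ (Fin.remQuot {b} (∏ bs) i)) ∷ decode bs (proj₂ (Fin.remQuot {b} (∏ bs) i))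

decode-encode : ∀ {m} {a b : Vec ℕ m} (p : a ≺ b) → decode b (encode p) ≡ a
decode-encode []       = refl
decode-encode {b = b ∷ bs} (p ∷ ps) =
  cong₂ _∷_ (trans (cong (toℕ ∘ proj₁) (Fin.remQuot-combine {k = ∏ bs} (Fin.fromℕ< p) (encode ps))) (Fin.toℕ-fromℕ< p))
            (trans (cong (decode bs ∘ proj₂) (Fin.remQuot-combine {k = ∏ bs} (Fin.fromℕ< p) (encode ps))) (decode-encode ps))

decode≺ : ∀ {m} (b : Vec ℕ m) i → decode b i ≺ b
decode≺ []       _ = []
decode≺ (b ∷ bs) i = Fin.toℕ<n (proj₁ (Fin.remQuot {b} (∏ bs) i)) ∷ decode≺ bs _

decode-injective : ∀ {m} (b : Vec ℕ m) {i j} → decode b i ≡ decode b j → i ≡ j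
decode-injective [] {Fin.zero} {Fin.zero} _ = refl
decode-injective (b ∷ bs) eq = remQuot-injective {b} (Fin.toℕ-injective (Vec.∷-injectiveˡ eq)) (decode-injective bs (Vec.∷-injectiveʳ eq))

∏>0 : ∀ {m} {b : Vec ℕ m} → 0ᵛ ≺ b → 0 < ∏ b
∏>0 []       = s≤s z≤n
∏>0 (p ∷ ps) = *-mono-≤ p (∏>0 ps)

infixr 5 _⟶_

data Execution {S : Set} (Good : S → Set) : List (Layer S) → S → S → Set where
  end : ∀ {x} → Good x → Execution Good [] x x
  _⟶_ : ∀ {l ls x y t} → Good x × T (l x y) → Execution Good ls y t → Execution Good (l ∷ ls) x t

Execution-++ : ∀ {S : Set} {Good : S → Set} {ls ms x y t} → Execution Good ls x y → Execution Good ms y t → Execution Good (ls ++ ms) x t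
Execution-++ (end _) f = f
Execution-++ (s ⟶ e) f = s ⟶ Execution-++ e f

Execution-start : ∀ {S : Set} {Good : S → Set} {ls x y} → Execution Good ls x y → Good x
Execution-start (end g)       = g
Execution-start ((g , _) ⟶ _) = g

Execution-end : ∀ {S : Set} {Good : S → Set} {ls x y} → Execution Good ls x y → Good y
Execution-end (end g) = g
Execution-end (_ ⟶ e) = Execution-end e

-- `origin` is the box of starting registers and controls the number of lines; `bound` holds every
-- value reached on a line and controls the number of states. `Good` speaks only of the executions
-- of lines, whereas the lower bound concerns walks through arbitrary decoded states.
record Realisation (G : Gadget) : Set₁ where
  open Gadget G
  field
    size           : ℕ
    size>0         : 0 < size
    Good           : State → Set
    enc            : ∀ x → Good x → Fin size
    dec            : Fin size → State
    dec-enc        : ∀ x g → dec (enc x g) ≡ x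
    origin bound   : Vec ℕ width
    0≺origin       : 0ᵛ ≺ origin
    count          : ℕ
    line           : Fin count → Line
    line-injective : ∀ {i j} → line i ≡ line j → i ≡ j
    source≺        : ∀ i → source (line i) ≺ bound
    target≺        : ∀ i → target (line i) ≺ bound
    initial final  : Fin count → State
    execution      : ∀ i → Execution Good program (initial i) (final i)
    read-initial   : ∀ i → read (initial i) ≡ source (line i)
    read-final     : ∀ i → read (final i) ≡ target (line i)

module _ {S : Set} (_≟ˢ_ : (x y : S) → Dec (x ≡ y)) {Good : S → Set} where
  open Idling _≟ˢ_

  Execution-rest : ∀ W {x} → Good x → Execution Good (rest W) x x
  Execution-rest zero g        = end g
  Execution-rest (suc W) {x} g = (g , fromWitness {a? = x ≟ˢ x} refl) ⟶ Execution-rest W g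

module BaseRealisation (A D R : ℕ) (A>0 : 0 < A) where
  open Base D R
  open Idling _≟ˢ_

  digits : ∀ {m} → Vec ℕ m
  digits = Vec.replicate _ A

  -- The leading 1 lets the register of squared norms start at 0 only; `bound` adds the most that R
  -- rounds can contribute.
  origin bound : Vec ℕ (suc D)
  origin = 1 ∷ digits
  bound  = origin ⊕ R · lifted digits

  Good : State → Set
  Good (c , z) = c < A × z ≺ bound

  0≺digits : ∀ m → 0ᵛ ≺ digits {m}
  0≺digits zero    = []
  0≺digits (suc m) = A>0 ∷ 0≺digits m

  Execution-pass : ∀ m ι {a : Vec ℕ m} {z c} → (∀ a b → ι (a ⊕ b) ≡ ι a ⊕ ι b) → ι 0ᵛ ≡ 0ᵛ → a ≺ digits → c < A →
                   z ⊕ (∥ a ∥² ∷ ι a) ≺ bound → ∃[ c′ ] c′ < A × Execution Good (pass m ι) (c , z) (c′ , z ⊕ (∥ a ∥² ∷ ι a))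
  Execution-pass zero ι {[]} {z} {c} ι-⊕ ι-0 [] c<A z≺ =
    c , c<A , subst (λ z′ → Execution Good [] (c , z) (c , z′)) z≡ (end (c<A , subst (_≺ bound) (sym z≡) z≺))
    where
    z≡ : z ≡ z ⊕ (0 ∷ ι [])
    z≡ = sym (trans (cong (λ a → z ⊕ (0 ∷ a)) ι-0) (⊕-identityʳ z))
  Execution-pass (suc m) ι {x ∷ a} {z} {c} ι-⊕ ι-0 (x< ∷ a≺) c<A z≺ =
    let c′ , c′< , e = Execution-pass m (λ a → ι (0 ∷ a)) (λ a b → ι-⊕ (0 ∷ a) (0 ∷ b)) ι-0 a≺ x< (subst (_≺ bound) z≡ z≺)
    in c′ , c′< , ((c<A , good) , fromWitness {a? = Vec.≡-dec _≟_ z z} refl) ⟶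
         Execution-++ (Execution-rest _≟ˢ_ R (x< , good))
           (((x< , good) , fromWitness {a? = bump (λ c → ι (c ∷ 0ᵛ)) (x , z) ≟ˢ (x , z₁)} refl) ⟶
             Execution-++ (Execution-rest _≟ˢ_ R (x< , good₁))
               (subst (λ z′ → Execution Good (pass m (λ a → ι (0 ∷ a))) (x , z₁) (c′ , z′)) (sym z≡) e))
    where
    z₁ : Vec ℕ (suc D)
    z₁ = z ⊕ (x * x ∷ ι (x ∷ 0ᵛ))
    z≡ : z ⊕ (∥ x ∷ a ∥² ∷ ι (x ∷ a)) ≡ z₁ ⊕ (∥ a ∥² ∷ ι (0 ∷ a))
    z≡ = sym (trans (⊕-assoc z _ _) (cong (λ b → z ⊕ (x * x + ∥ a ∥² ∷ b))
           (trans (sym (ι-⊕ (x ∷ 0ᵛ) (0 ∷ a))) (cong₂ (λ x y → ι (x ∷ y)) (+-identityʳ x) (⊕-identityˡ a)))))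
    good : z ≺ bound
    good = ≼-≺-trans (≼-⊕ʳ z _) z≺
    good₁ : z₁ ≺ bound
    good₁ = ≼-≺-trans (≼-⊕ʳ z₁ _) (subst (_≺ bound) z≡ z≺)

  Execution-rounds : ∀ r {a z c} → a ≺ digits → c < A → z ⊕ r · lifted a ≺ bound →
                     ∃[ c′ ] c′ < A × Execution Good (repeat r (pass D id)) (c , z) (c′ , z ⊕ r · lifted a)
  Execution-rounds zero {a} {z} {c} a≺ c<A z≺ =
    c , c<A , subst (λ z′ → Execution Good [] (c , z) (c , z′)) z≡ (end (c<A , subst (_≺ bound) (sym z≡) z≺))
    where
    z≡ : z ≡ z ⊕ 0 · lifted a
    z≡ = sym (trans (cong (z ⊕_) (zero-· (lifted a))) (⊕-identityʳ z))
  Execution-rounds (suc r) {a} {z} {c} a≺ c<A z≺ =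
    let c₁ , c₁< , e₁ = Execution-pass D id (λ _ _ → refl) refl a≺ c<A (≼-≺-trans (≼-⊕ʳ _ (r · lifted a)) (subst (_≺ bound) z≡ z≺))
        c₂ , c₂< , e₂ = Execution-rounds r a≺ c₁< (subst (_≺ bound) z≡ z≺)
    in c₂ , c₂< , Execution-++ e₁ (subst (λ z′ → Execution Good (repeat r (pass D id)) (c₁ , z ⊕ lifted a) (c₂ , z′)) (sym z≡) e₂)
    where
    z≡ : z ⊕ suc r · lifted a ≡ z ⊕ lifted a ⊕ r · lifted a
    z≡ = trans (cong (z ⊕_) (suc-· r (lifted a))) (sym (⊕-assoc z (lifted a) _))

  z₀ : Fin (∏ origin * ∏ (digits {D})) → Vec ℕ (suc D)
  z₀ i = decode origin (proj₁ (Fin.remQuot {∏ origin} (∏ (digits {D})) i))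

  a₀ : Fin (∏ origin * ∏ (digits {D})) → Vec ℕ D
  a₀ i = decode digits (proj₂ (Fin.remQuot {∏ origin} (∏ (digits {D})) i))

  z₀≺ : ∀ i → z₀ i ≺ origin
  z₀≺ i = decode≺ origin (proj₁ (Fin.remQuot {∏ origin} (∏ (digits {D})) i))

  a₀≺ : ∀ i → a₀ i ≺ digits
  a₀≺ i = decode≺ digits (proj₂ (Fin.remQuot {∏ origin} (∏ (digits {D})) i))

  target≺ : ∀ i → z₀ i ⊕ R · lifted (a₀ i) ≺ bound
  target≺ i = ⊕-mono-≺ (z₀≺ i) (·-mono-≼ R (lifted-mono (≺⇒≼ (a₀≺ i))))

  source≺ : ∀ i → z₀ i ≺ bound
  source≺ i = ≼-≺-trans (≼-⊕ʳ _ _) (target≺ i)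

  run : ∀ i → ∃[ c′ ] c′ < A × Execution Good (repeat R (pass D id)) (0 , z₀ i) (c′ , z₀ i ⊕ R · lifted (a₀ i))
  run i = Execution-rounds R (a₀≺ i) A>0 (target≺ i)

  base-realisation : Realisation base
  base-realisation = record
    { size           = A * ∏ bound
    ; size>0         = *-mono-≤ A>0 (∏>0 (≼-≺-trans (0ᵛ≼ 0ᵛ) 0≺bound))
    ; Good           = Good
    ; enc            = λ (c , z) (c< , z≺) → Fin.combine (Fin.fromℕ< c<) (encode z≺)
    ; dec            = λ i → toℕ (proj₁ (Fin.remQuot {A} (∏ bound) i)) , decode bound (proj₂ (Fin.remQuot {A} (∏ bound) i))
    ; dec-enc        = λ (c , z) (c< , z≺) → cong₂ _,_
        (trans (cong (toℕ ∘ proj₁) (Fin.remQuot-combine {k = ∏ bound} (Fin.fromℕ< c<) (encode z≺))) (Fin.toℕ-fromℕ< c<))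
        (trans (cong (decode bound ∘ proj₂) (Fin.remQuot-combine {k = ∏ bound} (Fin.fromℕ< c<) (encode z≺))) (decode-encode z≺))
    ; origin         = origin
    ; bound          = bound
    ; 0≺origin       = s≤s z≤n ∷ 0≺digits D
    ; count          = ∏ origin * ∏ (digits {D})
    ; line           = λ i → z₀ i , a₀ i
    ; line-injective = λ eq → remQuot-injective {∏ origin} (decode-injective origin (×.,-injectiveˡ eq)) (decode-injective digits (×.,-injectiveʳ eq))
    ; source≺        = source≺
    ; target≺        = target≺
    ; initial        = λ i → 0 , z₀ i
    ; final          = λ i → proj₁ (run i) , z₀ i ⊕ R · lifted (a₀ i)
    ; execution      = λ i → Execution-++ (Execution-rest _≟ˢ_ R (A>0 , source≺ i)) (proj₂ (proj₂ (run i)))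
    ; read-initial   = λ _ → refl
    ; read-final     = λ _ → refl
    }
    where
    0≺bound : 0ᵛ ≺ bound
    0≺bound = subst (_≺ bound) (⊕-identityʳ 0ᵛ) (⊕-mono-≺ (s≤s z≤n ∷ 0≺digits D) (0ᵛ≼ (R · lifted digits)))

module NestRealisation (R : ℕ) (I : Gadget) (realisation : Realisation I) where
  open Nest R I
  open Idling _≟ˢ_
  private
    module I = Gadget I
    module IR = Realisation realisation

  -- Two copies of the inner starting box, so that the number of starting vectors is squared from
  -- level to level.
  origin bound : Outer
  origin = 1 ∷ (IR.origin Vec.++ IR.origin)
  bound  = origin ⊕ R · lifted (IR.bound Vec.++ IR.bound)

  Good : State → Set
  Good (z , x) = z ≺ bound × IR.Good x

  Execution-inner : ∀ {ls x y z} → z ≺ bound → Execution IR.Good ls x y → Execution Good (Data.List.map inner ls) (z , x) (z , y)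
  Execution-inner z≺ (end g)             = end (z≺ , g)
  Execution-inner {z = z} z≺ (_⟶_ {l = l} {x = x} {y} (g , t) e) = ((z≺ , g) , T-∧ (fromWitness {a? = Vec.≡-dec _≟_ z z} refl) t) ⟶ Execution-inner z≺ e
    where
    T-∧ : ∀ {a b} → T a → T b → T (a ∧ b)
    T-∧ {true} _ t = t

  module _ (i : Fin IR.count) where
    x₀ x₁ : I.State
    x₀ = IR.initial i
    x₁ = IR.final i
    g₀ : IR.Good x₀
    g₀ = Execution-start (IR.execution i)
    g₁ : IR.Good x₁
    g₁ = Execution-end (IR.execution i)
    P : Vec ℕ (I.width + I.width)
    P = ends (IR.line i)

    P≼ : P ≼ IR.bound Vec.++ IR.bound
    P≼ = ++-mono-≼ (≺⇒≼ (IR.source≺ i)) (≺⇒≼ (IR.target≺ i))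

    Execution-round : ∀ {z x} → IR.Good x → z ⊕ lifted P ≺ bound → Execution Good round (z , x) (z ⊕ lifted P , x₁)
    Execution-round {z} {x} g z≺ = ((z≺₀ , g) , fromWitness {a? = Vec.≡-dec _≟_ z z} refl) ⟶
      Execution-++ (Execution-rest _≟ˢ_ W (z≺₀ , g₀)) (((z≺₀ , g₀) , fromWitness {a? = bump before (z , x₀) ≟ˢ (z₁ , x₀)} (cong (λ p → z ⊕ before p , x₀) (IR.read-initial i))) ⟶
      Execution-++ (Execution-rest _≟ˢ_ W (z≺₁ , g₀)) (Execution-++ (Execution-inner z≺₁ (IR.execution i))
      (Execution-++ (Execution-rest _≟ˢ_ W (z≺₁ , g₁)) (((z≺₁ , g₁) , fromWitness {a? = bump after (z₁ , x₁) ≟ˢ (z ⊕ lifted P , x₁)}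
        (cong (_, x₁) (trans (cong (λ p → z₁ ⊕ after p) (IR.read-final i)) z≡))) ⟶
      Execution-++ (Execution-rest _≟ˢ_ W (z≺ , g₁)) (end (z≺ , g₁))))))
      where
      z₁ : Outer
      z₁ = z ⊕ before (I.source (IR.line i))
      z≡ : z₁ ⊕ after (I.target (IR.line i)) ≡ z ⊕ lifted P
      z≡ = lifted-++ z (I.source (IR.line i)) (I.target (IR.line i))
      z≺₁ : z₁ ≺ bound
      z≺₁ = ≼-≺-trans (≼-⊕ʳ z₁ _) (subst (_≺ bound) (sym z≡) z≺)
      z≺₀ : z ≺ bound
      z≺₀ = ≼-≺-trans (≼-⊕ʳ z _) z≺

    Execution-rounds : ∀ r {z x} → IR.Good x → z ⊕ r · lifted P ≺ bound →
                       ∃[ x′ ] Execution Good (repeat r round) (z , x) (z ⊕ r · lifted P , x′)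
    Execution-rounds zero {z} {x} g z≺ = x , subst (λ z′ → Execution Good [] (z , x) (z′ , x)) z≡ (end (subst (_≺ bound) (sym z≡) z≺ , g))
      where
      z≡ : z ≡ z ⊕ 0 · lifted P
      z≡ = sym (trans (cong (z ⊕_) (zero-· (lifted P))) (⊕-identityʳ z))
    Execution-rounds (suc r) {z} {x} g z≺ =
      let e₁       = Execution-round g (≼-≺-trans (≼-⊕ʳ _ (r · lifted P)) (subst (_≺ bound) z≡ z≺))
          x′ , e₂  = Execution-rounds r g₁ (subst (_≺ bound) z≡ z≺)
      in x′ , Execution-++ e₁ (subst (λ z′ → Execution Good (repeat r round) (z ⊕ lifted P , x₁) (z′ , x′)) (sym z≡) e₂)
      where
      z≡ : z ⊕ suc r · lifted P ≡ z ⊕ lifted P ⊕ r · lifted P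
      z≡ = trans (cong (z ⊕_) (suc-· r (lifted P))) (sym (⊕-assoc z (lifted P) _))

  Index : Set
  Index = Fin (∏ origin * IR.count)

  z₀ : Index → Outer
  z₀ i = decode origin (proj₁ (Fin.remQuot {∏ origin} IR.count i))

  j₀ : Index → Fin IR.count
  j₀ i = proj₂ (Fin.remQuot {∏ origin} IR.count i)

  target≺ : ∀ i → z₀ i ⊕ R · lifted (P (j₀ i)) ≺ bound
  target≺ i = ⊕-mono-≺ (decode≺ origin _) (·-mono-≼ R (lifted-mono (P≼ (j₀ i))))

  source≺ : ∀ i → z₀ i ≺ bound
  source≺ i = ≼-≺-trans (≼-⊕ʳ _ _) (target≺ i)

  run : ∀ i → ∃[ x′ ] Execution Good (repeat R round) (z₀ i , x₀ (j₀ i)) (z₀ i ⊕ R · lifted (P (j₀ i)) , x′)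
  run i = Execution-rounds (j₀ i) R (g₀ (j₀ i)) (target≺ i)

  0≺origin : 0ᵛ ≺ origin
  0≺origin = s≤s z≤n ∷ subst (_≺ IR.origin Vec.++ IR.origin) (zeros I.width) (++-mono-≺ IR.0≺origin IR.0≺origin)
    where
    zeros : ∀ m {k} → 0ᵛ {m} Vec.++ 0ᵛ {k} ≡ 0ᵛ
    zeros zero    = refl
    zeros (suc m) = cong (0 ∷_) (zeros m)

  nest-realisation : Realisation nest
  nest-realisation = record
    { size           = ∏ bound * IR.size
    ; size>0         = *-mono-≤ (∏>0 (subst (_≺ bound) (⊕-identityʳ 0ᵛ) (⊕-mono-≺ 0≺origin (0ᵛ≼ (R · lifted (IR.bound Vec.++ IR.bound)))))) IR.size>0
    ; Good           = Good
    ; enc            = λ (z , x) (z≺ , g) → Fin.combine (encode z≺) (IR.enc x g)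
    ; dec            = λ i → decode bound (proj₁ (Fin.remQuot {∏ bound} IR.size i)) , IR.dec (proj₂ (Fin.remQuot {∏ bound} IR.size i))
    ; dec-enc        = λ (z , x) (z≺ , g) → cong₂ _,_
        (trans (cong (decode bound ∘ proj₁) (Fin.remQuot-combine {k = IR.size} (encode z≺) (IR.enc x g))) (decode-encode z≺))
        (trans (cong (IR.dec ∘ proj₂) (Fin.remQuot-combine {k = IR.size} (encode z≺) (IR.enc x g))) (IR.dec-enc x g))
    ; origin         = origin
    ; bound          = bound
    ; 0≺origin       = 0≺origin
    ; count          = ∏ origin * IR.count
    ; line           = λ i → z₀ i , IR.line (j₀ i)
    ; line-injective = λ eq → remQuot-injective {∏ origin} (decode-injective origin (×.,-injectiveˡ eq)) (IR.line-injective (×.,-injectiveʳ eq))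
    ; source≺        = source≺
    ; target≺        = target≺
    ; initial        = λ i → z₀ i , x₀ (j₀ i)
    ; final          = λ i → z₀ i ⊕ R · lifted (P (j₀ i)) , proj₁ (run i)
    ; execution      = λ i → Execution-++ (Execution-rest _≟ˢ_ W (source≺ i , g₀ (j₀ i))) (proj₂ (run i))
    ; read-initial   = λ _ → refl
    ; read-final     = λ _ → refl
    }

-- From programs to graphs, and from hopset walks to traces.

layerAt : ∀ {S : Set} → List (Layer S) → ℕ → S → S → Set
layerAt []       t       x y = ⊥
layerAt (l ∷ ls) zero    x y = T (l x y)
layerAt (l ∷ ls) (suc t) x y = layerAt ls t x y

layerAt? : ∀ {S : Set} (ls : List (Layer S)) t x y → Dec (layerAt ls t x y)
layerAt? []       t       x y = no λ ()
layerAt? (l ∷ ls) zero    x y = T? (l x y)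
layerAt? (l ∷ ls) (suc t) x y = layerAt? ls t x y

layerAt-length : ∀ {S : Set} (ls : List (Layer S)) {t x y} → layerAt ls t x y → t < length ls
layerAt-length (l ∷ ls) {zero}  _ = s≤s z≤n
layerAt-length (l ∷ ls) {suc t} e = s≤s (layerAt-length ls e)

_‼_ : ∀ {A : Set} → List A → ℕ → Maybe A
[]       ‼ i     = nothing
(x ∷ xs) ‼ zero  = just x
(x ∷ xs) ‼ suc i = xs ‼ i

-- Which pairs of `H` have finite distance is not computed. Since the final inequality is decidable,
-- finitely many such questions may be taken as answered under a double negation.
¬¬-decide-all : ∀ m (P : Fin m → Set) → ¬ ¬ (∀ i → Dec (P i))
¬¬-decide-all zero P k    = k λ ()
¬¬-decide-all (suc m) P k = ¬¬-decide-all m (P ∘ Fin.suc) λ ds →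
  (λ k′ → k′ (no λ p → k′ (yes p))) λ d → k λ { Fin.zero → d ; (Fin.suc i) → ds i }

module LayeredGraph (Γ : Gadget) (ρ : Realisation Γ)
  (guarantee : ∀ {V : Set} (τ : V → ℕ) (Fwd : V → V → Set) (tick : ∀ {u v} → Fwd u v → τ v ≡ suc (τ u)) →
               Robustness.Guarantee τ Fwd tick Γ)
  (n : ℕ) (fits : suc (length (Gadget.program Γ)) * Realisation.size ρ ≤ n) where

  open Gadget Γ
  open Realisation ρ

  instance
    size≢0 : NonZero size
    size≢0 = >-nonZero size>0

  τ : Fin n → ℕ
  τ i = toℕ i ℕ./ size

  π : Fin n → State
  π i = dec (toℕ i mod size)

  Fwd : Fin n → Fin n → Set
  Fwd u v = τ v ≡ suc (τ u) × layerAt program (τ u) (π u) (π v)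

  tick : ∀ {u v} → Fwd u v → τ v ≡ suc (τ u)
  tick = proj₁

  open Traces τ Fwd tick
  open Robustness τ Fwd tick using (Still; Obeys)
  open Robustness.Guarantee (guarantee τ Fwd tick)

  joined? : ∀ u v → Dec (Fwd u v ⊎ Fwd v u)
  joined? u v = fwd? u v ⊎-dec fwd? v u
    where
    fwd? : ∀ u v → Dec (Fwd u v)
    fwd? u v = (τ v ≟ suc (τ u)) ×-dec layerAt? program (τ u) (π u) (π v)

  G : Graph n
  G = record
    { adj        = λ u v → ⌊ joined? u v ⌋
    ; adj-sym    = λ {u} {v} e → fromWitness {a? = joined? v u} (swap (toWitness {a? = joined? u v} e))
    ; adj-irrefl = λ {u} e → [ (λ f → 1+n≢n (sym (tick f))) , (λ f → 1+n≢n (sym (tick f))) ]′ (toWitness {a? = joined? u u} e)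
    ; weight     = λ _ _ → 1ℚ
    ; weight-sym = λ _ → refl
    ; weight-pos = λ _ → _
    }

  open Graph G using (adj; adj-sym)
  open Lengths G (λ _ _ → 1) (λ _ → refl)

  joined : ∀ {u v} → T (adj u v) → Fwd u v ⊎ Fwd v u
  joined {u} {v} = toWitness {a? = joined? u v}

  obeys : Obeys π 0 program
  obeys = suffix program 0 λ t (_ , l) eq → subst (λ t → layerAt program t _ _) eq l
    where
    suffix : ∀ ls o → (∀ {x y} t → Fwd x y → τ x ≡ o + t → layerAt ls t (π x) (π y)) → Obeys π o ls
    suffix [] o at       = tt
    suffix (l ∷ ls) o at = (λ e eq → at 0 e (trans eq (sym (+-identityʳ o)))) ,
                           suffix ls (suc o) λ t e eq → at (suc t) e (trans eq (sym (+-suc o t)))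

  vertex : ∀ t x → Good x → t ≤ length program → Σ (Fin n) λ i → τ i ≡ t × π i ≡ x
  vertex t x g t≤ =
    let i , q , r = cell size t (toℕ (enc x g)) (Fin.toℕ<n (enc x g)) (begin-strict
          t * size + toℕ (enc x g) <⟨ +-monoʳ-< (t * size) (Fin.toℕ<n (enc x g)) ⟩
          t * size + size ≡⟨ +-comm (t * size) size ⟩
          suc t * size ≤⟨ *-monoˡ-≤ size (s≤s t≤) ⟩
          suc (length program) * size ≤⟨ fits ⟩
          n ∎)
    in i , q , trans (cong dec (Fin.toℕ-injective (trans (Fin.toℕ-fromℕ< (m%n<n (toℕ i) size)) r))) (dec-enc x g)
    where open ≤-Reasoning

  execution-walk : ∀ {x y} ls t → (∀ s {x y} → layerAt ls s x y → layerAt program (t + s) x y) → t + length ls ≡ length program →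
                   Execution Good ls x y → ∀ {u} → τ u ≡ t → π u ≡ x →
                   Σ (Fin n) λ v → τ v ≡ length program × π v ≡ y × Σ (Walk (edges G) u v) λ p → lenℕ p ≡ length ls
  execution-walk [] t _ eq (end _) {u} τu πu = u , trans τu (trans (sym (+-identityʳ t)) eq) , πu , [] , refl
  execution-walk (l ∷ ls) t at eq (_⟶_ {y = y} (_ , e) ex) {u} τu πu =
    let eq′ = trans (sym (+-suc t (length ls))) eq
        v , τv , πv = vertex (suc t) y (Execution-start ex) (≤-trans (m≤m+n (suc t) (length ls)) (≤-reflexive eq′))
        w , τw , πw , p , len = execution-walk ls (suc t) (λ s {x} {y} e → subst (λ t → layerAt program t x y) (+-suc t s) (at (suc s) e)) eq′ ex τv πv
        here-at = subst (λ t → layerAt program t (π u) (π v)) (trans (+-identityʳ t) (sym τu)) (at 0 (subst₂ (λ x y → T (l x y)) (sym πu) (sym πv) e))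
    in w , τw , πw , ((fromWitness {a? = joined? u v} (inj₁ (trans τv (cong suc (sym τu)) , here-at)) , refl) ∷ p) , cong suc len

  τ-walk : ∀ {u v} (p : Walk (edges G) u v) → τ v ≤ τ u + lenℕ p
  τ-walk {u} [] = m≤m+n (τ u) 0
  τ-walk {u} {w} (_∷_ {v = v} (e , _) p) = ≤-trans (τ-walk p) (≤-trans (+-monoˡ-≤ (lenℕ p) one-step) (≤-reflexive (sym (+-suc (τ u) (lenℕ p)))))
    where
    one-step : τ v ≤ suc (τ u)
    one-step = [ ≤-reflexive ∘ tick , (λ f → ≤-trans (n≤1+n _) (≤-trans (≤-reflexive (sym (tick f))) (n≤1+n _))) ]′ (joined e)

  reverse-onto : ∀ {u v w} → Walk (edges G) u v → Walk (edges G) u w → Walk (edges G) v w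
  reverse-onto [] q                      = q
  reverse-onto (_∷_ {u} {v} (e , _) p) q = reverse-onto p ((adj-sym {u} {v} e , refl) ∷ q)

  reverse : ∀ {u v} → Walk (edges G) u v → Walk (edges G) v u
  reverse p = reverse-onto p []

  lenℕ-reverse : ∀ {u v} (p : Walk (edges G) u v) → lenℕ (reverse p) ≡ lenℕ p
  lenℕ-reverse p = trans (onto p []) (+-identityʳ (lenℕ p))
    where
    onto : ∀ {u v w} (p : Walk (edges G) u v) (q : Walk (edges G) u w) → lenℕ (reverse-onto p q) ≡ lenℕ p + lenℕ q
    onto [] q                      = refl
    onto (_∷_ {u} {v} (e , _) p) q = trans (onto p _) (+-suc (lenℕ p) (lenℕ q))

  geodesic : ∀ {u v w} → Dist (edges G) u v w → Walk (edges G) u v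
  geodesic ((g , _) , _) = g

  geodesic-min : ∀ {u v w} (D : Dist (edges G) u v w) (q : Walk (edges G) u v) → lenℕ (geodesic D) ≤ lenℕ q
  geodesic-min ((g , refl) , min) q = fromℕ-cancel-≤ (subst₂ ℚ._≤_ (len≡ g) (len≡ q) (min q))

  Dist-sym : ∀ {u v w} → Dist (edges G) u v w → Σ ℚ (Dist (edges G) v u)
  Dist-sym D = _ , dist (reverse (geodesic D)) (lenℕ-reverse (geodesic D)) λ q →
    ≤-trans (geodesic-min D (reverse q)) (≤-reflexive (lenℕ-reverse q))

  vertices : ∀ {u v} → Walk (edges G) u v → List (Fin n)
  vertices {u} []      = u ∷ []
  vertices {u} (_ ∷ p) = u ∷ vertices p

  directed : ∀ {u v} → Bool → Fwd u v ⊎ Fwd v u → Step u v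
  directed b (inj₁ e) = fwd b e
  directed b (inj₂ e) = bwd b e

  toTrace : ∀ {u v} → Bool → Walk (edges G) u v → Trace u v
  toTrace b []            = ε
  toTrace b ((e , _) ∷ p) = directed b (joined e) ⨾ toTrace false p

  bad-step : ∀ {u v w b m k} (e : Fwd u v ⊎ Fwd v u) → m + τ w ≤ k + τ v → cost (directed b e) + m + τ w ≤ flag b + suc k + τ u
  bad-step {u} {v} {w} {b} {m} {k} (inj₁ e) le = begin
    flag b + m + τ w ≡⟨ +-assoc (flag b) m (τ w) ⟩
    flag b + (m + τ w) ≤⟨ +-monoʳ-≤ (flag b) le ⟩
    flag b + (k + τ v) ≡⟨ cong (λ t → flag b + (k + t)) (tick e) ⟩
    flag b + (k + suc (τ u)) ≡⟨ regroup (flag b) k (τ u) ⟩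
    flag b + suc k + τ u ∎
    where
    open ≤-Reasoning
    regroup : ∀ f k t → f + (k + suc t) ≡ f + suc k + t
    regroup = solve-∀
  bad-step {u} {v} {w} {b} {m} {k} (inj₂ e) le = begin
    suc (flag b) + m + τ w ≡⟨ +-assoc (suc (flag b)) m (τ w) ⟩
    suc (flag b) + (m + τ w) ≤⟨ +-monoʳ-≤ (suc (flag b)) le ⟩
    suc (flag b) + (k + τ v) ≤⟨ +-monoʳ-≤ (suc (flag b)) (+-monoʳ-≤ k (≤-trans (n≤1+n (τ v)) (≤-reflexive (sym (tick e))))) ⟩
    suc (flag b) + (k + τ u) ≡⟨ regroup (flag b) k (τ u) ⟩
    flag b + suc k + τ u ∎
    where
    open ≤-Reasoning
    regroup : ∀ f k t → suc f + (k + t) ≡ f + suc k + t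
    regroup = solve-∀

  -- Each backward step raises length minus climb by two, each forward step leaves it unchanged; the
  -- excess length pays for the backward steps.
  bad-toTrace : ∀ {u v} b (p : Walk (edges G) u v) → bad (toTrace b p) + τ v ≤ flag b + lenℕ p + τ u
  bad-toTrace {u} b []        = m≤n+m (τ u) (flag b + 0)
  bad-toTrace b (_∷_ {v = v} (e , _) p) = bad-step {b = b} {k = lenℕ p} (joined e) (bad-toTrace false p)

  -- Every hop opens with a flagged step, so a run that began inside one hop cannot continue into
  -- the next.
  Started : ∀ {u v} → Trace u v → Set
  Started ε               = ⊤
  Started (fwd b _ ⨾ _)   = T b
  Started (bwd b _ ⨾ _)   = T b

  Started-Prefix : ∀ {u v x} (q : Trace u v) → Started q → Prefix q x → x ≡ u
  Started-Prefix q st stop = refl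

  Started-toTrace : ∀ {u v w} (p : Walk (edges G) u v) (q : Trace v w) → Started q → Started (toTrace true p ⧺ q)
  Started-toTrace [] q st            = st
  Started-toTrace ((e , _) ∷ p) q st = on (joined e)
    where
    on : ∀ {u v w} {r : Trace v w} (e : Fwd u v ⊎ Fwd v u) → Started (directed true e ⨾ r)
    on (inj₁ _) = tt
    on (inj₂ _) = tt

  Prefix-tail : ∀ {u v w x} {s : Step u v} {p : Trace v w} → Prefix (s ⨾ p) x → x ≡ u ⊎ Prefix p x
  Prefix-tail stop   = inj₁ refl
  Prefix-tail (go r) = inj₂ r

  At : ℕ → List (Fin n) → Fin n → Set
  At M vs x = ∃[ i ] i ≤ M × vs ‼ i ≡ just x

  At-there : ∀ {M vs v x} → At M vs x → At (suc M) (v ∷ vs) x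
  At-there (i , i≤ , eq) = suc i , s≤s i≤ , eq

  At-≤ : ∀ {M M′ vs x} → M ≤ M′ → At M vs x → At M′ vs x
  At-≤ le (i , i≤ , eq) = i , ≤-trans i≤ le , eq

  Prefix-located : ∀ {u v w x b} (p : Walk (edges G) u v) (q : Trace v w) → Started q → Prefix (toTrace b p ⧺ q) x → At (lenℕ p) (vertices p) x
  Prefix-located [] q st r rewrite Started-Prefix q st r = 0 , z≤n , refl
  Prefix-located (_ ∷ p) q st r = [ (λ { refl → 0 , z≤n , refl }) , (λ r → At-there (Prefix-located p q st r)) ]′ (Prefix-tail r)

  Run-tail : ∀ {u v w x y} {s : Step u v} {p : Trace v w} → Run (s ⨾ p) x y → (x ≡ u × Prefix (s ⨾ p) y) ⊎ Run p x y
  Run-tail (here r)  = inj₁ (refl , r)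
  Run-tail (there r) = inj₂ r

  Run-located : ∀ {u v w x y b} (p : Walk (edges G) u v) (q : Trace v w) → Started q → Run (toTrace b p ⧺ q) x y →
                (At (lenℕ p) (vertices p) x × At (lenℕ p) (vertices p) y) ⊎ Run q x y
  Run-located [] q st r            = inj₂ r
  Run-located {b = b} p@(_ ∷ p′) q st r =
    [ (λ { (refl , r) → inj₁ ((0 , z≤n , refl) , Prefix-located {b = b} p q st r) })
    , (λ r → [ (λ (a , a′) → inj₁ (At-there a , At-there a′)) , inj₂ ]′ (Run-located p′ q st r)) ]′ (Run-tail r)

  -- Behind the last instruction `layerAt` is empty: no edge leads upwards there, also not among the
  -- vertices by which n exceeds the layered part.
  Still-end : ∀ {hi} → Still π (0 + length program) hi
  Still-end (_ , l) T≤ _ = ⊥-elim (<-irrefl refl (<-≤-trans (layerAt-length program l) T≤))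

  -- The `Dist` witness of a shortcut may carry any shortest walk between its ends. Fixing one walk
  -- per pair of `H` makes a run inside a shortcut describable by the pair, a direction and two
  -- positions, so that these runs can be counted.
  module Canonical (H : PairSet n)
    (decide : ∀ e → Dec (Σ ℚ (Dist (edges G) (proj₁ (lookup (PairSet.pairs H) e)) (proj₂ (lookup (PairSet.pairs H) e))))) where
    open PairSet H

    chosen : ∀ {u v} → Dec (Σ ℚ (Dist (edges G) u v)) → Fin 2 → List (Fin n)
    chosen (yes (_ , D)) Fin.zero    = vertices (geodesic D)
    chosen (yes (_ , D)) (Fin.suc _) = vertices (reverse (geodesic D))
    chosen (no _)        _           = []

    chosen-geodesic : ∀ {x u v w} (d : Dec (Σ ℚ (Dist (edges G) (proj₁ x) (proj₂ x)))) → (u , v) ≡ x → (D : Dist (edges G) u v w) →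
      Σ (Walk (edges G) u v) λ g → lenℕ g ≡ lenℕ (geodesic D) × chosen d Fin.zero ≡ vertices g × chosen d (Fin.suc Fin.zero) ≡ vertices (reverse g)
    chosen-geodesic (yes (_ , D′)) refl D =
      geodesic D′ , ≤-antisym (geodesic-min D′ (geodesic D)) (geodesic-min D (geodesic D′)) , refl , refl
    chosen-geodesic (no ¬D) refl D = ⊥-elim (¬D (_ , D))

    canonical : Fin ∣ H ∣ → Fin 2 → List (Fin n)
    canonical e = chosen (decide e)

    Shortcut : ∀ u v → ℕ → Set
    Shortcut u v m = Σ (Walk (edges G) u v) λ g → lenℕ g ≡ m × ∃[ e ] ∃[ o ] canonical e o ≡ vertices g

    shortcut : ∀ {u v w} → ((u , v) ∈ pairs) ⊎ ((v , u) ∈ pairs) → (D : Dist (edges G) u v w) → Shortcut u v (lenℕ (geodesic D))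
    shortcut (inj₁ m) D =
      let g , len , eq , _ = chosen-geodesic (decide (index m)) (lookup-index m) D
      in g , len , index m , Fin.zero , eq
    shortcut (inj₂ m) D =
      let _ , D′           = Dist-sym D
          g , len , _ , eq = chosen-geodesic (decide (index m)) (lookup-index m) D′
      in reverse g , trans (lenℕ-reverse g) (trans len (lenℕ-reverse (geodesic D))) , index m , Fin.suc Fin.zero , eq

    expand : ∀ {u v} → Walk (G ∪ H) u v → Trace u v
    expand []                  = ε
    expand (inj₁ e ∷ p)        = toTrace true (e ∷ []) ⧺ expand p
    expand (inj₂ (m , D) ∷ p)  = toTrace true (proj₁ (shortcut m D)) ⧺ expand p

    private
      bad-hop : ∀ {u t v h m k} (g : Walk (edges G) u t) (q : Trace t v) → lenℕ g ≡ m → bad q + τ v ≤ h + k + τ t →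
                bad (toTrace true g ⧺ q) + τ v ≤ suc h + (m + k) + τ u
      bad-hop {u} {t} {v} {h} {_} {k} g q refl le = begin
        bad (toTrace true g ⧺ q) + τ v ≡⟨ cong (_+ τ v) (bad-⧺ (toTrace true g) q) ⟩
        bad (toTrace true g) + bad q + τ v ≡⟨ +-assoc (bad (toTrace true g)) (bad q) (τ v) ⟩
        bad (toTrace true g) + (bad q + τ v) ≤⟨ +-monoʳ-≤ (bad (toTrace true g)) le ⟩
        bad (toTrace true g) + (h + k + τ t) ≡⟨ regroup (bad (toTrace true g)) (h + k) (τ t) ⟩
        bad (toTrace true g) + τ t + (h + k) ≤⟨ +-monoˡ-≤ (h + k) (bad-toTrace true g) ⟩
        1 + lenℕ g + τ u + (h + k) ≡⟨ regroup′ (lenℕ g) (τ u) h k ⟩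
        suc h + (lenℕ g + k) + τ u ∎
        where
        open ≤-Reasoning
        regroup : ∀ b h t → b + (h + t) ≡ b + t + h
        regroup = solve-∀
        regroup′ : ∀ l u h k → 1 + l + u + (h + k) ≡ suc h + (l + k) + u
        regroup′ = solve-∀

    bad-expand : ∀ {u v} (p : Walk (G ∪ H) u v) → bad (expand p) + τ v ≤ hops p + lenℕ-∪ H p + τ u
    bad-expand []                 = ≤-refl
    bad-expand (inj₁ e ∷ p)       = bad-hop {h = hops p} {k = lenℕ-∪ H p} (e ∷ []) (expand p) refl (bad-expand p)
    bad-expand (inj₂ (m , D) ∷ p) = bad-hop {h = hops p} {k = lenℕ-∪ H p} (proj₁ (shortcut m D)) (expand p) (proj₁ (proj₂ (shortcut m D))) (bad-expand p)

    Started-expand : ∀ {u v} (p : Walk (G ∪ H) u v) → Started (expand p)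
    Started-expand []                 = tt
    Started-expand (inj₁ e ∷ p)       = Started-toTrace (e ∷ []) (expand p) (Started-expand p)
    Started-expand (inj₂ (m , D) ∷ p) = Started-toTrace (proj₁ (shortcut m D)) (expand p) (Started-expand p)

    Located : ℕ → Fin n → Fin n → Set
    Located M x y = ∃[ e ] ∃[ o ] At M (canonical e o) x × At M (canonical e o) y

    Located-≤ : ∀ {M M′ x y} → M ≤ M′ → Located M x y → Located M′ x y
    Located-≤ le (e , o , a , b) = e , o , At-≤ {vs = canonical e o} le a , At-≤ {vs = canonical e o} le b

    -- A hop along an edge of `G` is a single flagged step and contains no run between different
    -- vertices, so the run lies on a shortcut.
    Run-expand : ∀ {u v x y} (p : Walk (G ∪ H) u v) → x ≢ y → Run (expand p) x y → Located (lenℕ-∪ H p) x y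
    Run-expand [] x≢y (here stop) = ⊥-elim (x≢y refl)
    Run-expand (_∷_ {v = t} (inj₁ (e , _)) p) x≢y r = [ (λ (x≡ , pre) → ⊥-elim (x≢y (trans x≡ (sym (single (joined e) pre)))))
                                           , (λ r → Located-≤ (n≤1+n _) (Run-expand p x≢y r)) ]′ (Run-tail r)
      where
      single : ∀ {u v w x} {q : Trace v w} (e : Fwd u v ⊎ Fwd v u) → Prefix (directed true e ⨾ q) x → x ≡ u
      single (inj₁ _) stop = refl
      single (inj₂ _) stop = refl
    Run-expand (inj₂ (m , D) ∷ p) x≢y r =
      let g , len , e , o , eq = shortcut m D
          M≤ = ≤-trans (≤-reflexive len) (m≤m+n _ (lenℕ-∪ H p))
      in [ (λ (a , b) → e , o , from (sym eq) (At-≤ {vs = vertices g} M≤ a) , from (sym eq) (At-≤ {vs = vertices g} M≤ b))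
         , (λ r → Located-≤ (m≤n+m _ (lenℕ (geodesic D))) (Run-expand p x≢y r)) ]′ (Run-located g (expand p) (Started-expand p) r)
      where
      from : ∀ {M vs vs′ x} → vs ≡ vs′ → At M vs x → At M vs′ x
      from refl a = a

    code : ∀ {M x y} → Located M x y → Fin (∣ H ∣ * (2 * (suc M * suc M)))
    code (e , o , (i , i≤ , _) , (j , j≤ , _)) = Fin.combine e (Fin.combine o (Fin.combine (Fin.fromℕ< (s≤s i≤)) (Fin.fromℕ< (s≤s j≤))))

    code-injective : ∀ {M x y x′ y′} (a : Located M x y) (b : Located M x′ y′) → code a ≡ code b → x ≡ x′ × y ≡ y′
    code-injective {M} (e , o , (i , i≤ , p) , (j , j≤ , q)) (e′ , o′ , (i′ , i′≤ , p′) , (j′ , j′≤ , q′)) eq =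
      let e≡ , eq₁ = Fin.combine-injective e _ e′ _ eq
          o≡ , eq₂ = Fin.combine-injective o _ o′ _ eq₁
          i≡ , j≡  = Fin.combine-injective (Fin.fromℕ< (s≤s i≤)) _ (Fin.fromℕ< (s≤s i′≤)) _ eq₂
      in same e≡ o≡ (index≡ i≤ i′≤ i≡) p p′ , same e≡ o≡ (index≡ j≤ j′≤ j≡) q q′
      where
      index≡ : ∀ {i i′} (i≤ : i ≤ M) (i′≤ : i′ ≤ M) → Fin.fromℕ< (s≤s i≤) ≡ Fin.fromℕ< (s≤s i′≤) → i ≡ i′
      index≡ i≤ i′≤ eq = trans (sym (Fin.toℕ-fromℕ< (s≤s i≤))) (trans (cong toℕ eq) (Fin.toℕ-fromℕ< (s≤s i′≤)))
      same : ∀ {e e′ o o′ i i′ x x′} → e ≡ e′ → o ≡ o′ → i ≡ i′ → canonical e o ‼ i ≡ just x → canonical e′ o′ ‼ i′ ≡ just x′ → x ≡ x′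
      same refl refl refl p p′ = just-injective (trans (sym p) p′)

    private
      within : ∀ {u w} (p : Trace u w) → All (λ x → 0 ≤ τ x × τ x ≤ n) p
      within {u} ε   = z≤n , ≤-trans (ℕ.m/n≤m (toℕ u) size) (<⇒≤ (Fin.toℕ<n u))
      within {u} (s ⨾ p) = (z≤n , ≤-trans (ℕ.m/n≤m (toℕ u) size) (<⇒≤ (Fin.toℕ<n u))) , within p

    -- A walk from layer 0 to the last layer that is at most r longer than the climb has at most r
    -- backward steps, and its hops contribute at most b flags; robustness applies as b + r is
    -- within the budget.
    certified : ∀ r b a {u v} → τ u ≡ 0 → π u ≡ initial a → τ v ≡ length program → π v ≡ final a →
                (g : Walk (G ∪ H) u v) → hops g ≤ b → lenℕ-∪ H g ≤ length program + r → b + r < budget →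
                ∃[ x ] ∃[ y ] Located (length program + r) x y × Cert π 0 (line a) x y
    certified r b a {u} {v} τu πu τv πv g h≤ g≤ β< =
      let x , y , run , cert = robust π {0} {0} {n} obeys (λ _ _ ()) Still-end (expand g) (within (expand g)) (≤-reflexive τu) (≤-reflexive (sym τv))
                                 (≤-<-trans bad≤ β<) (line a) (trans (cong read πu) (read-initial a)) (trans (cong read πv) (read-final a))
      in x , y , Located-≤ g≤ (Run-expand g (λ x≡y → <⇒≢ (Cert-ascending cert) (cong τ x≡y)) run) , cert
      where
      open ≤-Reasoning
      regroup : ∀ b t r → b + (t + r) ≡ b + r + t
      regroup = solve-∀
      bad≤ : bad (expand g) ≤ b + r
      bad≤ = +-cancelʳ-≤ (length program) _ _ (begin
        bad (expand g) + length program ≡⟨ cong (_+_ (bad (expand g))) τv ⟨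
        bad (expand g) + τ v ≤⟨ bad-expand g ⟩
        hops g + lenℕ-∪ H g + τ u ≡⟨ trans (cong (_+_ (hops g + lenℕ-∪ H g)) τu) (+-identityʳ _) ⟩
        hops g + lenℕ-∪ H g ≤⟨ +-mono-≤ h≤ g≤ ⟩
        b + (length program + r) ≡⟨ regroup b (length program) r ⟩
        b + r + length program ∎)

  Ends : Fin count → Set
  Ends a = Σ (Fin n) λ u → Σ (Fin n) λ v → τ u ≡ 0 × π u ≡ initial a × τ v ≡ length program × π v ≡ final a ×
           Dist (edges G) u v (fromℕ (length program))

  abstract
    ends-of : ∀ a → Ends a
    ends-of a =
      let u , τu , πu          = vertex 0 (initial a) (Execution-start (execution a)) z≤n
          v , τv , πv , p , lp = execution-walk program 0 (λ _ e → e) refl (execution a) τu πu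
      in u , v , τu , πu , τv , πv ,
         dist p lp λ q → ≤-trans (≤-reflexive (sym τv)) (subst (λ t → τ v ≤ t + lenℕ q) τu (τ-walk q))

  -- Each line is sent to the place of its run on a canonical shortcut. Lines with the same place
  -- share both ends of the run and agree by `Cert-injective`, so the places are at least as many as
  -- the lines.
  few-pairs : ∀ H {β f : ℕ → ℕ} r → IsHopsetᶠ G H β f → f (length program) ≤ length program + r → β (length program) + r < budget →
              count ≤ ∣ H ∣ * (2 * (suc (length program + r) * suc (length program + r)))
  few-pairs H {β} {f} r hopset f≤ β< = decidable-stable (count ≤? _) λ too-many →
    ¬¬-decide-all ∣ H ∣ _ λ decide →
    let open Canonical H decide
        M = length program + r
        found : ∀ a → ∃[ x ] ∃[ y ] Located M x y × Cert π 0 (line a) x y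
        found a =
          let u , v , τu , πu , τv , πv , D = ends-of a
              g , h≤ , g≤ = approx⇒walk H (hopset (length program) D)
          in certified r (β (length program)) a τu πu τv πv g h≤ (≤-trans g≤ f≤) β<
        a , b , a<b , eq = Fin.pigeonhole (≰⇒> too-many) (λ a → code (proj₁ (proj₂ (proj₂ (found a)))))
        x≡ , y≡ = code-injective (proj₁ (proj₂ (proj₂ (found a)))) (proj₁ (proj₂ (proj₂ (found b)))) eq
        same = Cert-injective (subst₂ (Cert π 0 (line a)) x≡ y≡ (proj₂ (proj₂ (proj₂ (found a))))) (proj₂ (proj₂ (proj₂ (found b))))
    in <⇒≢ a<b (cong toℕ (line-injective same))

-- Part (2): sizes and parameters

∏-mono : ∀ {m} {a b : Vec ℕ m} → a ≼ b → ∏ a ≤ ∏ b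
∏-mono []      = ≤-refl
∏-mono (p ∷ a) = *-mono-≤ p (∏-mono a)

∏-++ : ∀ {m k} (a : Vec ℕ m) (b : Vec ℕ k) → ∏ (a Vec.++ b) ≡ ∏ a * ∏ b
∏-++ [] b      = sym (+-identityʳ (∏ b))
∏-++ (x ∷ a) b = trans (cong (x *_) (∏-++ a b)) (sym (*-assoc x (∏ a) (∏ b)))

∏-· : ∀ {m} r (a : Vec ℕ m) → ∏ (r · a) ≡ r ^ m * ∏ a
∏-· r []              = refl
∏-· {suc m} r (x ∷ a) = trans (cong (r * x *_) (∏-· r a)) (regroup r x (r ^ m) (∏ a))
  where
  regroup : ∀ r x q p → r * x * (q * p) ≡ r * q * (x * p)
  regroup = solve-∀

∏-replicate : ∀ m A → ∏ (Vec.replicate m A) ≡ A ^ m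
∏-replicate zero A    = refl
∏-replicate (suc m) A = cong (A *_) (∏-replicate m A)

replicate-mono : ∀ {m A B} → A ≤ B → Vec.replicate m A ≼ Vec.replicate m B
replicate-mono {zero}  _  = []
replicate-mono {suc m} le = le ∷ replicate-mono le

≼-trans : ∀ {m} {a b c : Vec ℕ m} → a ≼ b → b ≼ c → a ≼ c
≼-trans []      []      = []
≼-trans (p ∷ a) (q ∷ b) = ≤-trans p q ∷ ≼-trans a b

·-replicate : ∀ m r M → r · Vec.replicate m M ≡ Vec.replicate m (r * M)
·-replicate zero r M    = refl
·-replicate (suc m) r M = cong (r * M ∷_) (·-replicate m r M)

∥∥²-bound : ∀ {m M} {a : Vec ℕ m} → a ≼ Vec.replicate m M → ∥ a ∥² ≤ m * (M * M)
∥∥²-bound []      = z≤n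
∥∥²-bound (p ∷ a) = +-mono-≤ (*-mono-≤ p p) (∥∥²-bound a)

module BoundBounds (R : ℕ) (2≤R : 2 ≤ R) where

  suc≤square : suc R ≤ R * R
  suc≤square = ≤-trans (suc-≤-double (≤-trans (n≤1+n 1) 2≤R)) (*-monoˡ-≤ R 2≤R)

  module _ {m : ℕ} (s B : Vec ℕ m) (M : ℕ) (1≤M : 1 ≤ M) (s≼B : s ≼ B) (B≼M : B ≼ Vec.replicate m M) (m<R : suc m ≤ R) where

    head-bound : 1 + R * ∥ B ∥² ≤ R * R * (M * M)
    head-bound = begin
      1 + R * ∥ B ∥² ≤⟨ +-mono-≤ (*-mono-≤ (≤-trans (n≤1+n 1) 2≤R) (*-mono-≤ 1≤M 1≤M)) (*-monoʳ-≤ R (∥∥²-bound B≼M)) ⟩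
      R * (M * M) + R * (m * (M * M)) ≡⟨ regroup R m (M * M) ⟩
      R * suc m * (M * M) ≤⟨ *-monoˡ-≤ (M * M) (*-monoʳ-≤ R m<R) ⟩
      R * R * (M * M) ∎
      where
      open ≤-Reasoning
      regroup : ∀ R m q → R * q + R * (m * q) ≡ R * suc m * q
      regroup = solve-∀

    tail-bound : s ⊕ R · B ≼ (R * R) · B
    tail-bound = ≼-trans (⊕-mono-≼ s≼B ≼-refl) (scale B)
      where
      scale : ∀ {m} (B : Vec ℕ m) → B ⊕ R · B ≼ (R * R) · B
      scale []      = []
      scale (x ∷ B) = *-monoˡ-≤ x suc≤square ∷ scale B

    entries-bound : (1 ∷ s) ⊕ R · lifted B ≼ Vec.replicate (suc m) (R * R * (M * M))
    entries-bound = head-bound ∷ ≼-trans tail-bound (≼-trans (·-mono-≼ (R * R) B≼M)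
      (subst (_≼ Vec.replicate m (R * R * (M * M))) (sym (·-replicate m (R * R) M))
        (replicate-mono (*-monoʳ-≤ (R * R) (≤-trans (≤-reflexive (sym (*-identityʳ M))) (*-monoʳ-≤ M 1≤M))))))

    -- Only the register of squared norms pays the square of the largest entry; every other
    -- coordinate grows by at most R². Hence R rounds cost an exponent linear in D.
    product-bound : ∏ ((1 ∷ s) ⊕ R · lifted B) ≤ R * R * (M * M) * ((R * R) ^ m * ∏ B)
    product-bound = *-mono-≤ head-bound (≤-trans (∏-mono tail-bound) (≤-reflexive (∏-· (R * R) B)))

length-repeat : ∀ {A : Set} r (p : List A) → length (repeat r p) ≡ r * length p
length-repeat zero p    = refl
length-repeat (suc r) p = trans (length-++ p) (cong (_+_ (length p)) (length-repeat r p))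

-- Constants depending on the level alone; exponents are quadratic in D only in the leading term.
widthᶜ entryᶜ productᶜ sizeᶜ powers : ℕ → ℕ
widthᶜ zero      = 2
widthᶜ (suc j)   = suc (widthᶜ j + widthᶜ j)
entryᶜ zero      = 4
entryᶜ (suc j)   = 2 + 2 * entryᶜ j
productᶜ zero    = 6
productᶜ (suc j) = entryᶜ (suc j) + 4 * widthᶜ j + 2 * productᶜ j
sizeᶜ zero       = 1 + productᶜ 0
sizeᶜ (suc j)    = productᶜ (suc j) + sizeᶜ j
powers zero      = 1
powers (suc j)   = 2 ^ suc j + powers j

suc-powers : ∀ j → suc (powers j) ≡ 2 ^ suc j
suc-powers zero    = refl
suc-powers (suc j) = trans (sym (+-suc (2 ^ suc j) (powers j))) (cong (_+_ (2 ^ suc j)) (trans (suc-powers j) (sym (+-identityʳ _))))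

module Tower (D R : ℕ) .{{D≢0 : NonZero D}} (2≤R : 2 ≤ R) where

  R≢0 : NonZero R
  R≢0 = >-nonZero (≤-trans (n≤1+n 1) 2≤R)

  1≤R^ : ∀ e → 1 ≤ R ^ e
  1≤R^ e = m^n>0 R {{R≢0}} e

  1≤D : 1 ≤ D
  1≤D = >-nonZero⁻¹ D

  gadget : ℕ → Gadget
  gadget zero    = Base.base D R
  gadget (suc j) = Nest.nest R (gadget j)

  guarantee : ∀ j {V : Set} (τ : V → ℕ) (Fwd : V → V → Set) (tick : ∀ {u v} → Fwd u v → τ v ≡ suc (τ u)) →
              Robustness.Guarantee τ Fwd tick (gadget j)
  guarantee zero τ Fwd tick    = Guarantees.BaseGuarantee.base-guarantee τ Fwd tick D R
  guarantee (suc j) τ Fwd tick = Guarantees.NestGuarantee.nest-guarantee τ Fwd tick R (gadget j) (guarantee j τ Fwd tick)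

  realisation : ∀ j → Realisation (gadget j)
  -- Entries below R^D make the factors R² lost per coordinate negligible against the R^(D²)
  -- vectors.
  realisation zero    = BaseRealisation.base-realisation (R ^ D) D R (1≤R^ D)
  realisation (suc j) = NestRealisation.nest-realisation R (gadget j) (realisation j)

  width time budget count size : ℕ → ℕ
  width j  = Gadget.width (gadget j)
  time j   = length (Gadget.program (gadget j))
  budget j = Gadget.budget (gadget j)
  count j  = Realisation.count (realisation j)
  size j   = Realisation.size (realisation j)

  origin bound : ∀ j → Vec ℕ (width j)
  origin j = Realisation.origin (realisation j)
  bound j  = Realisation.bound (realisation j)

  budget≡ : ∀ j → budget j ≡ R ^ suc j
  budget≡ zero    = sym (*-identityʳ R)
  budget≡ (suc j) = cong (R *_) (budget≡ j)

  time≤ : ∀ j → time j ≤ (4 * D + 1 + 8 * j) * R ^ (2 + j)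
  time≤ zero = begin
    length (rest R ++ repeat R (pass D id)) ≡⟨ length-rest R _ ⟩
    R + length (repeat R (pass D id)) ≡⟨ cong (_+_ R) (trans (length-repeat R (pass D id)) (cong (R *_) (length-pass D))) ⟩
    R + R * (D * (suc R + suc R)) ≤⟨ +-mono-≤ (≤-trans (≤-reflexive (sym (*-identityʳ R))) (*-monoʳ-≤ R (1≤R^ 1)))
                                                   (*-monoʳ-≤ R (*-monoʳ-≤ D (+-mono-≤ sucR sucR))) ⟩
    R * R ^ 1 + R * (D * (2 * R + 2 * R)) ≡⟨ regroup R D ⟩
    (4 * D + 1 + 8 * 0) * R ^ 2 ∎
    where
    open Base D R
    open Idling _≟ˢ_
    open ≤-Reasoning
    sucR : suc R ≤ 2 * R
    sucR = suc-≤-double (≤-trans (n≤1+n 1) 2≤R)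
    length-pass : ∀ m {ι} → length (pass m ι) ≡ m * (suc R + suc R)
    length-pass zero        = refl
    length-pass (suc m) {ι} = trans (cong suc (trans (length-rest R _) (cong (_+_ R) (cong suc (trans (length-rest R _)
      (cong (_+_ R) (length-pass m))))))) (regroup R (m * (suc R + suc R)))
      where
      regroup : ∀ R x → suc (R + suc (R + x)) ≡ suc R + suc R + x
      regroup = solve-∀
    regroup : ∀ R D → R * (R * 1) + R * (D * (2 * R + 2 * R)) ≡ (4 * D + 1 + 8 * 0) * (R * (R * 1))
    regroup = solve-∀
  time≤ (suc j) = begin
    length (rest W ++ repeat R round) ≡⟨ length-rest W _ ⟩
    W + length (repeat R round) ≡⟨ cong (_+_ W) (trans (length-repeat R round) (cong (R *_) (length-round 0))) ⟩
    W + R * (suc (entrance 0 + n + W) + W) ≡⟨ cong (λ w → w + R * (suc (suc (suc 0 + w) + w + n + w) + w)) (cong (R *_) (budget≡ j)) ⟩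
    w + R * (suc (suc (suc 0 + w) + w + n + w) + w) ≤⟨ +-mono-≤ (m≤n*m w R {{R≢0}}) (*-monoʳ-≤ R inside) ⟩
    R * w + R * (7 * w + c * w) ≡⟨ regroup R w c ⟩
    (c + 8) * (R * w) ≡⟨ cong (_* (R * w)) (shift D j) ⟩
    (4 * D + 1 + 8 * suc j) * (R * w) ∎
    where
    open Nest R (gadget j)
    open Idling _≟ˢ_
    open ≤-Reasoning
    w c : ℕ
    w = R ^ (2 + j)
    c = 4 * D + 1 + 8 * j
    regroup : ∀ R w c → R * w + R * (7 * w + c * w) ≡ (c + 8) * (R * w)
    regroup = solve-∀
    shift : ∀ D j → 4 * D + 1 + 8 * j + 8 ≡ 4 * D + 1 + 8 * suc j
    shift = solve-∀
    inside : suc (suc (suc 0 + w) + w + n + w) + w ≤ 7 * w + c * w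
    inside = begin
      suc (suc (suc 0 + w) + w + n + w) + w ≡⟨ collect w n ⟩
      3 + 4 * w + n ≤⟨ +-mono-≤ (+-monoˡ-≤ (4 * w) (*-monoʳ-≤ 3 (1≤R^ (2 + j)))) (time≤ j) ⟩
      3 * w + 4 * w + c * w ≡⟨ cong (_+ c * w) (sum w) ⟩
      7 * w + c * w ∎
      where
      collect : ∀ w n → suc (suc (suc 0 + w) + w + n + w) + w ≡ 3 + 4 * w + n
      collect = solve-∀
      sum : ∀ w → 3 * w + 4 * w ≡ 7 * w
      sum = solve-∀

  ∏origin : ∀ j → ∏ (origin j) ≡ R ^ (D * D * 2 ^ j)
  ∏origin zero    = trans (+-identityʳ _) (trans (∏-replicate D (R ^ D)) (trans (^-*-assoc R D D) (cong (R ^_) (sym (*-identityʳ (D * D))))))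
  ∏origin (suc j) = trans (+-identityʳ _) (trans (∏-++ (origin j) (origin j)) (trans (cong₂ _*_ (∏origin j) (∏origin j))
    (trans (sym (^-distribˡ-+-* R (D * D * 2 ^ j) (D * D * 2 ^ j))) (cong (R ^_) (regroup (D * D) (2 ^ j))))))
    where
    regroup : ∀ d p → d * p + d * p ≡ d * (2 * p)
    regroup = solve-∀

  count≡ : ∀ j → count j ≡ R ^ (D * D * 2 ^ suc j)
  count≡ zero    = trans (cong₂ _*_ (∏origin zero) (trans (∏-replicate D (R ^ D)) (^-*-assoc R D D)))
    (trans (sym (^-distribˡ-+-* R (D * D * 1) (D * D))) (cong (R ^_) (regroup (D * D))))
    where
    regroup : ∀ d → d * 1 + d ≡ d * 2
    regroup = solve-∀
  count≡ (suc j) = trans (cong₂ _*_ (∏origin (suc j)) (count≡ j))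
    (trans (sym (^-distribˡ-+-* R (D * D * 2 ^ suc j) (D * D * 2 ^ suc j))) (cong (R ^_) (regroup (D * D) (2 ^ suc j))))
    where
    regroup : ∀ d p → d * p + d * p ≡ d * (2 * p)
    regroup = solve-∀

  width≤ : ∀ j → width j ≤ widthᶜ j * D
  width≤ zero    = ≤-trans (+-monoˡ-≤ D 1≤D) (≤-reflexive (cong (_+_ D) (sym (+-identityʳ D))))
  width≤ (suc j) = ≤-trans (+-mono-≤ 1≤D (+-mono-≤ (width≤ j) (width≤ j))) (≤-reflexive (regroup D (widthᶜ j)))
    where
    regroup : ∀ D w → D + (w * D + w * D) ≡ suc (w + w) * D
    regroup = solve-∀

  origin≼bound : ∀ j → origin j ≼ bound j
  origin≼bound zero    = ≼-⊕ʳ _ _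
  origin≼bound (suc j) = ≼-⊕ʳ _ _

  module BB = BoundBounds R 2≤R

  square-power : ∀ e → R * R * (R ^ e * R ^ e) ≡ R ^ (2 + (e + e))
  square-power e = trans (*-assoc R R _) (cong (λ x → R * (R * x)) (sym (^-distribˡ-+-* R e e)))

  R^-mono : ∀ {d e} → d ≤ e → R ^ d ≤ R ^ e
  R^-mono = ^-monoʳ-≤ R {{R≢0}}

  width-mono : ∀ j → width j ≤ width (suc j)
  width-mono j = ≤-trans (m≤m+n (width j) (width j)) (n≤1+n _)

  replicate-++ : ∀ m (M : ℕ) → Vec.replicate m M Vec.++ Vec.replicate m M ≡ Vec.replicate (m + m) M
  replicate-++ m M = go m
    where
    go : ∀ k → Vec.replicate k M Vec.++ Vec.replicate m M ≡ Vec.replicate (k + m) M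
    go zero    = refl
    go (suc k) = cong (M ∷_) (go k)

  two≤2D : 2 ≤ 2 * D
  two≤2D = *-monoʳ-≤ 2 1≤D

  entries≤ : ∀ j → width j ≤ R → bound j ≼ Vec.replicate (width j) (R ^ (entryᶜ j * D))
  entries≤ zero w≤ = ≼-trans (BB.entries-bound (Vec.replicate D (R ^ D)) (Vec.replicate D (R ^ D)) (R ^ D) (1≤R^ D) ≼-refl ≼-refl w≤)
    (replicate-mono (≤-trans (≤-reflexive (square-power D)) (R^-mono (≤-trans (+-monoˡ-≤ (D + D) two≤2D) (≤-reflexive (regroup D))))))
    where
    regroup : ∀ D → 2 * D + (D + D) ≡ 4 * D
    regroup = solve-∀
  entries≤ (suc j) w≤ = ≼-trans (BB.entries-bound (origin j Vec.++ origin j) (bound j Vec.++ bound j) (R ^ (entryᶜ j * D)) (1≤R^ (entryᶜ j * D))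
      (++-mono-≼ (origin≼bound j) (origin≼bound j))
      (subst (bound j Vec.++ bound j ≼_) (replicate-++ (width j) _) (++-mono-≼ ih ih)) w≤)
    (replicate-mono (≤-trans (≤-reflexive (square-power (entryᶜ j * D))) (R^-mono (≤-trans (+-monoˡ-≤ _ two≤2D) (≤-reflexive (regroup (entryᶜ j) D))))))
    where
    ih = entries≤ j (≤-trans (width-mono j) w≤)
    regroup : ∀ e D → 2 * D + (e * D + e * D) ≡ (2 + 2 * e) * D
    regroup = solve-∀

  square^ : ∀ m → (R * R) ^ m ≡ R ^ (2 * m)
  square^ m = trans (cong (_^ m) (cong (R *_) (sym (*-identityʳ R)))) (^-*-assoc R 2 m)

  product≤ : ∀ j → width j ≤ R → ∏ (bound j) ≤ R ^ (D * D * 2 ^ j + productᶜ j * D)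
  product≤ zero w≤ = begin
    ∏ (bound 0) ≤⟨ BB.product-bound (Vec.replicate D (R ^ D)) (Vec.replicate D (R ^ D)) (R ^ D) (1≤R^ D) ≼-refl ≼-refl w≤ ⟩
    R * R * (R ^ D * R ^ D) * ((R * R) ^ D * ∏ (Vec.replicate D (R ^ D)))
      ≡⟨ cong₂ _*_ (square-power D) (cong₂ _*_ (square^ D) (trans (∏-replicate D (R ^ D)) (^-*-assoc R D D))) ⟩
    R ^ (2 + (D + D)) * (R ^ (2 * D) * R ^ (D * D)) ≡⟨ trans (cong (R ^ (2 + (D + D)) *_) (sym (^-distribˡ-+-* R (2 * D) (D * D)))) (sym (^-distribˡ-+-* R (2 + (D + D)) _)) ⟩
    R ^ (2 + (D + D) + (2 * D + D * D)) ≤⟨ R^-mono (≤-trans (+-monoˡ-≤ _ (+-monoˡ-≤ (D + D) two≤2D)) (≤-reflexive (regroup D))) ⟩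
    R ^ (D * D * 1 + 6 * D) ∎
    where
    open ≤-Reasoning
    regroup : ∀ D → 2 * D + (D + D) + (2 * D + D * D) ≡ D * D * 1 + 6 * D
    regroup = solve-∀
  product≤ (suc j) w≤ = begin
    ∏ (bound (suc j))
      ≤⟨ BB.product-bound (origin j Vec.++ origin j) (bound j Vec.++ bound j) (R ^ (entryᶜ j * D)) (1≤R^ (entryᶜ j * D))
           (++-mono-≼ (origin≼bound j) (origin≼bound j))
           (subst (bound j Vec.++ bound j ≼_) (replicate-++ (width j) _) (++-mono-≼ entries entries)) w≤ ⟩
    R * R * (R ^ (e * D) * R ^ (e * D)) * ((R * R) ^ (width j + width j) * ∏ (bound j Vec.++ bound j))
      ≤⟨ *-mono-≤ (≤-reflexive (square-power (e * D))) (*-mono-≤ (≤-trans (≤-reflexive (square^ (width j + width j)))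
           (R^-mono (*-monoʳ-≤ 2 (+-mono-≤ (width≤ j) (width≤ j)))))
           (≤-trans (≤-reflexive (∏-++ (bound j) (bound j))) (*-mono-≤ ih ih))) ⟩
    R ^ (2 + (e * D + e * D)) * (R ^ (2 * (w * D + w * D)) * (R ^ x * R ^ x))
      ≡⟨ trans (cong (R ^ (2 + (e * D + e * D)) *_) (trans (cong (R ^ (2 * (w * D + w * D)) *_) (sym (^-distribˡ-+-* R x x)))
           (sym (^-distribˡ-+-* R (2 * (w * D + w * D)) (x + x))))) (sym (^-distribˡ-+-* R (2 + (e * D + e * D)) _)) ⟩
    R ^ (2 + (e * D + e * D) + (2 * (w * D + w * D) + (x + x)))
      ≤⟨ R^-mono (≤-trans (+-monoˡ-≤ _ (+-monoˡ-≤ _ two≤2D)) (≤-reflexive (regroup D e w (2 ^ j) (productᶜ j)))) ⟩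
    R ^ (D * D * 2 ^ suc j + productᶜ (suc j) * D) ∎
    where
    open ≤-Reasoning
    e = entryᶜ j
    w = widthᶜ j
    x = D * D * 2 ^ j + productᶜ j * D
    w≤′ = ≤-trans (width-mono j) w≤
    entries = entries≤ j w≤′
    ih = product≤ j w≤′
    regroup : ∀ D e w q c → 2 * D + (e * D + e * D) + (2 * (w * D + w * D) + ((D * D * q + c * D) + (D * D * q + c * D))) ≡
              D * D * (2 * q) + ((2 + 2 * e) + 4 * w + 2 * c) * D
    regroup = solve-∀

  size≤ : ∀ j → width j ≤ R → size j ≤ R ^ (D * D * powers j + sizeᶜ j * D)
  size≤ zero w≤ = begin
    R ^ D * ∏ (bound 0) ≤⟨ *-monoʳ-≤ (R ^ D) (product≤ 0 w≤) ⟩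
    R ^ D * R ^ (D * D * 1 + 6 * D) ≡⟨ sym (^-distribˡ-+-* R D _) ⟩
    R ^ (D + (D * D * 1 + 6 * D)) ≡⟨ cong (R ^_) (regroup D) ⟩
    R ^ (D * D * 1 + 7 * D) ∎
    where
    open ≤-Reasoning
    regroup : ∀ D → D + (D * D * 1 + 6 * D) ≡ D * D * 1 + 7 * D
    regroup = solve-∀
  size≤ (suc j) w≤ = begin
    ∏ (bound (suc j)) * size j ≤⟨ *-mono-≤ (product≤ (suc j) w≤) (size≤ j (≤-trans (width-mono j) w≤)) ⟩
    R ^ (D * D * 2 ^ suc j + productᶜ (suc j) * D) * R ^ (D * D * powers j + sizeᶜ j * D) ≡⟨ sym (^-distribˡ-+-* R (D * D * 2 ^ suc j + productᶜ (suc j) * D) _) ⟩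
    R ^ (D * D * 2 ^ suc j + productᶜ (suc j) * D + (D * D * powers j + sizeᶜ j * D)) ≡⟨ cong (R ^_) (regroup (D * D) D (2 ^ suc j) (productᶜ (suc j)) (powers j) (sizeᶜ j)) ⟩
    R ^ (D * D * (2 ^ suc j + powers j) + (productᶜ (suc j) + sizeᶜ j) * D) ∎
    where
    open ≤-Reasoning
    regroup : ∀ d D p c q s → d * p + c * D + (d * q + s * D) ≡ d * (p + q) + (c + s) * D
    regroup = solve-∀

-- Growth estimates, exponents and the choice of parameters.

n<2^n : ∀ n → n < 2 ^ n
n<2^n zero    = s≤s z≤n
n<2^n (suc n) = ≤-trans (s≤s (n<2^n n)) (≤-trans (+-monoˡ-≤ (2 ^ n) (m^n>0 2 n)) (≤-reflexive (cong (_+_ (2 ^ n)) (sym (+-identityʳ (2 ^ n))))))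

-- With q = ⌊ρ/(a+1)⌋, both ρ < (a+1)(q+1) and q+1 ≤ 2^q.
polynomial≤exponential : ∀ c a → ∃[ ρ₀ ] (∀ ρ → ρ₀ ≤ ρ → c * ρ ^ a ≤ 2 ^ ρ)
polynomial≤exponential c a = c * suc a ^ suc a , λ ρ large → *-cancelˡ-≤ (suc a ^ suc a) {{m^n≢0 (suc a) (suc a)}} (begin
    suc a ^ suc a * (c * ρ ^ a) ≡⟨ regroup (suc a ^ suc a) c (ρ ^ a) ⟩
    c * suc a ^ suc a * ρ ^ a ≤⟨ *-monoˡ-≤ (ρ ^ a) large ⟩
    ρ ^ suc a ≤⟨ ^-monoˡ-≤ (suc a) (ρ≤ ρ) ⟩
    (suc a * suc (ρ ℕ./ suc a)) ^ suc a ≡⟨ ^-distribˡ-* (suc a) (suc (ρ ℕ./ suc a)) (suc a) ⟩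
    suc a ^ suc a * suc (ρ ℕ./ suc a) ^ suc a ≤⟨ *-monoʳ-≤ (suc a ^ suc a) (^-monoˡ-≤ (suc a) (n<2^n (ρ ℕ./ suc a))) ⟩
    suc a ^ suc a * (2 ^ (ρ ℕ./ suc a)) ^ suc a ≡⟨ cong (suc a ^ suc a *_) (^-*-assoc 2 (ρ ℕ./ suc a) (suc a)) ⟩
    suc a ^ suc a * 2 ^ (ρ ℕ./ suc a * suc a) ≤⟨ *-monoʳ-≤ (suc a ^ suc a) (^-monoʳ-≤ 2 (m/n*n≤m ρ (suc a))) ⟩
    suc a ^ suc a * 2 ^ ρ ∎)
  where
  open ≤-Reasoning
  regroup : ∀ e c p → e * (c * p) ≡ c * e * p
  regroup = solve-∀
  ρ≤ : ∀ ρ → ρ ≤ suc a * suc (ρ ℕ./ suc a)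
  ρ≤ ρ = begin
    ρ ≡⟨ m≡m%n+[m/n]*n ρ (suc a) ⟩
    ρ ℕ.% suc a + ρ ℕ./ suc a * suc a ≤⟨ +-monoˡ-≤ _ (<⇒≤ (m%n<n ρ (suc a))) ⟩
    suc a + ρ ℕ./ suc a * suc a ≡⟨ *-comm (suc (ρ ℕ./ suc a)) (suc a) ⟩
    suc a * suc (ρ ℕ./ suc a) ∎

≤·⟨⟩-elim : ∀ {x c d} e p q → ℚᵘ.↥ e ≡ + p → ℚᵘ.↧ₙ e ≡ q → x ≤ c ·⟨ d ^ e ⟩ → x ^ q ≤ c ^ q * d ^ p
≤·⟨⟩-elim (ℚᵘ.mkℚᵘ (+ p) q) .p .(suc q) refl refl le = le

⟨⟩≤-intro : ∀ {n y} e p q → ℚᵘ.↥ e ≡ + p → ℚᵘ.↧ₙ e ≡ q → n ^ p ≤ y ^ q → ⟨ n ^ e ⟩≤ y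
⟨⟩≤-intro (ℚᵘ.mkℚᵘ (+ p) q) .p .(suc q) refl refl le = le

+⊖ : ∀ {a b c} → a ≡ c + b → a ℤ.⊖ b ≡ + c
+⊖ {b = b} {c} refl = trans (ℤ.⊖-≥ (m≤n+m b c)) (cong (λ x → + x) (m+n∸n≡m c b))

one-minus : ∀ j → ℚᵘ.↥ (ℚᵘ.1ℚᵘ ℚᵘ.- + 1 ℚᵘ./ suc j) ≡ + j × ℚᵘ.↧ₙ (ℚᵘ.1ℚᵘ ℚᵘ.- + 1 ℚᵘ./ suc j) ≡ suc j
one-minus j = trans (cong (ℤ._⊖ 1) (cong suc (+-identityʳ j))) (+⊖ (+-comm 1 j)) , cong suc (+-identityʳ j)

-- The unreduced fraction is computed exactly, since comparison with a power inspects numerator and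
-- denominator as they stand.
size-exponent : ∀ d .{{_ : NonZero d}} m → let e = (ℚᵘ.1ℚᵘ ℚᵘ.+ + 1 ℚᵘ./ d) ℚᵘ.- ℚᵘ.mkℚᵘ (+ 1) m in
                ℚᵘ.↥ e ≡ + (suc d * m + 1) × ℚᵘ.↧ₙ e ≡ d * suc m
size-exponent (suc d) m = +⊖ {a = suc (m + (d + 0 * suc d + 1) * suc m)} {b = suc (d + 0 * suc d + 0 * suc (d + 0 * suc d))} (value d m) , cong (λ d → suc d * suc m) (+-identityʳ d)
  where
  value : ∀ d m → suc (m + (d + 0 * suc d + 1) * suc m) ≡ (suc (suc d) * m + 1) + suc (d + 0 * suc d + 0 * suc (d + 0 * suc d))
  value = solve-∀

-- For k = j + 1 and t ≤ c R^(k+1), the k-th power of t^(1-1/k) is of order R^(k²-1), one factor R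
-- short of (R^k)^k. The logarithm of n is linear in ρ, so its powers vanish against R = 2^ρ. The
-- factor 2 leaves room to add hopbound and error.
sublinear-bound : ∀ j v c g → Sublinear (suc j) g →
  ∃[ ρ₀ ] ∃[ n₀ ] (∀ n ρ t → n₀ ≤ n → ρ₀ ≤ ρ → n < 2 ^ (suc ρ * v) → t ≤ c * (2 ^ ρ) ^ (2 + j) → 2 * g n t < (2 ^ ρ) ^ suc j)
sublinear-bound j v c g (C , a , n₀ , bound) = 1 + (E + ρ₁) , n₀ , λ n ρ t n≥ ρ≥ n< t≤ →
    *-cancelˡ-< 2 _ _ (assemble n ρ t
      (root n ρ t (≤-trans (m≤m+n E ρ₁) (≤-trans (n≤1+n _) ρ≥)) t≤ (bound n n≥ t))
      (logarithm n ρ (≤-trans (m≤m+n 1 _) ρ≥) (≤-trans (m≤n+m ρ₁ E) (≤-trans (n≤1+n _) ρ≥)) n<))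
  where
  open ≤-Reasoning
  k E c′ ρ₁ : ℕ
  k = suc j
  E = (4 * (C * k)) ^ k * c ^ j
  c′ = 4 * C * (2 * v) ^ a
  ρ₁ = proj₁ (polynomial≤exponential c′ a)
  log^ : ℕ → ℕ
  log^ n = C * ⌈log₂ n ⌉ ^ a
  root : ∀ n ρ t → E ≤ ρ → t ≤ c * (2 ^ ρ) ^ (2 + j) → g n t ∸ log^ n ≤ C * k ·⟨ t ^ ℚᵘ.1ℚᵘ ℚᵘ.- + 1 ℚᵘ./ k ⟩ →
         4 * (g n t ∸ log^ n) < (2 ^ ρ) ^ k
  root n ρ t E≤ t≤ small = ≰⇒> λ large → <-irrefl refl (begin-strict
    R * R ^ ((2 + j) * j) ≡⟨ cong (R ^_) (square j) ⟩
    R ^ (k * k) ≡⟨ ^-*-assoc R k k ⟨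
    (R ^ k) ^ k ≤⟨ ^-monoˡ-≤ k large ⟩
    (4 * x) ^ k ≡⟨ ^-distribˡ-* 4 x k ⟩
    4 ^ k * x ^ k ≤⟨ *-monoʳ-≤ (4 ^ k) (≤·⟨⟩-elim {x} {C * k} {t} (ℚᵘ.1ℚᵘ ℚᵘ.- + 1 ℚᵘ./ k) j k (proj₁ (one-minus j)) (proj₂ (one-minus j)) small) ⟩
    4 ^ k * ((C * k) ^ k * t ^ j) ≤⟨ *-monoʳ-≤ (4 ^ k) (*-monoʳ-≤ ((C * k) ^ k) (^-monoˡ-≤ j t≤)) ⟩
    4 ^ k * ((C * k) ^ k * (c * R ^ (2 + j)) ^ j) ≡⟨ *-assoc (4 ^ k) _ _ ⟨
    4 ^ k * (C * k) ^ k * (c * R ^ (2 + j)) ^ j ≡⟨ cong₂ _*_ (^-distribˡ-* 4 (C * k) k) (sym (^-distribˡ-* c (R ^ (2 + j)) j)) ⟨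
    (4 * (C * k)) ^ k * (c ^ j * (R ^ (2 + j)) ^ j) ≡⟨ cong (λ y → (4 * (C * k)) ^ k * (c ^ j * y)) (^-*-assoc R (2 + j) j) ⟩
    (4 * (C * k)) ^ k * (c ^ j * R ^ ((2 + j) * j)) ≡⟨ *-assoc ((4 * (C * k)) ^ k) (c ^ j) _ ⟨
    E * R ^ ((2 + j) * j) <⟨ *-monoˡ-< (R ^ ((2 + j) * j)) {{m^n≢0 R ((2 + j) * j) {{R≢0}}}} (≤-<-trans E≤ (n<2^n ρ)) ⟩
    R * R ^ ((2 + j) * j) ∎)
    where
    R x : ℕ
    R = 2 ^ ρ
    x = g n t ∸ log^ n
    R≢0 : NonZero R
    R≢0 = m^n≢0 2 ρ
    square : ∀ j → suc ((2 + j) * j) ≡ suc j * suc j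
    square = solve-∀
  logarithm : ∀ n ρ → 1 ≤ ρ → ρ₁ ≤ ρ → n < 2 ^ (suc ρ * v) → 4 * log^ n ≤ 2 ^ ρ
  logarithm n ρ 1≤ρ ρ₁≤ n< = begin
    4 * (C * ⌈log₂ n ⌉ ^ a) ≡⟨ *-assoc 4 C _ ⟨
    4 * C * ⌈log₂ n ⌉ ^ a ≤⟨ *-monoʳ-≤ (4 * C) (^-monoˡ-≤ a (≤-trans (⌈log₂⌉-mono-≤ (<⇒≤ n<)) (≤-reflexive (⌈log₂2^n⌉≡n (suc ρ * v))))) ⟩
    4 * C * (suc ρ * v) ^ a ≤⟨ *-monoʳ-≤ (4 * C) (^-monoˡ-≤ a (*-monoˡ-≤ v (suc-≤-double 1≤ρ))) ⟩
    4 * C * (2 * ρ * v) ^ a ≡⟨ cong (λ y → 4 * C * y ^ a) (regroup ρ v) ⟩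
    4 * C * (2 * v * ρ) ^ a ≡⟨ cong (4 * C *_) (^-distribˡ-* (2 * v) ρ a) ⟩
    4 * C * ((2 * v) ^ a * ρ ^ a) ≡⟨ *-assoc (4 * C) _ _ ⟨
    c′ * ρ ^ a ≤⟨ proj₂ (polynomial≤exponential c′ a) ρ ρ₁≤ ⟩
    2 ^ ρ ∎
    where
    regroup : ∀ ρ v → 2 * ρ * v ≡ 2 * v * ρ
    regroup = solve-∀
  assemble : ∀ n ρ t → 4 * (g n t ∸ log^ n) < (2 ^ ρ) ^ k → 4 * log^ n ≤ 2 ^ ρ → 2 * (2 * g n t) < 2 * (2 ^ ρ) ^ k
  assemble n ρ t small log≤ = begin-strict
    2 * (2 * g n t) ≡⟨ *-assoc 2 2 (g n t) ⟨
    4 * g n t ≤⟨ *-monoʳ-≤ 4 (≤-trans (m≤n+m∸n (g n t) (log^ n)) (≤-reflexive (+-comm (log^ n) _))) ⟩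
    4 * (g n t ∸ log^ n + log^ n) ≡⟨ *-distribˡ-+ 4 (g n t ∸ log^ n) (log^ n) ⟩
    4 * (g n t ∸ log^ n) + 4 * log^ n <⟨ +-mono-<-≤ small (≤-trans log≤ (m≤m*n (2 ^ ρ) ((2 ^ ρ) ^ j) {{m^n≢0 (2 ^ ρ) j {{m^n≢0 2 ρ}}}})) ⟩
    (2 ^ ρ) ^ k + (2 ^ ρ) ^ k ≡⟨ cong (_+_ ((2 ^ ρ) ^ k)) (sym (+-identityʳ _)) ⟩
    2 * (2 ^ ρ) ^ k ∎

-- To leading order there are R^(D²K) vertices and R^(D²(K+1)) lines; a large D absorbs the rest.
exponents : ∀ K C s m D p → 1 ≤ K → 1 ≤ D → p + K ≡ suc K * suc m → (C * suc K + s) * suc m ≡ D →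
            (D * D * K + C * D) * p + s * (K * suc m) ≤ D * D * suc K * (K * suc m)
exponents K C s m D p 1≤K 1≤D p≡ D≡ = +-cancelʳ-≤ (D * D * (K * K)) _ _ (begin
  (D * D * K + C * D) * p + s * (K * suc m) + D * D * (K * K) ≡⟨ regroup D K C p s (suc m) ⟩
  D * D * K * (p + K) + (C * D * p + s * (K * suc m)) ≤⟨ +-mono-≤ (≤-reflexive (trans (cong (D * D * K *_) p≡) (regroup′ D K (suc m)))) lower ⟩
  D * D * suc K * (K * suc m) + D * D * (K * K) ∎)
  where
  open ≤-Reasoning
  regroup : ∀ D K C p s m → (D * D * K + C * D) * p + s * (K * m) + D * D * (K * K) ≡ D * D * K * (p + K) + (C * D * p + s * (K * m))
  regroup = solve-∀
  regroup′ : ∀ D K m → D * D * K * (suc K * m) ≡ D * D * suc K * (K * m)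
  regroup′ = solve-∀
  p≤ : p ≤ suc K * suc m
  p≤ = ≤-trans (m≤m+n p K) (≤-reflexive p≡)
  lower : C * D * p + s * (K * suc m) ≤ D * D * (K * K)
  lower = begin
    C * D * p + s * (K * suc m) ≤⟨ +-mono-≤ (*-monoʳ-≤ (C * D) p≤) (*-monoʳ-≤ s (m≤n*m (K * suc m) D {{>-nonZero 1≤D}})) ⟩
    C * D * (suc K * suc m) + s * (D * (K * suc m)) ≤⟨ +-monoˡ-≤ _ (m≤m*n (C * D * (suc K * suc m)) K {{>-nonZero 1≤K}}) ⟩
    C * D * (suc K * suc m) * K + s * (D * (K * suc m)) ≡⟨ regroup″ C D K s (suc m) ⟩
    D * K * ((C * suc K + s) * suc m) ≡⟨ cong (D * K *_) D≡ ⟩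
    D * K * D ≤⟨ m≤m*n (D * K * D) K {{>-nonZero 1≤K}} ⟩
    D * K * D * K ≡⟨ regroup₃ D K ⟩
    D * D * (K * K) ∎
    where
    regroup″ : ∀ C D K s m → C * D * (suc K * m) * K + s * (D * (K * m)) ≡ D * K * ((C * suc K + s) * m)
    regroup″ = solve-∀
    regroup₃ : ∀ D K → D * K * D * K ≡ D * D * (K * K)
    regroup₃ = solve-∀

module Parameters (j m : ℕ) where

  -- `R ^ s` covers the loss from locating two vertices on a shortcut, `R ^ v` the number of
  -- vertices. `C` gathers what is linear in `D` in the exponent `suc v`, `D` is what `exponents`
  -- asks for, and `ρ₀` makes R exceed the remaining constants.
  s C D c v ρ₀ : ℕ
  s = 7 + 2 * j
  C = sizeᶜ j + (4 + j)
  D = (C * suc (powers j) + s) * suc m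
  c = 4 * D + 1 + 8 * j
  v = 3 + j + (D * D * powers j + sizeᶜ j * D)
  ρ₀ = 1 + (v + (suc c + widthᶜ j * D))

  1≤D : 1 ≤ D
  1≤D = *-mono-≤ (≤-trans (s≤s z≤n) (m≤n+m s (C * suc (powers j)))) (s≤s (z≤n {m}))

  1≤powers : ∀ j → 1 ≤ powers j
  1≤powers zero    = ≤-refl
  1≤powers (suc j) = ≤-trans (1≤powers j) (m≤n+m _ (2 ^ suc j))

  suc-v≤ : suc v ≤ D * D * powers j + C * D
  suc-v≤ = begin
    4 + j + (D * D * powers j + sizeᶜ j * D) ≤⟨ +-monoˡ-≤ _ (m≤m*n (4 + j) D {{>-nonZero 1≤D}}) ⟩
    (4 + j) * D + (D * D * powers j + sizeᶜ j * D) ≡⟨ regroup (4 + j) D (D * D * powers j) (sizeᶜ j) ⟩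
    D * D * powers j + C * D ∎
    where
    open ≤-Reasoning
    regroup : ∀ a D q c → a * D + (q + c * D) ≡ q + (c + a) * D
    regroup = solve-∀

  private instance
    D≢0 : NonZero D
    D≢0 = >-nonZero 1≤D

  p : ℕ
  p = suc (powers j) * m + 1

  module _ (ρ : ℕ) (ρ≥ : ρ₀ ≤ ρ) where
    R : ℕ
    R = 2 ^ ρ

    R≥ : ∀ {x} → x ≤ ρ₀ → x ≤ R
    R≥ x≤ = ≤-trans x≤ (≤-trans ρ≥ (<⇒≤ (n<2^n ρ)))

    2≤R : 2 ≤ R
    2≤R = R≥ (s≤s (≤-trans (s≤s z≤n) (m≤n+m (suc c + widthᶜ j * D) v)))

    suc-c≤R : suc c ≤ R
    suc-c≤R = R≥ (≤-trans (≤-trans (m≤m+n (suc c) (widthᶜ j * D)) (m≤n+m _ v)) (n≤1+n _))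

    module Tw = Tower D R 2≤R

    width≤R : Tw.width j ≤ R
    width≤R = ≤-trans (Tw.width≤ j) (R≥ (≤-trans (≤-trans (m≤n+m (widthᶜ j * D) (suc c)) (m≤n+m _ v)) (n≤1+n _)))

    instance
      R≢0 : NonZero R
      R≢0 = Tw.R≢0

    room : ∀ x → x ≤ R ^ (2 + j) → Tw.time j + x ≤ R ^ (3 + j)
    room x x≤ = begin
      Tw.time j + x ≤⟨ +-mono-≤ (Tw.time≤ j) x≤ ⟩
      c * R ^ (2 + j) + R ^ (2 + j) ≡⟨ +-comm (c * R ^ (2 + j)) _ ⟩
      suc c * R ^ (2 + j) ≤⟨ *-monoˡ-≤ (R ^ (2 + j)) suc-c≤R ⟩
      R ^ (3 + j) ∎
      where open ≤-Reasoning

    fits : ∀ n → 2 ^ (ρ * v) ≤ n → suc (Tw.time j) * Tw.size j ≤ n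
    fits n le = begin
      suc (Tw.time j) * Tw.size j ≤⟨ *-mono-≤ (≤-trans (≤-reflexive (+-comm 1 (Tw.time j))) (room 1 (Tw.1≤R^ (2 + j)))) (Tw.size≤ j width≤R) ⟩
      R ^ (3 + j) * R ^ (D * D * powers j + sizeᶜ j * D) ≡⟨ ^-distribˡ-+-* R (3 + j) _ ⟨
      R ^ v ≡⟨ ^-*-assoc 2 ρ v ⟩
      2 ^ (ρ * v) ≤⟨ le ⟩
      n ∎
      where open ≤-Reasoning

    -- R runs through powers of two, so n is matched only up to a factor 2^v; this is at most R
    -- because ρ ≥ v.
    n≤ : ∀ n → n < 2 ^ (suc ρ * v) → n ≤ R ^ suc v
    n≤ n lt = begin
      n ≤⟨ <⇒≤ lt ⟩
      2 ^ (suc ρ * v) ≡⟨ ^-distribˡ-+-* 2 v (ρ * v) ⟩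
      2 ^ v * 2 ^ (ρ * v) ≤⟨ *-mono-≤ (^-monoʳ-≤ 2 (≤-trans (≤-trans (m≤m+n v _) (n≤1+n _)) ρ≥)) (≤-reflexive (sym (^-*-assoc 2 ρ v))) ⟩
      R ^ suc v ∎
      where open ≤-Reasoning

    pairs-bound : ∀ n h r → n < 2 ^ (suc ρ * v) → r < R ^ suc j →
                  Tw.count j ≤ h * (2 * (suc (Tw.time j + r) * suc (Tw.time j + r))) → n ^ p ≤ h ^ (powers j * suc m)
    pairs-bound n h r n< r< count≤ = *-cancelʳ-≤ (n ^ p) (h ^ q) (R ^ (s * q)) {{m^n≢0 R (s * q)}} (begin
      n ^ p * R ^ (s * q) ≤⟨ *-monoˡ-≤ (R ^ (s * q)) (^-monoˡ-≤ p (n≤ n n<)) ⟩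
      (R ^ suc v) ^ p * R ^ (s * q) ≡⟨ cong (_* R ^ (s * q)) (^-*-assoc R (suc v) p) ⟩
      R ^ (suc v * p) * R ^ (s * q) ≡⟨ ^-distribˡ-+-* R (suc v * p) (s * q) ⟨
      R ^ (suc v * p + s * q) ≤⟨ ^-monoʳ-≤ R (≤-trans (+-monoˡ-≤ (s * q) (*-monoˡ-≤ p suc-v≤))
                                                            (exponents (powers j) C s m D p (1≤powers j) 1≤D (p+K (powers j) m) refl)) ⟩
      R ^ (D * D * suc (powers j) * q) ≡⟨ ^-*-assoc R (D * D * suc (powers j)) q ⟨
      (R ^ (D * D * suc (powers j))) ^ q ≤⟨ ^-monoˡ-≤ q lines≤ ⟩
      (h * R ^ s) ^ q ≡⟨ ^-distribˡ-* h (R ^ s) q ⟩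
      h ^ q * (R ^ s) ^ q ≡⟨ cong (h ^ q *_) (^-*-assoc R s q) ⟩
      h ^ q * R ^ (s * q) ∎)
      where
      open ≤-Reasoning
      q : ℕ
      q = powers j * suc m
      p+K : ∀ K m → suc K * m + 1 + K ≡ suc K * suc m
      p+K = solve-∀
      M≤ : suc (Tw.time j + r) ≤ R ^ (3 + j)
      M≤ = ≤-trans (≤-reflexive (sym (+-suc (Tw.time j) r))) (room (suc r) (≤-trans r< (^-monoʳ-≤ R (n≤1+n (suc j)))))
      lines≤ : R ^ (D * D * suc (powers j)) ≤ h * R ^ s
      lines≤ = begin
        R ^ (D * D * suc (powers j)) ≡⟨ cong (λ x → R ^ (D * D * x)) (suc-powers j) ⟩
        R ^ (D * D * 2 ^ suc j) ≡⟨ Tw.count≡ j ⟨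
        Tw.count j ≤⟨ count≤ ⟩
        h * (2 * (suc (Tw.time j + r) * suc (Tw.time j + r))) ≤⟨ *-monoʳ-≤ h (*-mono-≤ 2≤R (*-mono-≤ M≤ M≤)) ⟩
        h * (R * (R ^ (3 + j) * R ^ (3 + j))) ≡⟨ cong (λ x → h * (R * x)) (^-distribˡ-+-* R (3 + j) (3 + j)) ⟨
        h * R ^ suc ((3 + j) + (3 + j)) ≡⟨ cong (λ e → h * R ^ e) (double j) ⟩
        h * R ^ s ∎
        where
        double : ∀ j → suc ((3 + j) + (3 + j)) ≡ 7 + 2 * j
        double = solve-∀

-- With K = `powers j`, the exponent (K + 1)m + 1 over K(m + 1) is 1 + 1/K - 1/(m + 1). The
-- threshold N depends on m through `D`, so one m cannot serve the whole sequence.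
sublinear-at-level : ∀ j (f β r : ℕ → ℕ → ℕ) → (∀ n d → f n d ≤ d + r n d) → Sublinear (suc j) r → Sublinear (suc j) β →
  ∀ m → ∃[ N ] (∀ n → N ≤ n → ∃[ G ] Unweighted {n} G × (∀ H → IsHopsetᶠ G H (β n) (f n) →
    n ^ (suc (powers j) * m + 1) ≤ ∣ H ∣ ^ (powers j * suc m)))
sublinear-at-level j f β r f≤ sub-r sub-β m = 2 ^ (ρ₁ * v) + (n-r + n-β) , graph
  where
  open Parameters j m
  bound-r = sublinear-bound j v c r sub-r
  bound-β = sublinear-bound j v c β sub-β
  ρ-r = proj₁ bound-r
  n-r = proj₁ (proj₂ bound-r)
  ρ-β = proj₁ bound-β
  n-β = proj₁ (proj₂ bound-β)
  ρ₁ : ℕ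
  ρ₁ = ρ₀ + (ρ-r + ρ-β)
  scale : ∀ n → 2 ^ (ρ₁ * v) ≤ n → ∃[ ρ ] ρ₁ ≤ ρ × 2 ^ (ρ * v) ≤ n × n < 2 ^ (suc ρ * v)
  scale n n≥ =
    let ρ , lo , hi = bracket (λ ρ → 2 ^ (ρ * v)) (λ ρ → ^-monoʳ-< 2 (s≤s (s≤s z≤n)) (*-monoˡ-< v (n<1+n ρ))) n
                        (≤-trans (m^n>0 2 (ρ₁ * v)) n≥)
    in ρ , ≮⇒≥ (λ ρ<ρ₁ → <-irrefl refl (<-≤-trans hi (≤-trans (^-monoʳ-≤ 2 (*-monoˡ-≤ v ρ<ρ₁)) n≥))) , lo , hi
  graph : ∀ n → 2 ^ (ρ₁ * v) + (n-r + n-β) ≤ n → ∃[ G ] Unweighted {n} G × (∀ H → IsHopsetᶠ G H (β n) (f n) →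
            n ^ (suc (powers j) * m + 1) ≤ ∣ H ∣ ^ (powers j * suc m))
  graph n n≥ = LG.G , (λ _ → refl) , λ H hopset → pairs-bound ρ ρ₀≤ n ∣ H ∣ (r n t) hi
      (*-cancelˡ-< 2 _ _ (<-≤-trans r< (m≤n*m _ 2)))
      (LG.few-pairs H {β n} {f n} (r n t) hopset (f≤ n t) budget)
    where
    scaled = scale n (≤-trans (m≤m+n _ _) n≥)
    ρ = proj₁ scaled
    lo = proj₁ (proj₂ (proj₂ scaled))
    hi = proj₂ (proj₂ (proj₂ scaled))
    ρ₀≤ : ρ₀ ≤ ρ
    ρ₀≤ = ≤-trans (m≤m+n ρ₀ _) (proj₁ (proj₂ scaled))
    module Levels = Tw ρ ρ₀≤
    t : ℕ
    t = Levels.time j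
    module LG = LayeredGraph (Levels.gadget j) (Levels.realisation j) (Levels.guarantee j) n (fits ρ ρ₀≤ n lo)
    r< : 2 * r n t < (2 ^ ρ) ^ suc j
    r< = proj₂ (proj₂ bound-r) n ρ t (≤-trans (≤-trans (m≤m+n n-r n-β) (m≤n+m _ (2 ^ (ρ₁ * v)))) n≥)
           (≤-trans (≤-trans (m≤m+n ρ-r ρ-β) (m≤n+m _ ρ₀)) (proj₁ (proj₂ scaled))) hi (Levels.time≤ j)
    β< : 2 * β n t < (2 ^ ρ) ^ suc j
    β< = proj₂ (proj₂ bound-β) n ρ t (≤-trans (≤-trans (m≤n+m n-β n-r) (m≤n+m _ (2 ^ (ρ₁ * v)))) n≥)
           (≤-trans (≤-trans (m≤n+m ρ-β ρ-r) (m≤n+m _ ρ₀)) (proj₁ (proj₂ scaled))) hi (Levels.time≤ j)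
    budget : β n t + r n t < Levels.budget j
    budget = subst (β n t + r n t <_) (sym (Levels.budget≡ j)) (*-cancelˡ-< 2 _ _ (begin-strict
      2 * (β n t + r n t) ≡⟨ *-distribˡ-+ 2 (β n t) _ ⟩
      2 * β n t + 2 * r n t <⟨ +-mono-< β< r< ⟩
      (2 ^ ρ) ^ suc j + (2 ^ ρ) ^ suc j ≡⟨ cong (_+_ ((2 ^ ρ) ^ suc j)) (+-identityʳ _) ⟨
      2 * (2 ^ ρ) ^ suc j ∎))
      where open ≤-Reasoning

-- Diagonalisation: the loss 1/(m+1) in the exponent is taken for the largest level m whose
-- threshold N m has been passed by n.
level : (ℕ → ℕ) → ℕ → ℕ → ℕ
level N n zero    = 0
level N n (suc b) = if ⌊ N (suc b) ≤? n ⌋ then suc b else level N n b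

level-passed : ∀ (N : ℕ → ℕ) n b → N 0 ≤ n → N (level N n b) ≤ n
level-passed N n zero N0≤ = N0≤
level-passed N n (suc b) N0≤ with N (suc b) ≤? n
... | yes le = le
... | no  _  = level-passed N n b N0≤

level-large : ∀ (N : ℕ → ℕ) n b a → a ≤ b → N a ≤ n → a ≤ level N n b
level-large N n zero    a a≤b Na≤ = a≤b
level-large N n (suc b) a a≤b Na≤ with N (suc b) ≤? n
... | yes _   = a≤b
... | no N≰n = level-large N n b a (s≤s⁻¹ (≤∧≢⇒< a≤b λ { refl → N≰n Na≤ })) Na≤

level-vanishing : ∀ N → Vanishing (λ n → ℚᵘ.mkℚᵘ (+ 1) (level N n n))
-- The search for the level ends at n, so n has to exceed both q + 1 and the threshold of that
-- level.
level-vanishing N (ℚᵘ.mkℚᵘ (+ suc p) q) _ = suc q + N (suc q) , λ n n≥ →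
  ℚᵘ.*<* (ℤ.+<+ (begin-strict
    1 * suc q ≡⟨ +-identityʳ (suc q) ⟩
    suc q ≤⟨ level-large N n n (suc q) (≤-trans (m≤m+n (suc q) _) n≥) (≤-trans (m≤n+m _ (suc q)) n≥) ⟩
    level N n n <⟨ n<1+n _ ⟩
    suc (level N n n) ≤⟨ m≤n*m (suc (level N n n)) (suc p) ⟩
    suc p * suc (level N n n) ∎))
  where open ≤-Reasoning

sublinear : ∀ (k : ℕ) .{{_ : NonZero k}} (f β r : ℕ → ℕ → ℕ) →
  (∀ n d → f n d ≤ d + r n d) → Sublinear k r → Sublinear k β →
  ∃[ c ] ∃[ δ ] Vanishing δ × (∃[ n₀ ] (∀ n → n ≥ n₀ →
    ∃[ G ] Unweighted G × (∀ (H : PairSet n) → IsHopsetᶠ G H (β n) (f n) → ⟨ n ^ sizeExponent k - δ n ⟩≤ c * ∣ H ∣)))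
sublinear zero {{k≢0}} = ⊥-elim (<-irrefl refl (>-nonZero⁻¹ 0 {{k≢0}}))
sublinear (suc j) f β r f≤ sub-r sub-β =
  -- From `N 0` on, at least level 0 has been passed, so the selected level always comes with its
  -- graph.
  1 , (λ n → ℚᵘ.mkℚᵘ (+ 1) (level N n n)) , level-vanishing N , N 0 , λ n n≥ →
    let G , unweighted , bound = proj₂ (at (level N n n)) n (level-passed N n n n≥)
    in G , unweighted , λ H hopset → restate n (level N n n) ∣ H ∣ (bound H hopset)
  where
  at = sublinear-at-level j f β r f≤ sub-r sub-β
  N : ℕ → ℕ
  N m = proj₁ (at m)
  d : ℕ
  d = 2 ^ suc j ∸ 1
  powers≡ : powers j ≡ d
  powers≡ = cong (_∸ 1) (suc-powers j)
  restate : ∀ n m h → n ^ (suc (powers j) * m + 1) ≤ h ^ (powers j * suc m) → ⟨ n ^ sizeExponent (suc j) - ℚᵘ.mkℚᵘ (+ 1) m ⟩≤ 1 * h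
  restate n m h le = ⟨⟩≤-intro (sizeExponent (suc j) - ℚᵘ.mkℚᵘ (+ 1) m) (suc d * m + 1) (d * suc m)
    (proj₁ (size-exponent d {{2^k∸1≢0 (suc j)}} m)) (proj₂ (size-exponent d {{2^k∸1≢0 (suc j)}} m))
    (subst₂ (λ K h → n ^ (suc K * m + 1) ≤ h ^ (K * suc m)) powers≡ (sym (+-identityʳ h)) le)

theorem1p7 : (∀ (C : ℕ) → ∃[ c ] ∃[ n₀ ] (∀ n → n ≥ n₀ →
    ∃[ G ] (∀ (H : PairSet n) (β : ℕ) → ∣ H ∣ ≤ C * n → IsHopset G H β 0ℚ →
    ⟨ n ^ + 1 / 3 ⟩≤ c * β)))
    ×
    (∀ (C : ℕ) → ∃[ c ] ∃[ n₀ ] (∀ n → n ≥ n₀ →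
    ∃[ G ] Unweighted G ×
    (∀ (H : PairSet n) (β : ℕ) → ∣ H ∣ ≤ C * n → IsHopset G H β 0ℚ →
    ⟨ n ^ + 1 / 5 ⟩≤ c * β)))
    ×
    (∀ (k : ℕ) .{{_ : NonZero k}} (f β r : ℕ → ℕ → ℕ) →
    (∀ n d → f n d ≤ d + r n d) → Sublinear k r → Sublinear k β →
    ∃[ c ] ∃[ δ ] Vanishing δ × (∃[ n₀ ] (∀ n → n ≥ n₀ →
    ∃[ G ] Unweighted G ×
    (∀ (H : PairSet n) → IsHopsetᶠ G H (β n) (f n) →
    ⟨ n ^ sizeExponent k - δ n ⟩≤ c * ∣ H ∣))))
theorem1p7 = weighted , unweighted , sublinear
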